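{- There is a (polynomial-time) $3$-approximation algorithm for the problem $$\min \sum_{i\in[k]} f(S_i)\quad\text{s.t. } S_1\uplus\cdots\uplus S_k\in\mathcal{F}\ \text{ and }\ S_i\neq\emptyset\ \text{ for all } i\in[k],$$ where $f$ is a non-negative monotone submodular function and $\mathcal{F}$ is the family of vertex covers of a graph.
   Context: The input is a finite graph $G$ with vertex set $V$, an integer $1\le k\le |V|$, and a function $f:2^V\to\mathbb{R}_+$ accessed through a value oracle (a query specifies $S\subseteq V$ and returns $f(S)$). $f$ is submodular if $f(A\cup\{v\})-f(A)\ge f(B\cup\{v\})-f(B)$ for all $A\subseteq B\subseteq V$, $v\notin B$, and monotone if $f(A)\le f(B)$ whenever $A\subseteq B\subseteq V$. A set $S\subseteq V$ is a vertex cover of $G$ if every edge of $G$ is incident on a vertex in $S$; $\mathcal{F}$ is the collection of all vertex covers of $G$. The symbol $\uplus$ denotes union of pairwise disjoint sets and $[k]=\{1,\dots,k\}$. An $\alpha$-approximation algorithm is an algorithm running in time polynomial in the input size (with oracle calls) that outputs a feasible solution of value at most $\alpha$ times the optimal value. -}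

module Defs where

open import Level using (Level; _⊔_) renaming (suc to lsuc)
open import Algebra.Bundles using (CommutativeRing)
open import Algebra.Structures using (IsCommutativeRing)
open import Data.Bool using (Bool; true; false; not; _∧_; if_then_else_)
open import Data.Fin using (Fin; toℕ; fromℕ<)
open import Data.Fin.Subset using (Subset; _∈_; _∉_; _⊆_; _∪_; _∩_; ⁅_⁆; ⋃; Empty; Nonempty)
import Data.List as List
open import Data.Nat using (ℕ; suc; _^_)
import Data.Nat as ℕ
open import Data.Product using (_×_; _,_; proj₁; proj₂; ∃-syntax)
open import Data.Sum using (_⊎_)
open import Data.Vec using (tabulate)
open import Relation.Binary.Core using (Rel)
open import Relation.Binary.Structures using (IsDecTotalOrder)
open import Relation.Binary.PropositionalEquality using (_≡_; _≢_)
open import Relation.Nullary using (¬_; yes; no; does)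

-- The values of f lie in an arbitrary ordered field, ℝ in particular.  The order
-- is decidable because a real RAM branches on comparisons.
record OrderedField (c ℓ₁ ℓ₂ : Level) : Set (lsuc (c ⊔ ℓ₁ ⊔ ℓ₂)) where
  infix  4 _≈_ _≤_
  infixl 6 _+_
  infixl 7 _*_
  field
    Carrier           : Set c
    _≈_               : Rel Carrier ℓ₁
    _≤_               : Rel Carrier ℓ₂
    _+_ _*_           : Carrier → Carrier → Carrier
    -_                : Carrier → Carrier
    0# 1#             : Carrier
    isCommutativeRing : IsCommutativeRing _≈_ _+_ _*_ -_ 0# 1#
    isDecTotalOrder   : IsDecTotalOrder _≈_ _≤_
    0≉1               : ¬ (0# ≈ 1#)
    inverse           : ∀ x → ¬ (x ≈ 0#) → ∃[ y ] (x * y ≈ 1#)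
    +-monoʳ-≤         : ∀ x {y z} → y ≤ z → (x + y) ≤ (x + z)
    *-nonNegative     : ∀ {x y} → 0# ≤ x → 0# ≤ y → 0# ≤ (x * y)

  commutativeRing : CommutativeRing c ℓ₁
  commutativeRing = record { isCommutativeRing = isCommutativeRing }

  open CommutativeRing commutativeRing public using (_-_; +-rawMonoid)
  open import Algebra.Definitions.RawMonoid +-rawMonoid public using (sum)
  open IsDecTotalOrder isDecTotalOrder public using (_≟_; _≤?_)

  infixl 7 _/_
  -- Total, with x / 0 = 0.
  _/_ : Carrier → Carrier → Carrier
  x / y with y ≟ 0#
  ... | yes _  = 0#
  ... | no y≉0 = x * proj₁ (inverse y y≉0)

-- Loops and parallel edges are allowed.
record Graph : Set where
  field
    order     : ℕ
    edges     : ℕ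
    endpoints : Fin edges → Fin order × Fin order

IsVertexCover : (G : Graph) → Subset (Graph.order G) → Set
IsVertexCover G S = ∀ e → proj₁ (endpoints e) ∈ S ⊎ proj₂ (endpoints e) ∈ S
  where open Graph G

-- Programs for a RAM with two unbounded memories, one of natural numbers and
-- one of field elements, both addressed by natural numbers.  Naturals have no
-- multiplication and field elements have no rounding to naturals, since unit-cost
-- versions of these would make the unit-cost measure unreasonable.
infixl 6 _+ᴺ_ _∸ᴺ_ _+ᴿ_ _-ᴿ_
infixl 7 _*ᴿ_ _/ᴿ_
infix  4 _≤ᴺ_ _≤ᴿ_

data NatExp : Set where
  lit               : ℕ → NatExp
  order edges parts : NatExp                -- |V|, |E| and k
  endpoint₁ endpoint₂ : NatExp → NatExp     -- end vertices of the e-th edge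
  loadᴺ             : NatExp → NatExp
  _+ᴺ_ _∸ᴺ_         : NatExp → NatExp → NatExp

data FieldExp : Set where
  0ᴿ 1ᴿ               : FieldExp
  loadᴿ               : NatExp → FieldExp
  _+ᴿ_ _-ᴿ_ _*ᴿ_ _/ᴿ_ : FieldExp → FieldExp → FieldExp
  -- the value f(S), where S is stored as a characteristic vector in the |V|
  -- consecutive cells of the natural-number memory starting at the address
  query               : NatExp → FieldExp

data BoolExp : Set where
  _≤ᴺ_ : NatExp → NatExp → BoolExp
  _≤ᴿ_ : FieldExp → FieldExp → BoolExp
  ¬ᴮ_  : BoolExp → BoolExp
  _∧ᴮ_ : BoolExp → BoolExp → BoolExp

infix  3 _≔ᴺ_ _≔ᴿ_
infixr 2 _⨾_

data Program : Set where
  skip          : Program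
  _≔ᴺ_          : NatExp → NatExp → Program     -- address ≔ value
  _≔ᴿ_          : NatExp → FieldExp → Program
  _⨾_           : Program → Program → Program
  If_Then_Else_ : BoolExp → Program → Program → Program
  While_Do_     : BoolExp → Program → Program

_[_↦_] : ∀ {a} {A : Set a} → (ℕ → A) → ℕ → A → (ℕ → A)
(m [ i ↦ x ]) j = if does (j ℕ.≟ i) then x else m j

readSubset : ∀ n → (ℕ → ℕ) → ℕ → Subset n
readSubset n m a = tabulate λ v → not (does (m (a ℕ.+ toℕ v) ℕ.≟ 0))

module _ {c ℓ₁ ℓ₂} (R : OrderedField c ℓ₁ ℓ₂) where
  private module R = OrderedField R
  open R using (Carrier; _≈_; _≤_)

  module _ {n : ℕ} (f : Subset n → Carrier) where
    NonNegative : Set ℓ₂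
    NonNegative = ∀ A → R.0# ≤ f A

    Monotone : Set ℓ₂
    Monotone = ∀ A B → A ⊆ B → f A ≤ f B

    Submodular : Set ℓ₂
    Submodular = ∀ A B v → A ⊆ B → v ∉ B →
      (f (B ∪ ⁅ v ⁆) R.- f B) ≤ (f (A ∪ ⁅ v ⁆) R.- f A)

  record Instance : Set (c ⊔ ℓ₂) where
    field
      graph : Graph
    open Graph graph renaming (order to n; edges to m) public
    field
      k           : ℕ
      1≤k         : 1 ℕ.≤ k
      k≤n         : k ℕ.≤ n
      f           : Subset n → Carrier
      nonNegative : NonNegative f
      monotone    : Monotone f
      submodular  : Submodular f

    size : ℕ
    size = n ℕ.+ m

  module Problem (I : Instance) where
    open Instance I

    Solution : Set
    Solution = Fin k → Subset n

    Feasible : Solution → Set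
    Feasible S = (∀ i j → i ≢ j → Empty (S i ∩ S j))
               × IsVertexCover graph (⋃ (List.tabulate S))
               × (∀ i → Nonempty (S i))

    objective : Solution → Carrier
    objective S = R.sum λ i → f (S i)

    IsOptimalValue : Carrier → Set (ℓ₁ ⊔ ℓ₂)
    IsOptimalValue v = (∃[ S ] (Feasible S × objective S ≈ v))
                     × (∀ S → Feasible S → v ≤ objective S)

  record State : Set c where
    constructor ⟨_,_⟩
    field
      nat : ℕ → ℕ
      val : ℕ → Carrier

  initial : State
  initial = ⟨ (λ _ → 0) , (λ _ → R.0#) ⟩

  module Semantics (I : Instance) where
    open Instance I
    open State

    -- 0 if there is no e-th edge.
    endpointOf : (Fin n × Fin n → Fin n) → ℕ → ℕ
    endpointOf π e with e ℕ.<? m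
    ... | yes e<m = toℕ (π (endpoints (fromℕ< e<m)))
    ... | no _    = 0

    ⟦_⟧ᴺ : NatExp → State → ℕ
    ⟦ lit x       ⟧ᴺ σ = x
    ⟦ order       ⟧ᴺ σ = n
    ⟦ edges       ⟧ᴺ σ = m
    ⟦ parts       ⟧ᴺ σ = k
    ⟦ endpoint₁ e ⟧ᴺ σ = endpointOf proj₁ (⟦ e ⟧ᴺ σ)
    ⟦ endpoint₂ e ⟧ᴺ σ = endpointOf proj₂ (⟦ e ⟧ᴺ σ)
    ⟦ loadᴺ a     ⟧ᴺ σ = nat σ (⟦ a ⟧ᴺ σ)
    ⟦ x +ᴺ y      ⟧ᴺ σ = ⟦ x ⟧ᴺ σ ℕ.+ ⟦ y ⟧ᴺ σ
    ⟦ x ∸ᴺ y      ⟧ᴺ σ = ⟦ x ⟧ᴺ σ ℕ.∸ ⟦ y ⟧ᴺ σ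

    ⟦_⟧ᴿ : FieldExp → State → Carrier
    ⟦ 0ᴿ      ⟧ᴿ σ = R.0#
    ⟦ 1ᴿ      ⟧ᴿ σ = R.1#
    ⟦ loadᴿ a ⟧ᴿ σ = val σ (⟦ a ⟧ᴺ σ)
    ⟦ x +ᴿ y  ⟧ᴿ σ = ⟦ x ⟧ᴿ σ R.+ ⟦ y ⟧ᴿ σ
    ⟦ x -ᴿ y  ⟧ᴿ σ = ⟦ x ⟧ᴿ σ R.- ⟦ y ⟧ᴿ σ
    ⟦ x *ᴿ y  ⟧ᴿ σ = ⟦ x ⟧ᴿ σ R.* ⟦ y ⟧ᴿ σ
    ⟦ x /ᴿ y  ⟧ᴿ σ = ⟦ x ⟧ᴿ σ R./ ⟦ y ⟧ᴿ σ
    ⟦ query a ⟧ᴿ σ = f (readSubset n (nat σ) (⟦ a ⟧ᴺ σ))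

    ⟦_⟧ᴮ : BoolExp → State → Bool
    ⟦ x ≤ᴺ y ⟧ᴮ σ = does (⟦ x ⟧ᴺ σ ℕ.≤? ⟦ y ⟧ᴺ σ)
    ⟦ x ≤ᴿ y ⟧ᴮ σ = does (⟦ x ⟧ᴿ σ R.≤? ⟦ y ⟧ᴿ σ)
    ⟦ ¬ᴮ b   ⟧ᴮ σ = not (⟦ b ⟧ᴮ σ)
    ⟦ b ∧ᴮ d ⟧ᴮ σ = ⟦ b ⟧ᴮ σ ∧ ⟦ d ⟧ᴮ σ

    infix 1 _,_⇓[_]_

    -- P , σ ⇓[ t ] τ: from σ, P halts in τ after t steps.  Assignments and
    -- tests cost one step each; the expressions in them have a size fixed by
    -- the program, so this is the unit-cost measure up to a constant factor.
    data _,_⇓[_]_ : Program → State → ℕ → State → Set c where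
      skip : ∀ {σ} → skip , σ ⇓[ 1 ] σ
      assignᴺ : ∀ {a x σ} →
        (a ≔ᴺ x) , σ ⇓[ 1 ] ⟨ nat σ [ ⟦ a ⟧ᴺ σ ↦ ⟦ x ⟧ᴺ σ ] , val σ ⟩
      assignᴿ : ∀ {a x σ} →
        (a ≔ᴿ x) , σ ⇓[ 1 ] ⟨ nat σ , val σ [ ⟦ a ⟧ᴺ σ ↦ ⟦ x ⟧ᴿ σ ] ⟩
      seq : ∀ {P Q σ τ υ s t} →
        P , σ ⇓[ s ] τ → Q , τ ⇓[ t ] υ → (P ⨾ Q) , σ ⇓[ s ℕ.+ t ] υ
      if-true : ∀ {b P Q σ τ t} → ⟦ b ⟧ᴮ σ ≡ true →
        P , σ ⇓[ t ] τ → (If b Then P Else Q) , σ ⇓[ suc t ] τ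
      if-false : ∀ {b P Q σ τ t} → ⟦ b ⟧ᴮ σ ≡ false →
        Q , σ ⇓[ t ] τ → (If b Then P Else Q) , σ ⇓[ suc t ] τ
      while-true : ∀ {b P σ τ υ s t} → ⟦ b ⟧ᴮ σ ≡ true →
        P , σ ⇓[ s ] τ → (While b Do P) , τ ⇓[ t ] υ →
        (While b Do P) , σ ⇓[ suc (s ℕ.+ t) ] υ
      while-false : ∀ {b P σ} → ⟦ b ⟧ᴮ σ ≡ false →
        (While b Do P) , σ ⇓[ 1 ] σ

    -- The characteristic vectors of S₁, …, S_k, one after the other.
    output : State → Problem.Solution I
    output σ i = readSubset n (nat σ) (toℕ i ℕ.* n)

  -- Every size is at least 1, so C * size ^ d covers all polynomial bounds.
  IsApproximationAlgorithm : Carrier → Program → Set (c ⊔ ℓ₁ ⊔ ℓ₂)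
  IsApproximationAlgorithm α P = ∃[ C ] ∃[ d ] ∀ (I : Instance) →
    let open Instance I using (size); open Problem I; open Semantics I in
    ∃[ t ] ∃[ σ ] ( (P , initial ⇓[ t ] σ)
                  × t ℕ.≤ C ℕ.* size ^ d
                  × Feasible (output σ)
                  × (∀ v → IsOptimalValue v → objective (output σ) ≤ α R.* v))

{-# OPTIONS --safe #-}
module Submission where

open import Defs
open import Algebra.Bundles using (CommutativeRing)
import Algebra.Properties.CommutativeMonoid.Sum as SumProperties
import Algebra.Solver.Ring as RingSolver
open import Algebra.Solver.Ring.AlmostCommutativeRing using (fromCommutativeRing; _-Raw-AlmostCommutative⟶_)
open import Data.Bool using (Bool; true; false; not; _∧_)
open import Data.Bool.Properties using (∨-identityʳ; ∨-zeroʳ)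
open import Data.Fin as Fin using (Fin; zero; suc; toℕ; punchIn)
import Data.Fin.Properties as Finₚ
open import Data.Fin.Subset using (Subset; _∈_; _∉_; _⊆_; _∪_; _∩_; ⁅_⁆; ⋃; ⊥; Empty; inside; outside)
open import Data.Fin.Subset.Properties
open import Data.Integer as ℤ using (ℤ; +_; -[1+_])
import Data.Integer.Properties as ℤₚ
open import Data.List as List using (List; []; _∷_)
open import Data.List.Membership.Propositional using () renaming (_∈_ to _∈ₗ_)
open import Data.List.Membership.Propositional.Properties using (∈-filter⁺; ∈-filter⁻; ∈-allFin)
import Data.List.Relation.Unary.Any as Any
import Data.Maybe as Maybe
open import Data.Nat as ℕ using (ℕ; zero; suc; s≤s; z≤n)
import Data.Nat.Properties as ℕₚ
open import Data.Product using (_×_; _,_; proj₁; proj₂; ∃-syntax)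
open import Data.Sum as Sum using (_⊎_; inj₁; inj₂; [_,_]′)
open import Data.Vec using (_∷_; lookup; _[_]≔_)
open import Data.Vec.Functional using () renaming (_∷_ to _◂_)
import Data.Vec.Properties as Vecₚ
open import Function using (_∘_)
open import Function.Definitions using (Injective)
open import Level using (Level; _⊔_)
open import Relation.Binary.PropositionalEquality using (_≡_; _≢_; refl; cong; cong₂; sym; trans; subst; subst₂)
import Relation.Binary.Reasoning.Setoid as SetoidReasoning
open import Relation.Binary.Structures using (IsDecTotalOrder)
open import Relation.Nullary using (¬_; Dec; yes; no; does; contradiction)
open import Relation.Nullary.Decidable using (dec-true; dec-false; dec⇒maybe)

-- Vertex cover: keep a random set X (finitely many weighted scenarios) and a set
-- C ⊆ X. For an edge {u, v} let a be the expected cost of inserting u into X, and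
-- suppose that inserting v costs at least a. Insert v into part of the scenarios, at
-- expected cost exactly a (splitting one scenario if necessary), and then u into all
-- of them and into C. By submodularity E[2 f(X ∪ K) - f(X)] does not increase, for
-- any cover K of {u, v}. It is 2 f(K) - f(∅) at first, so that in the end
-- f(C) ≤ E[f(X)] ≤ E[2 f(X ∪ K) - f(X)] ≤ 2 f(K).
-- Parts: the k cheapest vertices cost at most the optimum, as every optimal part owns
-- a vertex. Make each of them a part, and add the rest of C to the first part.

-- The quantity `potential K` is f(X) + 2 (f(X ∪ K) - f(X)): the cost so far plus twice what K would
-- still add. It must not grow although the algorithm does not know which end vertex K contains, and
-- the two possibilities pull in opposite directions. If u ∈ K, then inserting u everywhere leaves
-- f(X ∪ K) alone and earns a, so v may cost at most a. If v ∈ K, then the insertion of u may raise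
-- the potential by a, and the partial insertion of v has to earn this back, so v must cost at least
-- a. Hence its cost has to be a exactly. Whole scenarios need not add up to a, which is why one of
-- them is split, by a division. The scenarios play the part of a fractional solution of a convex
-- relaxation. They are computed by finitely many exact field operations instead of a minimisation,
-- and this works in every ordered field. As each edge adds one scenario, there are |E| + 1 of them
-- in the end.

module IntegerCoefficients {c ℓ} (A : CommutativeRing c ℓ) where
  open CommutativeRing A renaming (refl to ≈-refl; sym to ≈-sym; trans to ≈-trans)
  open import Algebra.Properties.Semiring.Mult semiring renaming (_×_ to _·_)
  open import Algebra.Properties.Ring ring
  open import Algebra.Properties.AbelianGroup +-abelianGroup using (⁻¹-∙-comm)
  open SetoidReasoning setoid

  -- The canonical homomorphism lets the solver compare coefficients in ℤ, where equality is
  -- decidable, so that cancellation is found in an abstract ring. Later goals use only the constant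
  -- `con (+ 0)`: `fromℤ (+ 0)` reduces to `0#`, but `fromℤ (+ 1)` to `1# + 0#`, so `1#` is passed
  -- to the solver as a variable.
  fromℤ : ℤ → Carrier
  fromℤ (+ n)    = n · 1#
  fromℤ -[1+ n ] = - (suc n · 1#)

  fromℤ-⊖ : ∀ m n → fromℤ (m ℤ.⊖ n) ≈ m · 1# - n · 1#
  fromℤ-⊖ zero    zero    = ≈-sym (-‿inverseʳ 0#)
  fromℤ-⊖ zero    (suc n) = ≈-sym (+-identityˡ _)
  fromℤ-⊖ (suc m) zero    = ≈-sym (≈-trans (+-congˡ -0#≈0#) (+-identityʳ _))
  fromℤ-⊖ (suc m) (suc n) = begin
    fromℤ (suc m ℤ.⊖ suc n)              ≡⟨ cong fromℤ (ℤₚ.[1+m]⊖[1+n]≡m⊖n m n) ⟩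
    fromℤ (m ℤ.⊖ n)                      ≈⟨ fromℤ-⊖ m n ⟩
    m · 1# - n · 1#                      ≈⟨ +-congʳ (+-identityˡ _) ⟨
    0# + m · 1# - n · 1#                 ≈⟨ +-congʳ (+-congʳ (-‿inverseʳ 1#)) ⟨
    1# - 1# + m · 1# - n · 1#            ≈⟨ +-congʳ (+-assoc _ _ _) ⟩
    1# + (- 1# + m · 1#) - n · 1#        ≈⟨ +-congʳ (+-congˡ (+-comm _ _)) ⟩
    1# + (m · 1# - 1#) - n · 1#          ≈⟨ +-congʳ (+-assoc _ _ _) ⟨
    1# + m · 1# - 1# - n · 1#            ≈⟨ +-assoc _ _ _ ⟩
    1# + m · 1# + (- 1# - n · 1#)        ≈⟨ +-congˡ (⁻¹-∙-comm _ _) ⟩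
    suc m · 1# - suc n · 1#              ∎

  fromℤ-+ : ∀ i j → fromℤ (i ℤ.+ j) ≈ fromℤ i + fromℤ j
  fromℤ-+ (+ m)    (+ n)    = ×-homo-+ 1# m n
  fromℤ-+ (+ m)    -[1+ n ] = fromℤ-⊖ m (suc n)
  fromℤ-+ -[1+ m ] (+ n)    = ≈-trans (fromℤ-⊖ n (suc m)) (+-comm _ _)
  fromℤ-+ -[1+ m ] -[1+ n ] = begin
    - (suc (suc (m ℕ.+ n)) · 1#)      ≡⟨ cong (λ l → - (suc l · 1#)) (ℕₚ.+-suc m n) ⟨
    - ((suc m ℕ.+ suc n) · 1#)        ≈⟨ -‿cong (×-homo-+ 1# (suc m) (suc n)) ⟩
    - (suc m · 1# + suc n · 1#)       ≈⟨ ⁻¹-∙-comm _ _ ⟨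
    - (suc m · 1#) - (suc n · 1#)     ∎

  fromℤ-neg : ∀ i → fromℤ (ℤ.- i) ≈ - fromℤ i
  fromℤ-neg (+ zero)  = ≈-sym -0#≈0#
  fromℤ-neg (+ suc n) = ≈-refl
  fromℤ-neg -[1+ n ]  = ≈-sym (-‿involutive _)

  fromℤ-* : ∀ i j → fromℤ (i ℤ.* j) ≈ fromℤ i * fromℤ j
  fromℤ-* (+ m) (+ n) = begin
    fromℤ (+ m ℤ.* + n)         ≡⟨ cong fromℤ (ℤₚ.pos-* m n) ⟨
    (m ℕ.* n) · 1#              ≈⟨ ×1-homo-* m n ⟩
    (m · 1#) * (n · 1#)         ∎
  fromℤ-* (+ m) -[1+ n ] = begin
    fromℤ (+ m ℤ.* -[1+ n ])    ≡⟨ cong fromℤ (ℤₚ.neg-distribʳ-* (+ m) (+ suc n)) ⟨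
    fromℤ (ℤ.- (+ m ℤ.* + suc n)) ≈⟨ fromℤ-neg (+ m ℤ.* + suc n) ⟩
    - fromℤ (+ m ℤ.* + suc n)   ≈⟨ -‿cong (fromℤ-* (+ m) (+ suc n)) ⟩
    - ((m · 1#) * (suc n · 1#)) ≈⟨ -‿distribʳ-* _ _ ⟩
    (m · 1#) * - (suc n · 1#)   ∎
  fromℤ-* -[1+ m ] (+ n) = begin
    fromℤ (-[1+ m ] ℤ.* + n)    ≡⟨ cong fromℤ (ℤₚ.neg-distribˡ-* (+ suc m) (+ n)) ⟨
    fromℤ (ℤ.- (+ suc m ℤ.* + n)) ≈⟨ fromℤ-neg (+ suc m ℤ.* + n) ⟩
    - fromℤ (+ suc m ℤ.* + n)   ≈⟨ -‿cong (fromℤ-* (+ suc m) (+ n)) ⟩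
    - ((suc m · 1#) * (n · 1#)) ≈⟨ -‿distribˡ-* _ _ ⟩
    - (suc m · 1#) * (n · 1#)   ∎
  fromℤ-* -[1+ m ] -[1+ n ] = begin
    fromℤ (-[1+ m ] ℤ.* -[1+ n ])         ≈⟨ fromℤ-* (+ suc m) (+ suc n) ⟩
    (suc m · 1#) * (suc n · 1#)           ≈⟨ -‿involutive _ ⟨
    - - ((suc m · 1#) * (suc n · 1#))     ≈⟨ -‿cong (-‿distribˡ-* _ _) ⟩
    - (- (suc m · 1#) * (suc n · 1#))     ≈⟨ -‿distribʳ-* _ _ ⟩
    - (suc m · 1#) * - (suc n · 1#)       ∎

  morphism : ℤ.+-*-rawRing -Raw-AlmostCommutative⟶ fromCommutativeRing A
  morphism = record
    { ⟦_⟧    = fromℤ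
    ; +-homo = fromℤ-+
    ; *-homo = fromℤ-*
    ; -‿homo = fromℤ-neg
    ; 0-homo = ≈-refl
    ; 1-homo = +-identityʳ 1#
    }

  module Solver = RingSolver ℤ.+-*-rawRing (fromCommutativeRing A) morphism
    (λ i j → Maybe.map (λ i≡j → reflexive (cong fromℤ i≡j)) (dec⇒maybe (i ℤ.≟ j)))

-- Inequalities, division and finite sums in an ordered field

module Ordered {c ℓ₁ ℓ₂} (R : OrderedField c ℓ₁ ℓ₂) where
  open OrderedField R public
  open CommutativeRing commutativeRing public
    using (+-cong; +-congˡ; +-congʳ; *-cong; *-congˡ; *-congʳ; +-identityˡ; +-identityʳ; -‿cong;
           zeroˡ; zeroʳ; *-identityˡ; *-identityʳ; *-comm; +-comm)
    renaming (refl to ≈-refl; sym to ≈-sym; trans to ≈-trans; reflexive to ≈-reflexive)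
  open IsDecTotalOrder isDecTotalOrder public
    using (antisym; total; ≤-respˡ-≈; ≤-respʳ-≈)
    renaming (refl to ≤-refl; trans to ≤-trans; reflexive to ≤-reflexive)
  open IntegerCoefficients.Solver commutativeRing public
    using (solve; _:=_; _:+_; _:*_; _:-_; :-_; con)

  +-mono-≤ : ∀ {x y z w} → x ≤ y → z ≤ w → x + z ≤ y + w
  +-mono-≤ {x} {y} {z} {w} x≤y z≤w = ≤-trans (+-monoʳ-≤ x z≤w)
    (≤-respˡ-≈ (+-comm _ _) (≤-respʳ-≈ (+-comm _ _) (+-monoʳ-≤ w x≤y)))

  -- Linear arithmetic: any identity x + q = y + p turns p ≤ q into x ≤ y.
  ≤-by : ∀ {p q x y} → p ≤ q → x + q ≈ y + p → x ≤ y
  ≤-by {p} {q} {x} {y} p≤q eq =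
    ≤-respˡ-≈ (solve 2 (λ x q → (x :+ q) :- q := x) ≈-refl x q)
      (≤-respʳ-≈ (solve 3 (λ y p q → (y :+ q) :- q := y) ≈-refl y p q)
        (≤-respˡ-≈ (+-congʳ (≈-sym eq))
          (+-mono-≤ (+-monoʳ-≤ y p≤q) (≤-refl { - q}))))

  x≤y⇒0≤y-x : ∀ {x y} → x ≤ y → 0# ≤ y - x
  x≤y⇒0≤y-x {x} {y} x≤y = ≤-by x≤y (solve 2 (λ x y → con (+ 0) :+ y := (y :- x) :+ x) ≈-refl x y)

  *-monoˡ-≤ : ∀ {x y z} → 0# ≤ z → x ≤ y → z * x ≤ z * y
  *-monoˡ-≤ {x} {y} {z} 0≤z x≤y = ≤-by (*-nonNegative 0≤z (x≤y⇒0≤y-x x≤y))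
    (solve 3 (λ x y z → z :* x :+ z :* (y :- x) := z :* y :+ con (+ 0)) ≈-refl x y z)

  ≰⇒≥ : ∀ {x y} → ¬ (x ≤ y) → y ≤ x
  ≰⇒≥ {x} {y} x≰y with total x y
  ... | inj₁ x≤y = contradiction x≤y x≰y
  ... | inj₂ y≤x = y≤x

  0≤1 : 0# ≤ 1#
  0≤1 with total 0# 1#
  ... | inj₁ 0≤1 = 0≤1
  ... | inj₂ 1≤0 = ≤-respʳ-≈
    (≈-trans (solve 1 (λ x → (con (+ 0) :- x) :* (con (+ 0) :- x) := x :* x) ≈-refl 1#) (*-identityˡ 1#))
    (*-nonNegative (x≤y⇒0≤y-x 1≤0) (x≤y⇒0≤y-x 1≤0))

  0≤x∧xy≈1⇒0≤y : ∀ {x y} → 0# ≤ x → x * y ≈ 1# → 0# ≤ y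
  0≤x∧xy≈1⇒0≤y {x} {y} 0≤x xy≈1 with total 0# y
  ... | inj₁ 0≤y = 0≤y
  ... | inj₂ y≤0 = contradiction
    (antisym 0≤1 (≤-respˡ-≈ xy≈1 (≤-respʳ-≈ (zeroʳ x) (*-monoˡ-≤ 0≤x y≤0)))) 0≉1

  /-cancel : ∀ {x y} → ¬ (y ≈ 0#) → (x / y) * y ≈ x
  /-cancel {x} {y} y≉0 with y ≟ 0#
  ... | yes y≈0 = contradiction y≈0 y≉0
  ... | no y≉0′ with inverse y y≉0′
  ...   | z , yz≈1 = ≈-trans (solve 3 (λ x y z → x :* z :* y := x :* (y :* z)) ≈-refl x y z)
                       (≈-trans (*-congˡ yz≈1) (*-identityʳ x))

  /-nonNegative : ∀ {x y} → 0# ≤ x → 0# ≤ y → 0# ≤ x / y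
  /-nonNegative {x} {y} 0≤x 0≤y with y ≟ 0#
  ... | yes _ = ≤-refl
  ... | no y≉0 = *-nonNegative 0≤x (0≤x∧xy≈1⇒0≤y 0≤y (proj₂ (inverse y y≉0)))

  x≤zy⇒x/y≤z : ∀ {x y z} → 0# ≤ y → ¬ (y ≈ 0#) → x ≤ z * y → x / y ≤ z
  x≤zy⇒x/y≤z {x} {y} {z} 0≤y y≉0 x≤zy with y ≟ 0#
  ... | yes y≈0 = contradiction y≈0 y≉0
  ... | no y≉0′ with inverse y y≉0′
  ...   | w , yw≈1 = ≤-respˡ-≈ (*-comm w x) (≤-respʳ-≈
            (≈-trans (solve 3 (λ y z w → w :* (z :* y) := z :* (y :* w)) ≈-refl y z w)
              (≈-trans (*-congˡ yw≈1) (*-identityʳ z)))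
            (*-monoˡ-≤ (0≤x∧xy≈1⇒0≤y 0≤y yw≈1) x≤zy))

  Σ< : ℕ → (ℕ → Carrier) → Carrier
  Σ< zero    F = 0#
  Σ< (suc N) F = Σ< N F + F N

  Σ<-cong : ∀ N {F G} → (∀ i → i ℕ.< N → F i ≈ G i) → Σ< N F ≈ Σ< N G
  Σ<-cong zero    F≈G = ≈-refl
  Σ<-cong (suc N) F≈G =
    +-cong (Σ<-cong N λ i i<N → F≈G i (ℕₚ.m<n⇒m<1+n i<N)) (F≈G N ℕₚ.≤-refl)

  Σ<-mono : ∀ N {F G} → (∀ i → i ℕ.< N → F i ≤ G i) → Σ< N F ≤ Σ< N G
  Σ<-mono zero    F≤G = ≤-refl
  Σ<-mono (suc N) F≤G =
    +-mono-≤ (Σ<-mono N λ i i<N → F≤G i (ℕₚ.m<n⇒m<1+n i<N)) (F≤G N ℕₚ.≤-refl)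

  Σ<-- : ∀ N F G → Σ< N (λ i → F i - G i) ≈ Σ< N F - Σ< N G
  Σ<-- zero    F G = solve 0 (con (+ 0) := con (+ 0) :- con (+ 0)) ≈-refl
  Σ<-- (suc N) F G = ≈-trans (+-congʳ (Σ<-- N F G))
    (solve 4 (λ a b c d → (a :- b) :+ (c :- d) := (a :+ c) :- (b :+ d)) ≈-refl _ _ _ _)

  Σ<-+ : ∀ N F G → Σ< N (λ i → F i + G i) ≈ Σ< N F + Σ< N G
  Σ<-+ zero    F G = solve 0 (con (+ 0) := con (+ 0) :+ con (+ 0)) ≈-refl
  Σ<-+ (suc N) F G = ≈-trans (+-congʳ (Σ<-+ N F G))
    (solve 4 (λ a b c d → (a :+ b) :+ (c :+ d) := (a :+ c) :+ (b :+ d)) ≈-refl _ _ _ _)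

  Σ<-* : ∀ N F c → Σ< N (λ i → F i * c) ≈ Σ< N F * c
  Σ<-* zero    F c = ≈-sym (zeroˡ c)
  Σ<-* (suc N) F c = ≈-trans (+-congʳ (Σ<-* N F c))
    (solve 3 (λ a b c → a :* c :+ b :* c := (a :+ b) :* c) ≈-refl _ _ _)

  -- Both sides are the common sum over the indices other than j, plus F j and G j.
  Σ<-update : ∀ N {F G} j → j ℕ.< N → (∀ i → i ℕ.< N → i ≢ j → F i ≈ G i) →
    Σ< N F + G j ≈ Σ< N G + F j
  Σ<-update (suc N) {F} {G} j j<1+N F≈G with j ℕ.≟ N
  ... | yes refl = ≈-trans (+-congʳ (+-congʳ (Σ<-cong N λ i i<N → F≈G i (ℕₚ.m<n⇒m<1+n i<N) (ℕₚ.<⇒≢ i<N))))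
    (solve 3 (λ a b c → a :+ b :+ c := a :+ c :+ b) ≈-refl _ _ _)
  ... | no j≢N = ≈-trans (solve 3 (λ a b c → a :+ b :+ c := a :+ c :+ b) ≈-refl _ _ _)
    (≈-trans (+-cong (Σ<-update N j (ℕₚ.≤∧≢⇒< (ℕ.s≤s⁻¹ j<1+N) j≢N) λ i i<N → F≈G i (ℕₚ.m<n⇒m<1+n i<N)) (F≈G N ℕₚ.≤-refl λ N≡j → j≢N (sym N≡j)))
      (solve 3 (λ a b c → a :+ b :+ c := a :+ c :+ b) ≈-refl _ _ _))

-- Finite subsets and their expectations

module _ {n : ℕ} where
  ∪-lub : ∀ {A B C : Subset n} → A ⊆ C → B ⊆ C → A ∪ B ⊆ C
  ∪-lub {A} {B} A⊆C B⊆C x∈ = [ A⊆C , B⊆C ]′ (x∈p∪q⁻ A B x∈)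

  ⁅⁆-⊆ : ∀ {v} {A : Subset n} → v ∈ A → ⁅ v ⁆ ⊆ A
  ⁅⁆-⊆ {v} v∈A x∈ with refl ← x∈⁅y⁆⇒x≡y v x∈ = v∈A

  ∪-absorb : ∀ {A B : Subset n} → B ⊆ A → A ∪ B ≡ A
  ∪-absorb {A} {B} B⊆A = ⊆-antisym (∪-lub ⊆-refl B⊆A) (p⊆p∪q B)

  ∪-mono : ∀ {A B C D : Subset n} → A ⊆ C → B ⊆ D → A ∪ B ⊆ C ∪ D
  ∪-mono {A} {B} {C} {D} A⊆C B⊆D = ∪-lub (⊆-trans A⊆C (p⊆p∪q D)) (⊆-trans B⊆D (q⊆p∪q C D))

  ∪-swap : ∀ (A B C : Subset n) → (A ∪ B) ∪ C ≡ (A ∪ C) ∪ B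
  ∪-swap A B C = trans (∪-assoc A B C)
    (trans (cong (A ∪_) (∪-comm B C)) (sym (∪-assoc A C B)))

  v∈A∪⁅v⁆ : ∀ (A : Subset n) v → v ∈ A ∪ ⁅ v ⁆
  v∈A∪⁅v⁆ A v = q⊆p∪q A ⁅ v ⁆ (x∈⁅x⁆ v)

module Weighted {c ℓ₁ ℓ₂} (R : OrderedField c ℓ₁ ℓ₂) (n : ℕ) where
  open Ordered R

  -- A random subset: the weight of X i is w i.
  expectation : ℕ → (ℕ → Carrier) → (ℕ → Subset n) → (Subset n → Carrier) → Carrier
  expectation N w X h = Σ< N λ i → w i * h (X i)

  -- The test functions whose mean cannot grow when v is inserted into part of the weight.
  -- Quantifying over all of them lets one invariant serve both the potential and the event C ⊆ X.
  Decreasing : Fin n → (Subset n → Carrier) → Set ℓ₂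
  Decreasing v h = ∀ A → h (A ∪ ⁅ v ⁆) ≤ h A

  module Expectation (N : ℕ) (w : ℕ → Carrier) (X : ℕ → Subset n) where
    private E = expectation N w X

    E-mono : (∀ i → i ℕ.< N → 0# ≤ w i) → ∀ {h h′} → (∀ A → h A ≤ h′ A) → E h ≤ E h′
    E-mono 0≤w h≤h′ = Σ<-mono N λ i i<N → *-monoˡ-≤ (0≤w i i<N) (h≤h′ (X i))

    E-cong : ∀ {h h′} → (∀ A → h A ≈ h′ A) → E h ≈ E h′
    E-cong h≈h′ = Σ<-cong N λ i _ → *-congˡ (h≈h′ (X i))

    E-+ : ∀ h h′ → E (λ A → h A + h′ A) ≈ E h + E h′
    E-+ h h′ = ≈-trans
      (Σ<-cong N λ i _ → solve 3 (λ a b c → a :* (b :+ c) := a :* b :+ a :* c) ≈-refl _ _ _)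
      (Σ<-+ N _ _)

    E-- : ∀ h h′ → E (λ A → h A - h′ A) ≈ E h - E h′
    E-- h h′ = ≈-trans
      (Σ<-cong N λ i _ → solve 3 (λ a b c → a :* (b :- c) := a :* b :- a :* c) ≈-refl _ _ _)
      (Σ<-- N _ _)

    E-* : ∀ h x → E (λ A → h A * x) ≈ E h * x
    E-* h x = ≈-trans
      (Σ<-cong N λ i _ → solve 3 (λ a b c → a :* (b :* c) := a :* b :* c) ≈-refl _ _ _)
      (Σ<-* N _ x)

  -- E (minusIndicator C) ≤ - 1 says that C ⊆ X almost surely.
  minusIndicator : Subset n → Subset n → Carrier
  minusIndicator C A with C ⊆? A
  ... | yes _ = - 1#
  ... | no _  = 0#

  minusIndicator-⊆ : ∀ {C A} → C ⊆ A → minusIndicator C A ≡ - 1#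
  minusIndicator-⊆ {C} {A} C⊆A with C ⊆? A
  ... | yes _   = refl
  ... | no C⊈A  = contradiction (λ {x} → C⊆A {x}) C⊈A

  -1≤0 : - 1# ≤ 0#
  -1≤0 = ≤-by 0≤1 (solve 1 (λ x → :- x :+ x := con (+ 0) :+ con (+ 0)) ≈-refl 1#)

  minusIndicator-antitone : ∀ {C A D B} → (C ⊆ A → D ⊆ B) → minusIndicator D B ≤ minusIndicator C A
  minusIndicator-antitone {C} {A} {D} {B} imp with C ⊆? A | D ⊆? B
  ... | yes C⊆A | no D⊈B = contradiction (λ {x} → imp C⊆A {x}) D⊈B
  ... | yes _   | yes _  = ≤-refl
  ... | no _    | yes _  = -1≤0
  ... | no _    | no _   = ≤-refl

-- Submodularity and the potential of a random set

module SubmodularFunction {c ℓ₁ ℓ₂} (R : OrderedField c ℓ₁ ℓ₂) {n : ℕ}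
  (f : Subset n → OrderedField.Carrier R)
  (f-nonNegative : NonNegative R f) (f-monotone : Monotone R f) (f-submodular : Submodular R f) where
  open Ordered R
  open Weighted R n

  f-mono : ∀ {A B} → A ⊆ B → f A ≤ f B
  f-mono {A} {B} = f-monotone A B

  gain : Fin n → Subset n → Carrier
  gain v A = f (A ∪ ⁅ v ⁆) - f A

  gain-nonNegative : ∀ v A → 0# ≤ gain v A
  gain-nonNegative v A = x≤y⇒0≤y-x (f-mono (p⊆p∪q ⁅ v ⁆))

  -- Submodularity is assumed for v outside of B only; for v in B the gain at B is 0, and
  -- monotonicity suffices.
  gain-antitone : ∀ {A B} v → A ⊆ B → gain v B ≤ gain v A
  gain-antitone {A} {B} v A⊆B with v ∈? B
  ... | no v∉B  = f-submodular A B v A⊆B v∉B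
  ... | yes v∈B = ≤-respˡ-≈
    (≈-trans (solve 1 (λ x → con (+ 0) := x :- x) ≈-refl (f B))
      (+-congʳ (≈-reflexive (cong f (sym (∪-absorb (⁅⁆-⊆ v∈B)))))))
    (gain-nonNegative v A)

  -- For the random set X its mean stays below 2 f(K), for every vertex cover K.
  potential : Subset n → Subset n → Carrier
  potential K A = (f (A ∪ K) + f (A ∪ K)) - f A

  f≤potential : ∀ K A → f A ≤ potential K A
  f≤potential K A = ≤-by (+-mono-≤ (f-mono (p⊆p∪q {p = A} K)) (f-mono (p⊆p∪q {p = A} K)))
    (solve 2 (λ a k → a :+ (k :+ k) := ((k :+ k) :- a) :+ (a :+ a)) ≈-refl (f A) (f (A ∪ K)))

  module _ {N N′ : ℕ} {w w′ : ℕ → Carrier} {X Y : ℕ → Subset n}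
    (w′-nonNegative : ∀ i → i ℕ.< N′ → 0# ≤ w′ i) where
    private
      E  = expectation N w X
      E′ = expectation N′ w′ Y
      module E  = Expectation N w X
      module E′ = Expectation N′ w′ Y

    -- Y arises from X by adding v with part of the weight, at the total cost
    -- a; adding u everywhere also costs a.
    potential-step : ∀ {u v K a} → u ∈ K ⊎ v ∈ K →
      (∀ h → Decreasing v h → E′ h ≤ E h) → E′ f ≈ E f + a → E (gain u) ≈ a →
      E′ (λ A → potential K (A ∪ ⁅ u ⁆)) ≤ E (potential K)
    potential-step {u} {v} {K} {a} (inj₁ u∈K) E′≤E E′f≈ Egain≈ =
      ≤-by (E′≤E h h-decreasing)
        (≈-trans (+-cong (E′.E-cong λ A → solve 2 (λ p f → p := (p :- f) :+ f) ≈-refl (potential K (A ∪ ⁅ u ⁆)) (f A)) Eh≈)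
        (≈-trans (+-congʳ (E′.E-+ h f))
        (≈-trans (+-congʳ (+-congˡ E′f≈))
          (solve 4 (λ h f a p → (h :+ (f :+ a)) :+ ((p :- a) :- f) := p :+ h) ≈-refl (E′ h) (E f) a (E (potential K))))))
      where
      h : Subset n → Carrier
      h A = potential K (A ∪ ⁅ u ⁆) - f A
      u⊆K : ∀ A → (A ∪ ⁅ u ⁆) ∪ K ≡ A ∪ K
      u⊆K A = trans (∪-swap A ⁅ u ⁆ K) (∪-absorb (⁅⁆-⊆ (q⊆p∪q A K u∈K)))
      -- As u ∈ K, here h A = 2 f(A ∪ K) - f(A ∪ u) - f(A). Both A and A ∪ u lie in A ∪ K, so the
      -- two gains of v that are subtracted outweigh the doubled gain of v at A ∪ K.
      h-decreasing : Decreasing v h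
      h-decreasing A rewrite u⊆K (A ∪ ⁅ v ⁆) | u⊆K A | ∪-swap A ⁅ v ⁆ K | ∪-swap A ⁅ v ⁆ ⁅ u ⁆ =
        ≤-by (+-mono-≤ (gain-antitone {A} {A ∪ K} v (p⊆p∪q K))
                       (gain-antitone {A ∪ ⁅ u ⁆} {A ∪ K} v (∪-lub (p⊆p∪q K) (⁅⁆-⊆ (q⊆p∪q A K u∈K)))))
          (solve 6 (λ akv ak av a auv au →
            (((akv :+ akv) :- auv) :- av) :+ ((av :- a) :+ (auv :- au)) :=
            (((ak :+ ak) :- au) :- a) :+ ((akv :- ak) :+ (akv :- ak))) ≈-refl _ _ _ _ _ _)
      Eh≈ : E h ≈ (E (potential K) - a) - E f
      Eh≈ = ≈-trans (E.E-cong λ A → ≈-trans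
              (+-congʳ (+-congʳ (+-cong (≈-reflexive (cong f (u⊆K A))) (≈-reflexive (cong f (u⊆K A))))))
              (solve 3 (λ ak au a → ((ak :+ ak) :- au) :- a := (((ak :+ ak) :- a) :- (au :- a)) :- a) ≈-refl
                (f (A ∪ K)) (f (A ∪ ⁅ u ⁆)) (f A)))
        (≈-trans (E.E-- (λ A → potential K A - gain u A) f) (+-congʳ (≈-trans (E.E-- (potential K) (gain u)) (+-congˡ (-‿cong Egain≈)))))
    potential-step {u} {v} {K} {a} (inj₂ v∈K) E′≤E E′f≈ Egain≈ =
      ≤-trans (E′.E-mono w′-nonNegative {h′ = λ A → h A - f A} pot≤)
        (≤-by (E′≤E h h-decreasing)
          (≈-trans (+-cong (≈-trans (E′.E-- h f) (+-congˡ (-‿cong E′f≈))) Eh≈)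
            (solve 4 (λ h f a p → (h :- (f :+ a)) :+ ((p :+ a) :+ f) := p :+ h) ≈-refl (E′ h) (E f) a (E (potential K)))))
      where
      h : Subset n → Carrier
      h A = (potential K A + gain u A) + f A
      -- The doubled term grows by at most twice the gain of u at A, and the subtracted term by
      -- exactly that gain, which leaves one gain of u at A.
      pot≤ : ∀ A → potential K (A ∪ ⁅ u ⁆) ≤ h A - f A
      pot≤ A rewrite ∪-swap A ⁅ u ⁆ K =
        ≤-by (+-mono-≤ (gain-antitone {A} {A ∪ K} u (p⊆p∪q K)) (gain-antitone {A} {A ∪ K} u (p⊆p∪q K)))
          (solve 4 (λ aku ak au a →
            ((aku :+ aku) :- au) :+ ((au :- a) :+ (au :- a)) :=
            (((((ak :+ ak) :- a) :+ (au :- a)) :+ a) :- a) :+ ((aku :- ak) :+ (aku :- ak))) ≈-refl _ _ _ _)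
      -- Here h A is 2 f(A ∪ K) plus the gain of u at A. As v ∈ K, the first term ignores v, and the
      -- second is antitone.
      h-decreasing : Decreasing v h
      h-decreasing A rewrite ∪-swap A ⁅ v ⁆ K | ∪-absorb (⁅⁆-⊆ (q⊆p∪q A K v∈K)) | ∪-swap A ⁅ v ⁆ ⁅ u ⁆ =
        ≤-by (gain-antitone {A} {A ∪ ⁅ u ⁆} v (p⊆p∪q ⁅ u ⁆))
          (solve 5 (λ ak av a auv au →
            ((((ak :+ ak) :- av) :+ (auv :- av)) :+ av) :+ (av :- a) :=
            ((((ak :+ ak) :- a) :+ (au :- a)) :+ a) :+ (auv :- au)) ≈-refl _ _ _ _ _)
      Eh≈ : E h ≈ (E (potential K) + a) + E f
      Eh≈ = ≈-trans (E.E-+ (λ A → potential K A + gain u A) f) (+-congʳ (≈-trans (E.E-+ (potential K) (gain u)) (+-congˡ Egain≈)))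

  module _ {N : ℕ} {w : ℕ → Carrier} {X : ℕ → Subset n} (0≤w : ∀ i → i ℕ.< N → 0# ≤ w i) where
    private E = expectation N w X
    open Expectation N w X

    -- Scenarios that contain C cost at least f(C) by monotonicity and have total weight at least 1;
    -- all others cost at least 0.
    f≤E : ∀ {C} → E (minusIndicator C) ≤ - 1# → f C ≤ E f
    f≤E {C} almostSurely = ≤-trans
      (≤-by (*-monoˡ-≤ (f-nonNegative C) almostSurely)
        (≈-trans (+-congˡ (≈-trans (solve 2 (λ c i → c :* :- i := :- (c :* i)) ≈-refl (f C) 1#)
                                   (-‿cong (*-identityʳ (f C)))))
          (solve 2 (λ c e → c :- c := (con (+ 0) :- e :* c) :+ c :* e) ≈-refl (f C) (E (minusIndicator C)))))
      (≤-respˡ-≈ (≈-trans (E-- (λ _ → 0#) (λ A → minusIndicator C A * f C)) (+-cong Σ0 (-‿cong (E-* (minusIndicator C) (f C)))))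
        (E-mono 0≤w pointwise))
      where
      Σ0 : E (λ _ → 0#) ≈ 0#
      Σ0 = ≈-trans (E-cong {h = λ _ → 0#} {h′ = λ _ → 0# * 0#} λ _ → ≈-sym (zeroʳ 0#)) (≈-trans (E-* (λ _ → 0#) 0#) (zeroʳ _))
      pointwise : ∀ A → 0# - minusIndicator C A * f C ≤ f A
      pointwise A with C ⊆? A
      ... | yes C⊆A = ≤-respˡ-≈ (≈-trans (≈-sym (*-identityˡ (f C))) (solve 2 (λ i c → i :* c := con (+ 0) :- :- i :* c) ≈-refl 1# (f C))) (f-mono C⊆A)
      ... | no _    = ≤-respˡ-≈ (solve 1 (λ c → con (+ 0) := con (+ 0) :- con (+ 0) :* c) ≈-refl (f C)) (f-nonNegative A)

    cover-bound : ∀ {C K} → E (minusIndicator C) ≤ - 1# → E (potential K) ≤ f K + f K → f C ≤ f K + f K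
    cover-bound {C} {K} almostSurely bounded =
      ≤-trans (f≤E almostSurely) (≤-trans (E-mono 0≤w (f≤potential K)) bounded)

-- Subadditivity

module Subadditive {c ℓ₁ ℓ₂} (R : OrderedField c ℓ₁ ℓ₂) {n : ℕ}
  (f : Subset n → OrderedField.Carrier R)
  (f-nonNegative : NonNegative R f) (f-monotone : Monotone R f) (f-submodular : Submodular R f) where
  open Ordered R
  open SubmodularFunction R f f-nonNegative f-monotone f-submodular

  insertAll : Subset n → List (Fin n) → Subset n
  insertAll A []      = A
  insertAll A (v ∷ l) = insertAll A l ∪ ⁅ v ⁆

  insertAll-⊆ : ∀ {A B} l → A ⊆ B → (∀ {v} → v ∈ₗ l → v ∈ B) → insertAll A l ⊆ B
  insertAll-⊆ []      A⊆B l⊆B = A⊆B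
  insertAll-⊆ (v ∷ l) A⊆B l⊆B = ∪-lub (insertAll-⊆ l A⊆B (l⊆B ∘ Any.there)) (⁅⁆-⊆ (l⊆B (Any.here refl)))

  ⊆-insertAll : ∀ A l → A ⊆ insertAll A l
  ⊆-insertAll A []      = ⊆-refl
  ⊆-insertAll A (v ∷ l) = ⊆-trans (⊆-insertAll A l) (p⊆p∪q ⁅ v ⁆)

  ∈-insertAll : ∀ A {v} l → v ∈ₗ l → v ∈ insertAll A l
  ∈-insertAll A (v ∷ l) (Any.here refl) = v∈A∪⁅v⁆ (insertAll A l) v
  ∈-insertAll A (v ∷ l) (Any.there v∈l) = p⊆p∪q ⁅ v ⁆ (∈-insertAll A l v∈l)

  -- The gains telescope along the list, and at every stage the set grown from A lies inside the one
  -- grown from B.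
  insertAll-gain : ∀ {A B} l → A ⊆ B → f (insertAll B l) - f B ≤ f (insertAll A l) - f A
  insertAll-gain {A} {B} [] A⊆B = ≤-reflexive (solve 2 (λ a b → b :- b := a :- a) ≈-refl (f A) (f B))
  insertAll-gain {A} {B} (v ∷ l) A⊆B =
    ≤-by (+-mono-≤ (insertAll-gain l A⊆B)
                   (gain-antitone {insertAll A l} {insertAll B l} v
                     (insertAll-⊆ l (⊆-trans A⊆B (⊆-insertAll B l)) (∈-insertAll B l))))
      (solve 6 (λ a a′ a″ b b′ b″ → (b″ :- b) :+ ((a′ :- a) :+ (a″ :- a′)) :=
                                    (a″ :- a) :+ ((b′ :- b) :+ (b″ :- b′))) ≈-refl
        (f A) (f (insertAll A l)) (f (insertAll A (v ∷ l))) (f B) (f (insertAll B l)) (f (insertAll B (v ∷ l))))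

  -- The elements of B are inserted one by one into A and, for comparison, into ⊥. The latter gains
  -- at most f(B) - f(⊥), and f(⊥) is non-negative.
  f-subadditive : ∀ A B → f (A ∪ B) ≤ f A + f B
  f-subadditive A B = ≤-trans
    (f-mono (∪-lub (⊆-insertAll A l) λ x∈B → ∈-insertAll A l (∈-filter⁺ (_∈? B) (∈-allFin _) x∈B)))
    (≤-by (+-mono-≤ (insertAll-gain l (⊆-min A))
            (+-mono-≤ (f-mono (insertAll-⊆ {⊥} {B} l (⊆-min B) (proj₂ ∘ ∈-filter⁻ (_∈? B) {xs = List.allFin n})))
                      (f-nonNegative ⊥)))
      (solve 5 (λ al a bl b o → al :+ ((bl :- o) :+ (b :+ o)) := (a :+ b) :+ ((al :- a) :+ (bl :+ con (+ 0)))) ≈-refl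
        (f (insertAll A l)) (f A) (f (insertAll ⊥ l)) (f B) (f ⊥)))
    where l = List.filter (_∈? B) (List.allFin n)

  f-⋃ : ∀ {k} A (S : Fin k → Subset n) → f (A ∪ ⋃ (List.tabulate S)) ≤ f A + sum (f ∘ S)
  f-⋃ {zero} A S = ≤-reflexive (≈-trans (≈-reflexive (cong f (∪-identityʳ A))) (≈-sym (+-identityʳ (f A))))
  f-⋃ {suc k} A S = ≤-respˡ-≈ (≈-reflexive (cong f (∪-assoc A (S zero) _)))
    (≤-trans (f-⋃ (A ∪ S zero) (S ∘ suc))
      (≤-by (f-subadditive A (S zero))
        (solve 4 (λ a b c s → (c :+ s) :+ (a :+ b) := (a :+ (b :+ s)) :+ c) ≈-refl
          (f A) (f (S zero)) (f (A ∪ S zero)) (sum (f ∘ S ∘ suc)))))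

  -- The first set starts the accumulation in `f-⋃`. Starting from ⊥ would leave a term `f ⊥` on the
  -- right, which can be positive.
  f-⋃-nonEmpty : ∀ {k} (S : Fin k → Subset n) → 1 ℕ.≤ k → f (⋃ (List.tabulate S)) ≤ sum (f ∘ S)
  f-⋃-nonEmpty {suc k} S _ = f-⋃ (S zero) (S ∘ suc)

-- Greedy choice of the cheapest vertices

module Sums {c ℓ₁ ℓ₂} (R : OrderedField c ℓ₁ ℓ₂) where
  open Ordered R

  sum-mono : ∀ {k} {F G : Fin k → Carrier} → (∀ i → F i ≤ G i) → sum F ≤ sum G
  sum-mono {zero}  F≤G = ≤-refl
  sum-mono {suc k} F≤G = +-mono-≤ (F≤G zero) (sum-mono (F≤G ∘ suc))

  module _ {n : ℕ} (ω : Fin n → Carrier) where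
    Cheapest : ∀ {k} → (Fin k → Fin n) → Set ℓ₂
    Cheapest {k} t = ∀ (s : Fin k → Fin n) → Injective _≡_ _≡_ s → sum (ω ∘ t) ≤ sum (ω ∘ s)

    missed : ∀ {k} (t : Fin k → Fin n) (s : Fin (suc k) → Fin n) → Injective _≡_ _≡_ s →
      ∃[ l ] ¬ (∃[ j ] t j ≡ s l)
    missed {k} t s s-inj = Finₚ.¬∀⟶∃¬ (suc k) _ (λ l → Finₚ.any? λ j → t j Fin.≟ s l) λ hit →
      let (i , j , i<j , same) = Finₚ.pigeonhole ℕₚ.≤-refl (proj₁ ∘ hit)
      in Finₚ.<⇒≢ i<j (s-inj (trans (sym (proj₂ (hit i))) (trans (cong t same) (proj₂ (hit j)))))

    -- An exchange argument: a competitor with one more entry than t has an entry outside of t,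
    -- which costs at least as much as b. Without this entry it is still injective and competes with
    -- t.
    Cheapest-∷ : ∀ {k b} {t : Fin k → Fin n} → (∀ v → ¬ (∃[ j ] t j ≡ v) → ω b ≤ ω v) →
      Cheapest t → Cheapest (b ◂ t)
    Cheapest-∷ {t = t} b-min t-cheapest s s-inj with missed t s s-inj
    ... | l , sl∉t = ≤-respʳ-≈ (≈-sym (SumProperties.sum-remove (CommutativeRing.+-commutativeMonoid commutativeRing) {i = l} (ω ∘ s)))
      (+-mono-≤ (b-min (s l) sl∉t)
        (t-cheapest (s ∘ punchIn l) (λ eq → Finₚ.punchIn-injective l _ _ (s-inj eq))))

-- The approximation factor

module Approximation {c ℓ₁ ℓ₂} (R : OrderedField c ℓ₁ ℓ₂) (I : Instance R) where
  open Ordered R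
  open Instance I
  open Problem R I
  open SubmodularFunction R f nonNegative monotone submodular
  open Subadditive R f nonNegative monotone submodular
  open Sums R

  -- The output: the k cheapest vertices are spread over the parts, and the
  -- rest of the cover C joins part 0.
  record Assigned (C : Subset n) (t : Fin k → Fin n) (S : Solution) : Set where
    field
      owner    : ∀ i → t i ∈ S i
      foreign  : ∀ i {x} → x ∈ S i → x ≡ t i ⊎ (toℕ i ≡ 0 × x ∈ C × ¬ (∃[ j ] t j ≡ x))
      complete : ∀ {x} → x ∈ C → (∃[ j ] t j ≡ x) ⊎ (∃[ i ] x ∈ S i)

  module _ {C : Subset n} {t : Fin k → Fin n} {S : Solution} (assigned : Assigned C t S) where
    open Assigned assigned

    ∈-⋃ : ∀ {m} (T : Fin m → Subset n) i {x} → x ∈ T i → x ∈ ⋃ (List.tabulate T)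
    ∈-⋃ T zero    x∈ = p⊆p∪q _ x∈
    ∈-⋃ T (suc i) x∈ = q⊆p∪q (T zero) _ (∈-⋃ (T ∘ suc) i x∈)

    assigned-feasible : Injective _≡_ _≡_ t → IsVertexCover graph C → Feasible S
    assigned-feasible t-inj C-cover = disjoint , covers , (λ i → t i , owner i)
      where
      disjoint : ∀ i j → i ≢ j → Empty (S i ∩ S j)
      disjoint i j i≢j (x , x∈) with x∈p∩q⁻ (S i) (S j) x∈
      ... | x∈Si , x∈Sj with foreign i x∈Si | foreign j x∈Sj
      ...   | inj₁ x≡ti | inj₁ x≡tj = i≢j (t-inj (trans (sym x≡ti) x≡tj))
      ...   | inj₁ x≡ti | inj₂ (_ , _ , x∉t) = x∉t (i , sym x≡ti)
      ...   | inj₂ (_ , _ , x∉t) | inj₁ x≡tj = x∉t (j , sym x≡tj)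
      ...   | inj₂ (i≡0 , _) | inj₂ (j≡0 , _) = i≢j (Finₚ.toℕ-injective (trans i≡0 (sym j≡0)))
      C⊆⋃ : ∀ {x} → x ∈ C → x ∈ ⋃ (List.tabulate S)
      C⊆⋃ x∈C with complete x∈C
      ... | inj₁ (j , refl) = ∈-⋃ S j (owner j)
      ... | inj₂ (i , x∈Si) = ∈-⋃ S i x∈Si
      covers : IsVertexCover graph (⋃ (List.tabulate S))
      covers e = Sum.map C⊆⋃ C⊆⋃ (C-cover e)

    private
      -- The number of parts is generalised from the field `k` to a variable, so that matching on it
      -- can single out part 0. Only this part absorbs vertices of C, hence f(C) is paid once.
      sum-≤ : ∀ {k′} (t′ : Fin k′ → Fin n) (S′ : Fin k′ → Subset n) →
        (∀ i {x} → x ∈ S′ i → x ≡ t′ i ⊎ (toℕ i ≡ 0 × x ∈ C)) →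
        sum (f ∘ S′) ≤ sum (f ∘ ⁅_⁆ ∘ t′) + f C
      sum-≤ {zero} t′ S′ ⊆ = ≤-respʳ-≈ (≈-sym (+-identityˡ (f C))) (nonNegative C)
      sum-≤ {suc k′} t′ S′ ⊆ = ≤-by
        (+-mono-≤
          (≤-trans (f-mono {S′ zero} {⁅ t′ zero ⁆ ∪ C} λ {x} x∈ → x∈p∪q⁺ (Sum.map (λ { refl → x∈⁅x⁆ x }) proj₂ (⊆ zero x∈)))
                   (f-subadditive ⁅ t′ zero ⁆ C))
          (sum-mono {F = f ∘ S′ ∘ suc} {G = f ∘ ⁅_⁆ ∘ t′ ∘ suc} λ i → f-mono λ {x} x∈ →
            [ (λ { refl → x∈⁅x⁆ x }) , (λ { (() , _) }) ]′ (⊆ (suc i) x∈)))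
        (solve 5 (λ s r a c b → (s :+ r) :+ ((a :+ c) :+ b) := ((a :+ b) :+ c) :+ (s :+ r)) ≈-refl _ _ _ _ _)

    -- The factor 3 is 1 + 2. The singletons cost at most the optimum. The union K of the optimal
    -- parts is a vertex cover with f(K) at most the optimum by subadditivity, and C costs at most
    -- twice f(K).
    assigned-objective : Cheapest (f ∘ ⁅_⁆) t → (∀ K → IsVertexCover graph K → f C ≤ f K + f K) →
      ∀ v → IsOptimalValue v → objective S ≤ ((1# + 1#) + 1#) * v
    assigned-objective t-cheapest C≤2K v ((S* , (S*-disjoint , S*-cover , S*-nonempty) , S*≈v) , _) =
      ≤-trans (sum-≤ t S λ i x∈ → Sum.map₂ (λ { (i≡0 , x∈C , _) → i≡0 , x∈C }) (foreign i x∈))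
        (≤-trans (+-mono-≤ T≤ (≤-trans (C≤2K K S*-cover) (+-mono-≤ K≤ K≤)))
          (≤-reflexive (≈-trans (+-cong S*≈v (+-cong S*≈v S*≈v))
            (≈-trans (+-cong 1v (+-cong 1v 1v))
              (solve 2 (λ i v → i :* v :+ (i :* v :+ i :* v) := ((i :+ i) :+ i) :* v) ≈-refl 1# v)))))
      where
      1v : v ≈ 1# * v
      1v = ≈-sym (*-identityˡ v)
      K = ⋃ (List.tabulate S*)
      K≤ : f K ≤ objective S*
      K≤ = f-⋃-nonEmpty S* 1≤k
      s : Fin k → Fin n
      s i = proj₁ (S*-nonempty i)
      s-inj : Injective _≡_ _≡_ s
      s-inj {i} {j} si≡sj with i Fin.≟ j
      ... | yes i≡j = i≡j
      ... | no i≢j  = contradiction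
        (s i , x∈p∩q⁺ (proj₂ (S*-nonempty i) , subst (_∈ S* j) (sym si≡sj) (proj₂ (S*-nonempty j))))
        (S*-disjoint i j i≢j)
      T≤ : sum (f ∘ ⁅_⁆ ∘ t) ≤ objective S*
      T≤ = ≤-trans (t-cheapest s s-inj) (sum-mono λ i → f-mono (⁅⁆-⊆ (proj₂ (S*-nonempty i))))

-- Memory updates and characteristic vectors

module _ {a} {A : Set a} (m : ℕ → A) where
  updated-same : ∀ i {x} → (m [ i ↦ x ]) i ≡ x
  updated-same i rewrite dec-true (i ℕ.≟ i) refl = refl

  updated-other : ∀ {i j x} → j ≢ i → (m [ i ↦ x ]) j ≡ m j
  updated-other {i} {j} j≢i rewrite dec-false (j ℕ.≟ i) j≢i = refl

  updated-back : ∀ i {x} j → ((m [ i ↦ x ]) [ i ↦ m i ]) j ≡ m j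
  updated-back i {x} j = by-cases (j ℕ.≟ i)
    where
    by-cases : Dec (j ≡ i) → ((m [ i ↦ x ]) [ i ↦ m i ]) j ≡ m j
    by-cases (yes refl) = updated-same′ j
      where
      updated-same′ : ∀ i → ((m [ i ↦ x ]) [ i ↦ m i ]) i ≡ m i
      updated-same′ i rewrite dec-true (i ℕ.≟ i) refl = refl
    by-cases (no j≢i) rewrite dec-false (j ℕ.≟ i) j≢i = refl

does⇒ : ∀ {p} {P : Set p} (d : Dec P) → does d ≡ true → P
does⇒ (yes p) _ = p

does⇒¬ : ∀ {p} {P : Set p} (d : Dec P) → does d ≡ false → ¬ P
does⇒¬ (no ¬p) _ = ¬p

[]≔-inside : ∀ {n} (A : Subset n) v → A [ v ]≔ inside ≡ A ∪ ⁅ v ⁆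
[]≔-inside (x ∷ A) zero    = cong₂ _∷_ (sym (∨-zeroʳ x)) (sym (∪-identityʳ A))
[]≔-inside (x ∷ A) (suc v) = cong₂ _∷_ (sym (∨-identityʳ x)) ([]≔-inside A v)

-- A tentative insertion is undone by writing the saved entry instead of `outside`, because v may
-- have belonged to A before.
insert-undo : ∀ {n} (A : Subset n) v → (A ∪ ⁅ v ⁆) [ v ]≔ lookup A v ≡ A
insert-undo A v = trans (cong (_[ v ]≔ lookup A v) (sym ([]≔-inside A v)))
  (trans (Vecₚ.[]≔-idempotent A v) (Vecₚ.[]≔-lookup A v))

subset-ext : ∀ {n} {A B : Subset n} → (∀ v → lookup A v ≡ lookup B v) → A ≡ B
subset-ext {A = A} {B} eq =
  trans (sym (Vecₚ.tabulate∘lookup A)) (trans (Vecₚ.tabulate-cong eq) (Vecₚ.tabulate∘lookup B))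

-- Counting loops and total correctness with time bounds

Loop : ℕ → NatExp → Program → Program
Loop c bound P =
  (lit c ≔ᴺ bound) ⨾
  (While (lit 1 ≤ᴺ loadᴺ (lit c)) Do ((lit c ≔ᴺ loadᴺ (lit c) ∸ᴺ lit 1) ⨾ P))

-- The outer 2 pays for the initial assignment and the final failing test, the inner 2 for the test
-- and the decrement of each iteration.
loopTime : ℕ → ℕ → ℕ
loopTime B T = 2 ℕ.+ B ℕ.* (2 ℕ.+ T)

module Machine {c ℓ₁ ℓ₂} (R : OrderedField c ℓ₁ ℓ₂) (I : Instance R) where
  open Instance I
  open Semantics R I public
  open State public
  open import Data.Nat using (_+_; _*_; _∸_; _≤_; _<_)

  private variable
    p q : Level
    P Q : Program
    σ : State R

  -- A total-correctness triple with an upper bound on the time. An exact time would not allow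
  -- branches of different lengths to be joined.
  Runs : Program → State R → ℕ → (State R → Set p) → Set (c ⊔ p)
  Runs P σ T Post = ∃[ t ] ∃[ τ ] ((P , σ ⇓[ t ] τ) × t ≤ T × Post τ)

  module _ {Post : State R → Set p} where
    assignᴺ-runs : ∀ {a x} → Post ⟨ nat σ [ ⟦ a ⟧ᴺ σ ↦ ⟦ x ⟧ᴺ σ ] , val σ ⟩ → Runs (a ≔ᴺ x) σ 1 Post
    assignᴺ-runs post = _ , _ , assignᴺ , ℕₚ.≤-refl , post

    assignᴿ-runs : ∀ {a x} → Post ⟨ nat σ , val σ [ ⟦ a ⟧ᴺ σ ↦ ⟦ x ⟧ᴿ σ ] ⟩ → Runs (a ≔ᴿ x) σ 1 Post
    assignᴿ-runs post = _ , _ , assignᴿ , ℕₚ.≤-refl , post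

    skip-runs : Post σ → Runs skip σ 1 Post
    skip-runs post = _ , _ , skip , ℕₚ.≤-refl , post

    seq-runs : ∀ {S T} {Mid : State R → Set q} → Runs P σ S Mid →
      (∀ τ → Mid τ → Runs Q τ T Post) → Runs (P ⨾ Q) σ (S + T) Post
    seq-runs (s , τ , P⇓ , s≤S , mid) next with next τ mid
    ... | t , υ , Q⇓ , t≤T , post = _ , _ , seq P⇓ Q⇓ , ℕₚ.+-mono-≤ s≤S t≤T , post

    infixr 3 assignᴺ-then_ assignᴿ-then_
    assignᴺ-then_ : ∀ {a x T} → Runs Q ⟨ nat σ [ ⟦ a ⟧ᴺ σ ↦ ⟦ x ⟧ᴺ σ ] , val σ ⟩ T Post →
      Runs ((a ≔ᴺ x) ⨾ Q) σ (suc T) Post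
    assignᴺ-then (t , υ , Q⇓ , t≤T , post) = _ , _ , seq assignᴺ Q⇓ , s≤s t≤T , post

    assignᴿ-then_ : ∀ {a x T} → Runs Q ⟨ nat σ , val σ [ ⟦ a ⟧ᴺ σ ↦ ⟦ x ⟧ᴿ σ ] ⟩ T Post →
      Runs ((a ≔ᴿ x) ⨾ Q) σ (suc T) Post
    assignᴿ-then (t , υ , Q⇓ , t≤T , post) = _ , _ , seq assignᴿ Q⇓ , s≤s t≤T , post

    if-runs : ∀ {b T} → (⟦ b ⟧ᴮ σ ≡ true → Runs P σ T Post) → (⟦ b ⟧ᴮ σ ≡ false → Runs Q σ T Post) →
      Runs (If b Then P Else Q) σ (suc T) Post
    if-runs {σ = σ} {b = b} yes-case no-case with ⟦ b ⟧ᴮ σ in eq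
    ... | true with yes-case refl
    ...   | t , τ , P⇓ , t≤T , post = _ , _ , if-true eq P⇓ , s≤s t≤T , post
    if-runs {b = b} yes-case no-case | false with no-case refl
    ...   | t , τ , Q⇓ , t≤T , post = _ , _ , if-false eq Q⇓ , s≤s t≤T , post

    weaken-runs : ∀ {S T} {Pre : State R → Set q} → S ≤ T → (∀ τ → Pre τ → Post τ) → Runs P σ S Pre → Runs P σ T Post
    weaken-runs S≤T imp (t , τ , P⇓ , t≤S , pre) = t , τ , P⇓ , ℕₚ.≤-trans t≤S S≤T , imp τ pre

  module _ (Inv : ℕ → State R → Set p) where
    private
      -- The decrement precedes the body, so the body sees the index i itself, running down to 0.
      -- The body has to return the counter unchanged, which is why its postcondition repeats the
      -- value.
      while-runs : ∀ {ct B T} j σ → nat σ ct ≡ j → Inv j σ →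
        (∀ i τ → i < j → nat τ ct ≡ suc i → Inv (suc i) τ →
          Runs B ⟨ nat τ [ ct ↦ i ] , val τ ⟩ T (λ υ → nat υ ct ≡ i × Inv i υ)) →
        Runs (While (lit 1 ≤ᴺ loadᴺ (lit ct)) Do ((lit ct ≔ᴺ loadᴺ (lit ct) ∸ᴺ lit 1) ⨾ B))
          σ (1 + j * (2 + T)) (Inv 0)
      while-runs zero σ σct≡ inv body = _ , _ , while-false (cong (λ x → does (1 ℕ.≤? x)) σct≡) , ℕₚ.≤-refl , inv
      while-runs {ct} {B} {T} (suc j) σ σct≡ inv body
        with body j σ ℕₚ.≤-refl σct≡ inv
      ... | s , τ , B⇓ , s≤T , τct≡ , inv′
        with while-runs j τ τct≡ inv′ (λ i υ i<j → body i υ (ℕₚ.m<n⇒m<1+n i<j))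
      ...   | t , υ , W⇓ , t≤ , post =
        _ , υ
        , while-true (cong (λ x → does (1 ℕ.≤? x)) σct≡)
            (seq assignᴺ (subst (λ x → B , ⟨ nat σ [ ct ↦ x ∸ 1 ] , val σ ⟩ ⇓[ s ] τ) (sym σct≡) B⇓)) W⇓
        , ℕₚ.≤-trans (s≤s (s≤s (ℕₚ.+-mono-≤ s≤T t≤))) (ℕₚ.≤-reflexive (lemma T (j * (2 + T)))) , post
        where
        lemma : ∀ T x → 2 + (T + (1 + x)) ≡ 1 + ((2 + T) + x)
        lemma T x = cong (2 ℕ.+_) (ℕₚ.+-suc T x)

    loop-runs : ∀ {ct bound B T σ} N M → ⟦ bound ⟧ᴺ σ ≡ N → N ≤ M →
      Inv N ⟨ nat σ [ ct ↦ N ] , val σ ⟩ →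
      (∀ j τ → j < N → nat τ ct ≡ suc j → Inv (suc j) τ →
        Runs B ⟨ nat τ [ ct ↦ j ] , val τ ⟩ T (λ υ → nat υ ct ≡ j × Inv j υ)) →
      Runs (Loop ct bound B) σ (loopTime M T) (Inv 0)
    loop-runs {ct} {T = T} {σ} N M refl N≤M inv body =
      weaken-runs (s≤s (s≤s (ℕₚ.*-monoˡ-≤ (2 + T) N≤M))) (λ _ post → post)
        (assignᴺ-then while-runs N _ (updated-same (nat σ) ct) inv body)

  -- The cells of the natural-number memory below 15 are registers; the others
  -- are seen as rows of n bits.
  row : (ℕ → ℕ) → ℕ → Subset n
  row m r = readSubset n m (15 + r * n)

  bit : ℕ → Bool
  bit x = not (does (x ℕ.≟ 0))

  lookup-row : ∀ m r v → lookup (row m r) v ≡ bit (m (15 + (r * n + toℕ v)))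
  lookup-row m r v = Vecₚ.lookup∘tabulate _ v

  row-cong : ∀ m m′ r → (∀ v → bit (m (15 + (r * n + toℕ v))) ≡ bit (m′ (15 + (r * n + toℕ v)))) → row m r ≡ row m′ r
  row-cong m m′ r eq = Vecₚ.tabulate-cong eq

  -- Uniqueness of the quotient in a division by n. It keeps different rows apart in memory.
  address-injective : ∀ r r′ {v v′} → v < n → v′ < n → r * n + v ≡ r′ * n + v′ → r ≡ r′
  address-injective zero    zero     v< v′< eq = refl
  address-injective (suc r) zero     v< v′< eq =
    contradiction (subst (_< n) (sym eq) v′<) (ℕₚ.≤⇒≯ (ℕₚ.≤-trans (ℕₚ.m≤m+n n (r * n)) (ℕₚ.m≤m+n _ _)))
  address-injective zero    (suc r′) v< v′< eq =
    contradiction (subst (_< n) eq v<) (ℕₚ.≤⇒≯ (ℕₚ.≤-trans (ℕₚ.m≤m+n n (r′ * n)) (ℕₚ.m≤m+n _ _)))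
  address-injective (suc r) (suc r′) v< v′< eq =
    cong suc (address-injective r r′ v< v′< (ℕₚ.+-cancelˡ-≡ n _ _
      (trans (sym (ℕₚ.+-assoc n _ _)) (trans eq (ℕₚ.+-assoc n _ _)))))

  -- An evaluated `cell` address consists of register contents p and x; the two equations translate
  -- it into a row and a vertex.
  module _ (m : ℕ → ℕ) {p x : ℕ} {r : ℕ} {v : Fin n} (p≡ : p ≡ r * n) (x≡ : x ≡ toℕ v) where
    row-write : ∀ y → row (m [ 15 + (p + x) ↦ y ]) r ≡ row m r [ v ]≔ bit y
    row-write y rewrite p≡ | x≡ = subset-ext λ w → trans (lookup-row (m [ 15 + (r * n + toℕ v) ↦ y ]) r w) (pointwise w)
      where
      pointwise : ∀ w → bit ((m [ 15 + (r * n + toℕ v) ↦ y ]) (15 + (r * n + toℕ w))) ≡ lookup (row m r [ v ]≔ bit y) w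
      pointwise w with w Fin.≟ v
      ... | yes refl = trans (cong bit (updated-same m (15 + (r * n + toℕ v)) {y})) (sym (Vecₚ.lookup∘updateAt v (row m r)))
      ... | no w≢v   = trans
        (cong bit (updated-other m {i = 15 + (r * n + toℕ v)} {x = y} λ eq → w≢v (Finₚ.toℕ-injective (ℕₚ.+-cancelˡ-≡ (15 + r * n) _ _ eq))))
        (trans (sym (lookup-row m r w)) (sym (Vecₚ.lookup∘updateAt′ w v w≢v (row m r))))

    row-insert : row (m [ 15 + (p + x) ↦ 1 ]) r ≡ row m r ∪ ⁅ v ⁆
    row-insert = trans (row-write 1) ([]≔-inside (row m r) v)

    row-other : ∀ y {r′} → r′ ≢ r → row (m [ 15 + (p + x) ↦ y ]) r′ ≡ row m r′
    row-other y {r′} r′≢r rewrite p≡ | x≡ = row-cong (m [ 15 + (r * n + toℕ v) ↦ y ]) m r′ λ w → cong bit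
      (updated-other m {i = 15 + (r * n + toℕ v)} {x = y} λ eq →
        r′≢r (address-injective r′ r (Finₚ.toℕ<n w) (Finₚ.toℕ<n v) (ℕₚ.+-cancelˡ-≡ 15 _ _ eq)))

    cell-bit : bit (m (15 + (p + x))) ≡ lookup (row m r) v
    cell-bit rewrite p≡ | x≡ = sym (lookup-row m r v)

  row-restore : ∀ m a y r → row ((m [ a ↦ y ]) [ a ↦ m a ]) r ≡ row m r
  row-restore m a y r = row-cong ((m [ a ↦ y ]) [ a ↦ m a ]) m r λ w → cong bit (updated-back m a {y} (15 + (r * n + toℕ w)))

-- Registers 2, …, 6 hold the addresses of rows (relative to cell 15):
--   2: the first output row k;  3: row 2k, the marked vertices;
--   4: row 2k + 1, always empty outside of queries;  5: row 2k + 2, the cover C;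
--   6: the first row after those of the scenarios, which start at row 2k + 3.
-- Register 7 is the number of scenarios, 9 and 10 hold vertices u and v, 12 is
-- the address of the current row, and 8, 11, 13 are loop counters.
-- Field cells 0, …, 3 are registers; the weight of scenario j is in cell 4 + j.
reg : ℕ → NatExp
reg i = loadᴺ (lit i)

value : ℕ → FieldExp
value i = loadᴿ (lit i)

cell : ℕ → ℕ → NatExp
cell p x = lit 15 +ᴺ (reg p +ᴺ reg x)

query-row : ℕ → FieldExp
query-row p = query (lit 15 +ᴺ reg p)

weight-cell : ℕ → NatExp
weight-cell j = lit 4 +ᴺ reg j

-- Adds vertex x to the current row and leaves the gain in field cell 3 and the
-- overwritten entry in register 14.
probe : ℕ → Program
probe x =
  (lit 2 ≔ᴿ query-row 12) ⨾
  (lit 14 ≔ᴺ loadᴺ (cell 12 x)) ⨾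
  (cell 12 x ≔ᴺ lit 1) ⨾
  (lit 3 ≔ᴿ query-row 12 -ᴿ value 2)

restore : ℕ → Program
restore x = cell 12 x ≔ᴺ reg 14

accumulate : ℕ → ℕ → Program
accumulate x acc =
  probe x ⨾ restore x ⨾ (lit acc ≔ᴿ value acc +ᴿ loadᴿ (weight-cell 11) *ᴿ value 3)

-- Without multiplication on naturals, the address of a row cannot be computed from the counter.
-- Register 12 starts behind the last scenario and loses `order` whenever the counter loses 1.
measure : Program
measure = (lit 12 ≔ᴺ reg 6) ⨾ Loop 11 (reg 7)
  ((lit 12 ≔ᴺ reg 12 ∸ᴺ order) ⨾ accumulate 9 0 ⨾ accumulate 10 1)

-- The expected cost of inserting each end vertex

module CoverPhase {c ℓ₁ ℓ₂} (R : OrderedField c ℓ₁ ℓ₂) (I : Instance R) where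
  open Ordered R
  open Instance I
  open Machine R I
  open Weighted R n
  open SubmodularFunction R f nonNegative monotone submodular

  -- The index is the first summand so that `scenarioRow (suc j)` reduces to `suc (scenarioRow j)`,
  -- the form in which `previous-row` moves the pointer.
  scenarioRow : ℕ → ℕ
  scenarioRow j = j ℕ.+ (3 ℕ.+ (k ℕ.+ k))

  scenario : (ℕ → ℕ) → ℕ → Subset n
  scenario m j = row m (scenarioRow j)

  weight : (ℕ → Carrier) → ℕ → Carrier
  weight w j = w (4 ℕ.+ j)

  mean : ℕ → State R → (Subset n → Carrier) → Carrier
  mean N σ = expectation N (weight (val σ)) (scenario (nat σ))

  AgreeBelow : ∀ {a} {A : Set a} → ℕ → (ℕ → A) → (ℕ → A) → Set a
  AgreeBelow l m m′ = ∀ i → i ℕ.< l → m i ≡ m′ i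

  agree-updated : ∀ {ℓ} {A : Set ℓ} {l} (m : ℕ → A) {a x} → l ℕ.≤ a → AgreeBelow l (m [ a ↦ x ]) m
  agree-updated m l≤a i i<l = updated-other m (ℕₚ.<⇒≢ (ℕₚ.<-≤-trans i<l l≤a))

  previous-row : ∀ {p r} → p ≡ suc r ℕ.* n → p ℕ.∸ n ≡ r ℕ.* n
  previous-row {r = r} refl = ℕₚ.m+n∸m≡n n (r ℕ.* n)

  record Probed (x r : ℕ) (v : Fin n) (σ τ : State R) : Set c where
    field
      agree     : AgreeBelow 14 (nat τ) (nat σ)
      here      : row (nat τ) r ≡ row (nat σ) r ∪ ⁅ v ⁆
      elsewhere : ∀ {r′} → r′ ≢ r → row (nat τ) r′ ≡ row (nat σ) r′
      restored  : ∀ r′ → row (nat τ [ 15 ℕ.+ (nat τ 12 ℕ.+ nat τ x) ↦ nat τ 14 ]) r′ ≡ row (nat σ) r′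
      old       : bit (nat τ 14) ≡ lookup (row (nat σ) r) v
      gain≡     : val τ 3 ≡ gain v (row (nat σ) r)
      values    : AgreeBelow 2 (val τ) (val σ)
      weights   : ∀ i → weight (val τ) i ≡ weight (val σ) i

  probe-runs : ∀ x {r v} σ → x ℕ.< 14 → nat σ 12 ≡ r ℕ.* n → nat σ x ≡ toℕ v →
    Runs (probe x) σ 4 (Probed x r v σ)
  probe-runs x {r} {v} ⟨ m , w ⟩ x<14 p≡ x≡ =
    assignᴿ-then assignᴺ-then assignᴺ-then assignᴿ-runs record
      { agree     = λ i i<14 → trans (agree-updated m₁ (ℕₚ.m≤m+n 14 _) i i<14) (agree-updated m ℕₚ.≤-refl i i<14)
      ; here      = row-insert m₁ {r = r} p≡ x₁≡
      ; elsewhere = row-other m₁ {r = r} {v} p≡ x₁≡ 1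
      ; restored  = λ r′ → trans
          (cong (λ y → row (m₂ [ 15 ℕ.+ (m 12 ℕ.+ y) ↦ m a ]) r′) (trans (agree-updated m₁ (ℕₚ.m≤m+n 14 _) x x<14) (agree-updated m ℕₚ.≤-refl x x<14)))
          (trans (cong (λ y → row (m₂ [ 15 ℕ.+ (m 12 ℕ.+ y) ↦ m a ]) r′) (sym (agree-updated m ℕₚ.≤-refl x x<14)))
            (trans (cong (λ y → row (m₂ [ a₁ ↦ m (15 ℕ.+ (m 12 ℕ.+ y)) ]) r′) (sym (agree-updated m ℕₚ.≤-refl x x<14))) (row-restore m₁ a₁ 1 r′)))
      ; old       = cell-bit m {r = r} p≡ x≡
      ; gain≡     = difference p≡ x₁≡
      ; values    = λ { zero _ → refl ; (suc zero) _ → refl ; (suc (suc _)) (s≤s (s≤s ())) }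
      ; weights   = λ _ → refl
      }
    where
    a = 15 ℕ.+ (m 12 ℕ.+ m x)
    m₁ = m [ 14 ↦ m a ]
    x₁≡ : m₁ x ≡ toℕ v
    x₁≡ = trans (agree-updated m ℕₚ.≤-refl x x<14) x≡
    a₁ = 15 ℕ.+ (m 12 ℕ.+ m₁ x)
    m₂ = m₁ [ a₁ ↦ 1 ]
    difference : ∀ {p y} → p ≡ r ℕ.* n → y ≡ toℕ v →
      f (readSubset n (m₁ [ 15 ℕ.+ (p ℕ.+ y) ↦ 1 ]) (15 ℕ.+ p)) - f (readSubset n m (15 ℕ.+ p)) ≡ gain v (row m r)
    difference refl refl = cong (λ A → f A - f (row m r)) (row-insert m₁ {r = r} {v} refl refl)

  record Accumulated (acc j : ℕ) (Δ : Carrier) (σ τ : State R) : Set c where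
    field
      agree   : AgreeBelow 14 (nat τ) (nat σ)
      rows    : ∀ r → row (nat τ) r ≡ row (nat σ) r
      result  : val τ acc ≡ val σ acc + weight (val σ) j * Δ
      other   : ∀ i → i ℕ.< 2 → i ≢ acc → val τ i ≡ val σ i
      weights : ∀ i → weight (val τ) i ≡ weight (val σ) i

  accumulate-runs : ∀ x acc {r v j} σ → x ℕ.< 14 → acc ℕ.< 2 → nat σ 12 ≡ r ℕ.* n → nat σ x ≡ toℕ v → nat σ 11 ≡ j →
    Runs (accumulate x acc) σ 6 (Accumulated acc j (gain v (row (nat σ) r)) σ)
  accumulate-runs x acc {r} {j = j} σ x<14 acc<2 p≡ x≡ refl =
    seq-runs (probe-runs x {r} σ x<14 p≡ x≡) λ τ probed → let open Probed probed in
      assignᴺ-then assignᴿ-runs record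
        { agree   = λ i i<14 → trans (agree-updated (nat τ) (ℕₚ.m≤m+n 14 _) i i<14) (agree i i<14)
        ; rows    = restored
        ; result  = trans (updated-same (val τ) acc)
            (cong₂ _+_ (values acc acc<2)
              (cong₂ _*_ (trans (cong (weight (val τ)) (agree 11 (ℕₚ.m≤m+n 12 2))) (weights (nat σ 11))) gain≡))
        ; other   = λ i i<2 i≢acc → trans (updated-other (val τ) i≢acc) (values i i<2)
        ; weights = λ i → trans (updated-other (val τ) (λ 4+i≡acc → ℕₚ.<⇒≱ acc<2 (subst (2 ℕ.≤_) 4+i≡acc (s≤s (s≤s z≤n))))) (weights i)
        }

  -- The loop counts down, so the scenarios still to be measured are those below j. The running sums
  -- are described by what they lack, namely the mean over these scenarios.
  record Measured (u v : Fin n) (N : ℕ) (σ : State R) (j : ℕ) (τ : State R) : Set (c ⊔ ℓ₁) where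
    field
      agree   : AgreeBelow 11 (nat τ) (nat σ)
      rows    : ∀ r → row (nat τ) r ≡ row (nat σ) r
      weights : ∀ i → weight (val τ) i ≡ weight (val σ) i
      pointer : nat τ 12 ≡ scenarioRow j ℕ.* n
      cost-u  : val τ 0 + mean j σ (gain u) ≈
                mean N σ (gain u)
      cost-v  : val τ 1 + mean j σ (gain v) ≈
                mean N σ (gain v)

  measure-runs : ∀ {u v N B} σ → N ℕ.≤ B → nat σ 6 ≡ scenarioRow N ℕ.* n → nat σ 7 ≡ N →
    nat σ 9 ≡ toℕ u → nat σ 10 ≡ toℕ v → val σ 0 ≡ 0# → val σ 1 ≡ 0# →
    Runs measure σ (suc (loopTime B 13)) (Measured u v N σ 0)
  measure-runs {u} {v} {N} σ N≤B σ6 σ7 σ9 σ10 σa σb =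
    assignᴺ-then loop-runs (Measured u v N σ) N _ σ7 N≤B
      record
        { agree = λ i i<11 → trans (agree-updated (nat σ [ 12 ↦ nat σ 6 ]) ℕₚ.≤-refl i i<11)
                                   (agree-updated (nat σ) (ℕₚ.n≤1+n 11) i i<11)
        ; rows = λ _ → refl ; weights = λ _ → refl ; pointer = σ6
        ; cost-u = ≈-trans (+-congʳ (≈-reflexive σa)) (+-identityˡ _)
        ; cost-v = ≈-trans (+-congʳ (≈-reflexive σb)) (+-identityˡ _) }
      body
    where
    body : ∀ j τ → j ℕ.< N → nat τ 11 ≡ suc j → Measured u v N σ (suc j) τ →
      Runs ((lit 12 ≔ᴺ reg 12 ∸ᴺ order) ⨾ accumulate 9 0 ⨾ accumulate 10 1) ⟨ nat τ [ 11 ↦ j ] , val τ ⟩ 13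
        (λ υ → nat υ 11 ≡ j × Measured u v N σ j υ)
    body j τ j<N _ inv =
      assignᴺ-then
      seq-runs (accumulate-runs 9 0 {scenarioRow j} {u} τ₀ (ℕₚ.m≤m+n 10 4) (s≤s z≤n) p≡ u≡ refl) λ τ₁ acc₁ →
      let module ₁ = Accumulated acc₁ in
      weaken-runs ℕₚ.≤-refl
        (λ τ₂ acc₂ → let module ₂ = Accumulated acc₂ in
          trans (₂.agree 11 (ℕₚ.m≤m+n 12 2)) (₁.agree 11 (ℕₚ.m≤m+n 12 2)) , record
          { agree   = λ i i<11 → let i<14 = ℕₚ.<-≤-trans i<11 (ℕₚ.m≤m+n 11 3) in
              trans (₂.agree i i<14) (trans (₁.agree i i<14)
                (trans (agree-updated (nat τ [ 11 ↦ j ]) (ℕₚ.n≤1+n 11) i i<11)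
                  (trans (agree-updated (nat τ) ℕₚ.≤-refl i i<11) (agree i i<11))))
          ; rows    = λ r → trans (₂.rows r) (trans (₁.rows r) (rows r))
          ; weights = λ i → trans (₂.weights i) (trans (₁.weights i) (weights i))
          ; pointer = trans (₂.agree 12 (ℕₚ.m≤m+n 13 1)) (trans (₁.agree 12 (ℕₚ.m≤m+n 13 1)) p≡)
          ; cost-u  = step (val τ 0) (weights j) (cong (gain u) (rows (scenarioRow j)))
                        (trans (₂.other 0 (s≤s z≤n) (λ ())) ₁.result) cost-u
          ; cost-v  = step (val τ 1) (trans (₁.weights j) (weights j))
                        (cong (gain v) (trans (₁.rows (scenarioRow j)) (rows (scenarioRow j))))
                        (trans ₂.result (cong (_+ weight (val τ₁) j * _) (₁.other 1 (s≤s (s≤s z≤n)) λ ()))) cost-v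
          })
        (accumulate-runs 10 1 {scenarioRow j} {v} τ₁ (ℕₚ.m≤m+n 11 3) (s≤s (s≤s z≤n))
          (trans (₁.agree 12 (ℕₚ.m≤m+n 13 1)) p≡) (trans (₁.agree 10 (ℕₚ.m≤m+n 11 3)) v≡) (₁.agree 11 (ℕₚ.m≤m+n 12 2)))
      where
      open Measured inv
      τ₀ : State R
      τ₀ = ⟨ (nat τ [ 11 ↦ j ]) [ 12 ↦ nat τ 12 ℕ.∸ n ] , val τ ⟩
      p≡ : nat τ 12 ℕ.∸ n ≡ scenarioRow j ℕ.* n
      p≡ = previous-row {r = scenarioRow j} pointer
      u≡ : nat τ 9 ≡ toℕ u
      u≡ = trans (agree 9 (ℕₚ.m≤m+n 10 1)) σ9
      v≡ : nat τ 10 ≡ toℕ v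
      v≡ = trans (agree 10 ℕₚ.≤-refl) σ10
      step : ∀ a {a′ w w′ g g′ s t} → w ≡ w′ → g ≡ g′ → a′ ≡ a + w * g → a + (s + w′ * g′) ≈ t → a′ + s ≈ t
      step a {w = w} {g = g} {s = s} refl refl refl eq =
        ≈-trans (solve 3 (λ a x s → (a :+ x) :+ s := a :+ (s :+ x)) ≈-refl a (w * g) s) eq

-- Partial insertion of v at a prescribed cost

copy-row : Program
copy-row = Loop 13 order (cell 6 13 ≔ᴺ loadᴺ (cell 12 13))

-- The current row still contains v from the preceding `probe` when it is copied. The copy is
-- therefore the part with v, and the `restore` that follows in `raise` returns the original to the
-- part without v.
split : Program
split =
  copy-row ⨾
  (weight-cell 7 ≔ᴿ value 0 /ᴿ value 3) ⨾
  (weight-cell 11 ≔ᴿ loadᴿ (weight-cell 11) -ᴿ loadᴿ (weight-cell 7)) ⨾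
  (lit 0 ≔ᴿ 0ᴿ)

-- Field cell 0 holds the budget.
raise : Program
raise = (lit 12 ≔ᴺ reg 6) ⨾ Loop 11 (reg 7)
  ((lit 12 ≔ᴺ reg 12 ∸ᴺ order) ⨾
   probe 10 ⨾
   (If loadᴿ (weight-cell 11) *ᴿ value 3 ≤ᴿ value 0
    Then (lit 0 ≔ᴿ value 0 -ᴿ loadᴿ (weight-cell 11) *ᴿ value 3)
    Else ((If value 0 ≤ᴿ 0ᴿ Then skip Else split) ⨾ restore 10)))

module Shift {c ℓ₁ ℓ₂} (R : OrderedField c ℓ₁ ℓ₂) (n : ℕ) where
  open Ordered R
  open Weighted R n

  module _ {N j : ℕ} {v : Fin n} {w w′ : ℕ → Carrier} {X X′ : ℕ → Subset n} where

    -- Vertex v is added in a part of weight s of scenario j.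
    Shifted : Carrier → Set (c ⊔ ℓ₁)
    Shifted s = ∀ h → expectation N w′ X′ h ≈ expectation N w X h + s * (h (X j ∪ ⁅ v ⁆) - h (X j))

  shifted-whole : ∀ {N j v w w′ X X′} → j ℕ.< N → (∀ i → w′ i ≡ w i) →
    X′ j ≡ X j ∪ ⁅ v ⁆ → (∀ i → i ≢ j → X′ i ≡ X i) → Shifted {N} {j} {v} {w} {w′} {X} {X′} (w j)
  shifted-whole {N} {j} {v} {w} {w′} {X} {X′} j<N w′≡w here elsewhere h =
    ≈-trans (solve 2 (λ x y → x := (x :+ y) :- y) ≈-refl (expectation N w′ X′ h) (w j * h (X j)))
      (≈-trans (+-congʳ (≈-trans
        (Σ<-update N {λ i → w′ i * h (X′ i)} {λ i → w i * h (X i)} j j<N λ i _ i≢j →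
          ≈-reflexive (cong₂ _*_ (w′≡w i) (cong h (elsewhere i i≢j))))
        (+-congˡ (≈-reflexive (cong₂ _*_ (w′≡w j) (cong h here))))))
        (solve 4 (λ e w a b → (e :+ w :* a) :- w :* b := e :+ w :* (a :- b)) ≈-refl (expectation N w X h) (w j) (h (X j ∪ ⁅ v ⁆)) (h (X j))))

  -- Slot N has weight 0 beforehand, so it can be counted in the old expectation whatever its row
  -- contains.
  shifted-split : ∀ {N j v w w′ X X′ s} → j ℕ.< N → w N ≈ 0# →
    w′ N ≡ s → w′ j ≡ w j - s → (∀ i → i ≢ j → i ≢ N → w′ i ≡ w i) →
    X′ N ≡ X j ∪ ⁅ v ⁆ → (∀ i → i ≢ N → X′ i ≡ X i) →
    Shifted {suc N} {j} {v} {w} {w′} {X} {X′} s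
  shifted-split {N} {j} {v} {w} {w′} {X} {X′} {s} j<N wN≈0 w′N w′j w′≡w here elsewhere h =
    ≈-trans (solve 3 (λ x y z → x :+ z := ((x :+ y) :- y) :+ z) ≈-refl (expectation N w′ X′ h) (w j * h (X j)) (w′ N * h (X′ N)))
      (≈-trans (+-cong
        (+-congʳ (≈-trans
          (Σ<-update N {λ i → w′ i * h (X′ i)} {λ i → w i * h (X i)} j j<N λ i i<N i≢j →
            ≈-reflexive (cong₂ _*_ (w′≡w i i≢j (ℕₚ.<⇒≢ i<N)) (cong h (elsewhere i (ℕₚ.<⇒≢ i<N)))))
          (+-congˡ (≈-reflexive (cong₂ _*_ w′j (cong h (elsewhere j (ℕₚ.<⇒≢ j<N))))))))
        (≈-reflexive (cong₂ _*_ w′N (cong h here))))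
      (≈-trans (solve 5 (λ e w a b s → ((e :+ (w :- s) :* b) :- w :* b) :+ s :* a := (e :+ con (+ 0)) :+ s :* (a :- b)) ≈-refl
                 (expectation N w X h) (w j) (h (X j ∪ ⁅ v ⁆)) (h (X j)) s)
        (+-congʳ (+-congˡ (≈-sym (≈-trans (*-congʳ wN≈0) (zeroˡ (h (X N)))))))))

module RowCopy {c ℓ₁ ℓ₂} (R : OrderedField c ℓ₁ ℓ₂) (I : Instance R) where
  open Instance I
  open Machine R I
  open CoverPhase R I

  record Copied (r r′ : ℕ) (σ : State R) (j : ℕ) (τ : State R) : Set c where
    field
      agree  : ∀ i → i ℕ.< 15 → i ≢ 13 → nat τ i ≡ nat σ i
      others : ∀ {i} → i ≢ r′ → row (nat τ) i ≡ row (nat σ) i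
      copied : ∀ x → j ℕ.≤ toℕ x → lookup (row (nat τ) r′) x ≡ lookup (row (nat σ) r) x
      val≡   : val τ ≡ val σ

  copy-runs : ∀ {r r′ B} σ → n ℕ.≤ B → r ≢ r′ → nat σ 12 ≡ r ℕ.* n → nat σ 6 ≡ r′ ℕ.* n →
    Runs copy-row σ (loopTime B 1) (Copied r r′ σ 0)
  copy-runs {r} {r′} σ n≤B r≢r′ p≡ q≡ = loop-runs (Copied r r′ σ) n _ refl n≤B
    record
      { agree = λ i _ i≢13 → updated-other (nat σ) i≢13 ; others = λ _ → refl ; val≡ = refl
      ; copied = λ x n≤x → contradiction (Finₚ.toℕ<n x) (ℕₚ.≤⇒≯ n≤x) }
    body
    where
    body : ∀ j τ → j ℕ.< n → nat τ 13 ≡ suc j → Copied r r′ σ (suc j) τ →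
      Runs (cell 6 13 ≔ᴺ loadᴺ (cell 12 13)) ⟨ nat τ [ 13 ↦ j ] , val τ ⟩ 1 (λ υ → nat υ 13 ≡ j × Copied r r′ σ j υ)
    body j τ j<n _ inv = assignᴺ-runs (refl , record
      { agree  = λ i i<15 i≢13 → trans (agree-updated μ {15 ℕ.+ (nat τ 6 ℕ.+ j)} (ℕₚ.m≤m+n 15 _) i i<15)
                                 (trans (updated-other (nat τ) i≢13) (agree i i<15 i≢13))
      ; others = λ {i} i≢r′ → trans (row-other μ {r = r′} {v} q₆ v≡ y i≢r′) (others i≢r′)
      ; copied = λ x j≤x → trans (cong (λ A → lookup A x) (row-write μ {r = r′} {v} q₆ v≡ y)) (pointwise x j≤x)
      ; val≡   = val≡ })
      where
      open Copied inv
      μ = nat τ [ 13 ↦ j ]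
      v = Fin.fromℕ< j<n
      v≡ : j ≡ toℕ v
      v≡ = sym (Finₚ.toℕ-fromℕ< j<n)
      y = nat τ (15 ℕ.+ (nat τ 12 ℕ.+ j))
      q₆ : nat τ 6 ≡ r′ ℕ.* n
      q₆ = trans (agree 6 (ℕₚ.m≤m+n 7 8) λ ()) q≡
      p₁₂ : nat τ 12 ≡ r ℕ.* n
      p₁₂ = trans (agree 12 (ℕₚ.m≤m+n 13 2) λ ()) p≡
      pointwise : ∀ x → j ℕ.≤ toℕ x → lookup (row (nat τ) r′ [ v ]≔ bit y) x ≡ lookup (row (nat σ) r) x
      pointwise x j≤x with x Fin.≟ v
      ... | yes refl = trans (Vecₚ.lookup∘updateAt v (row (nat τ) r′))
                         (trans (cell-bit (nat τ) {r = r} {v} p₁₂ v≡) (cong (λ A → lookup A v) (others r≢r′)))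
      ... | no x≢v   = trans (Vecₚ.lookup∘updateAt′ x v x≢v (row (nat τ) r′))
                         (copied x (ℕₚ.≤∧≢⇒< j≤x λ j≡x → x≢v (Finₚ.toℕ-injective (trans (sym j≡x) v≡))))

raiseBodyTime : ℕ → ℕ
raiseBodyTime B = suc (4 ℕ.+ suc (suc (loopTime B 1 ℕ.+ 3) ℕ.+ 1))

module RaiseLoop {c ℓ₁ ℓ₂} (R : OrderedField c ℓ₁ ℓ₂) (I : Instance R) where
  open Ordered R
  open Instance I
  open Machine R I
  open Weighted R n
  open SubmodularFunction R f nonNegative monotone submodular
  open CoverPhase R I
  open Shift R n
  open RowCopy R I

  -- By `affordable` the scenarios still to come can absorb the remaining budget, which forces it to
  -- 0 at the end. `untouched` and `untouchedʷ` link them to the initial state, in which that mean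
  -- is taken. By `spare` slot N is free as long as there is budget left, so there is room for the
  -- only split. `decreasing` and `spent` are what `potential-step` consumes.
  record Raised (v : Fin n) (N : ℕ) (σ : State R) (j : ℕ) (τ : State R) : Set (c ⊔ ℓ₁ ⊔ ℓ₂) where
    field
      agree       : AgreeBelow 11 (nat τ) (nat σ)
      pointer     : nat τ 12 ≡ scenarioRow j ℕ.* n
      rows        : ∀ r → r ℕ.< scenarioRow 0 → row (nat τ) r ≡ row (nat σ) r
      untouched   : ∀ i → i ℕ.< j → scenario (nat τ) i ≡ scenario (nat σ) i
      untouchedʷ  : ∀ i → i ℕ.< j → weight (val τ) i ≡ weight (val σ) i
      nonneg      : ∀ i → i ℕ.< suc N → 0# ≤ weight (val τ) i
      budget≥0    : 0# ≤ val τ 0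
      affordable  : val τ 0 ≤ mean j σ (gain v)
      spare       : weight (val τ) N ≈ 0# ⊎ val τ 0 ≤ 0#
      decreasing  : ∀ h → Decreasing v h → mean (suc N) τ h ≤ mean N σ h
      spent       : mean (suc N) τ f + val τ 0 ≈ mean N σ f + val σ 0

  splitWeights : ℕ → ℕ → Carrier → (ℕ → Carrier) → ℕ → Carrier
  splitWeights N j s w =
    let w′ = w [ 4 ℕ.+ N ↦ s ] in (w′ [ 4 ℕ.+ j ↦ w′ (4 ℕ.+ j) - w′ (4 ℕ.+ N) ]) [ 0 ↦ 0# ]

  module _ {N j : ℕ} {s : Carrier} (w : ℕ → Carrier) (j<N : j ℕ.< N) where
    private
      w′ = w [ 4 ℕ.+ N ↦ s ]
      Δ = w′ (4 ℕ.+ j) - w′ (4 ℕ.+ N)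
      4+-≢ : ∀ {i i′} → i ≢ i′ → 4 ℕ.+ i ≢ 4 ℕ.+ i′
      4+-≢ i≢i′ eq = i≢i′ (ℕₚ.+-cancelˡ-≡ 4 _ _ eq)

    splitWeights-N : weight (splitWeights N j s w) N ≡ s
    splitWeights-N = trans (updated-other w′ {i = 4 ℕ.+ j} {x = Δ} (4+-≢ (ℕₚ.<⇒≢ j<N ∘ sym))) (updated-same w (4 ℕ.+ N))

    splitWeights-j : weight (splitWeights N j s w) j ≡ w (4 ℕ.+ j) - s
    splitWeights-j = trans (updated-same w′ (4 ℕ.+ j) {Δ})
      (cong₂ _-_ (updated-other w {i = 4 ℕ.+ N} {x = s} (4+-≢ (ℕₚ.<⇒≢ j<N))) (updated-same w (4 ℕ.+ N)))

    splitWeights-other : ∀ i → i ≢ j → i ≢ N → weight (splitWeights N j s w) i ≡ w (4 ℕ.+ i)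
    splitWeights-other i i≢j i≢N =
      trans (updated-other w′ {i = 4 ℕ.+ j} {x = Δ} (4+-≢ i≢j)) (updated-other w {i = 4 ℕ.+ N} {x = s} (4+-≢ i≢N))

  scenarioRow-injective : ∀ {i j} → i ≢ j → scenarioRow i ≢ scenarioRow j
  scenarioRow-injective i≢j eq = i≢j (ℕₚ.+-cancelʳ-≡ _ _ _ eq)

  low≢scenarioRow : ∀ {r} j → r ℕ.< scenarioRow 0 → r ≢ scenarioRow j
  low≢scenarioRow j r< refl = ℕₚ.<⇒≱ r< (ℕₚ.m≤n+m _ j)

  module _ {v : Fin n} {N B : ℕ} (σ : State R) (n≤B : n ℕ.≤ B) (N≤B : N ℕ.≤ B)
    (σ6 : nat σ 6 ≡ scenarioRow N ℕ.* n) (σ7 : nat σ 7 ≡ N) (σ10 : nat σ 10 ≡ toℕ v)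
    (nonnegσ : ∀ i → i ℕ.< N → 0# ≤ weight (val σ) i) where

    module Body {j : ℕ} {τ : State R} (j<N : j ℕ.< N) (inv : Raised v N σ (suc j) τ) where
      open Raised inv

      a ω g : Carrier
      A : Subset n
      a = val τ 0
      A = scenario (nat τ) j
      ω = weight (val τ) j
      g = gain v A

      0≤g : 0# ≤ g
      0≤g = gain-nonNegative v A

      0≤ω : 0# ≤ ω
      0≤ω = nonneg j (ℕₚ.m<n⇒m<1+n j<N)

      A≡ : A ≡ scenario (nat σ) j
      A≡ = untouched j ℕₚ.≤-refl

      ω≡ : ω ≡ weight (val σ) j
      ω≡ = untouchedʷ j ℕₚ.≤-refl

      affordable-rest : ∀ {a′} → a′ ≤ 0# → a′ ≤ mean j σ (gain v)
      affordable-rest a′≤0 = ≤-trans a′≤0 (≤-respˡ-≈ (zeros j)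
        (Σ<-mono j λ i i<j → *-nonNegative (nonnegσ i (ℕₚ.<-trans i<j j<N)) (gain-nonNegative v _)))
        where
        zeros : ∀ i → Σ< i (λ _ → 0#) ≈ 0#
        zeros zero    = ≈-refl
        zeros (suc i) = ≈-trans (+-identityʳ _) (zeros i)

      -- The three branches differ only in the weight s that receives v: all of ω, nothing, or a /
      -- g. Each costs s * g and cannot raise the mean of a decreasing function.
      close : ∀ {υ s} → 0# ≤ s → AgreeBelow 11 (nat υ) (nat τ) → nat υ 12 ≡ scenarioRow j ℕ.* n →
        (∀ r → r ℕ.< scenarioRow 0 → row (nat υ) r ≡ row (nat τ) r) →
        (∀ i → i ℕ.< j → scenario (nat υ) i ≡ scenario (nat τ) i) →
        (∀ i → i ℕ.< j → weight (val υ) i ≡ weight (val τ) i) →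
        (∀ i → i ℕ.< suc N → 0# ≤ weight (val υ) i) →
        0# ≤ val υ 0 → val υ 0 ≤ mean j σ (gain v) → weight (val υ) N ≈ 0# ⊎ val υ 0 ≤ 0# →
        Shifted {suc N} {j} {v} {weight (val τ)} {weight (val υ)} {scenario (nat τ)} {scenario (nat υ)} s →
        val υ 0 ≈ a - s * g →
        Raised v N σ j υ
      close {υ} {s} 0≤s agree′ pointer′ rows′ untouched′ untouchedʷ′ nonneg′ 0≤ aff spare′ shifted a′≈ = record
        { agree      = λ i i<11 → trans (agree′ i i<11) (agree i i<11)
        ; pointer    = pointer′
        ; rows       = λ r r< → trans (rows′ r r<) (rows r r<)
        ; untouched  = λ i i<j → trans (untouched′ i i<j) (untouched i (ℕₚ.m<n⇒m<1+n i<j))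
        ; untouchedʷ = λ i i<j → trans (untouchedʷ′ i i<j) (untouchedʷ i (ℕₚ.m<n⇒m<1+n i<j))
        ; nonneg     = nonneg′
        ; budget≥0   = 0≤
        ; affordable = aff
        ; spare      = spare′
        ; decreasing = λ h h↓ → ≤-trans (≤-respˡ-≈ (≈-sym (shifted h))
            (≤-by (*-monoˡ-≤ 0≤s (h↓ A))
              (solve 4 (λ e s x y → (e :+ s :* (x :- y)) :+ s :* y := e :+ s :* x) ≈-refl
                (mean (suc N) τ h) s (h (A ∪ ⁅ v ⁆)) (h A)))) (decreasing h h↓)
        ; spent      = ≈-trans (+-cong (shifted f) a′≈)
            (≈-trans (solve 4 (λ e s g a → (e :+ s :* g) :+ (a :- s :* g) := e :+ a) ≈-refl (mean (suc N) τ f) s g a) spent)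
        }

      module Probing {τ₀ τ₁ : State R} (agree₀ : AgreeBelow 11 (nat τ₀) (nat τ)) (p₀ : nat τ₀ 12 ≡ scenarioRow j ℕ.* n)
        (j₀ : nat τ₀ 11 ≡ j) (rows₀ : ∀ r → row (nat τ₀) r ≡ row (nat τ) r) (val₀ : val τ₀ ≡ val τ)
        (probed : Probed 10 (scenarioRow j) v τ₀ τ₁) where
        module P = Probed probed

        agree₁ : AgreeBelow 11 (nat τ₁) (nat τ)
        agree₁ i i<11 = trans (P.agree i (ℕₚ.<-≤-trans i<11 (ℕₚ.m≤m+n 11 3))) (agree₀ i i<11)

        τ₁-12 : nat τ₁ 12 ≡ scenarioRow j ℕ.* n
        τ₁-12 = trans (P.agree 12 (ℕₚ.m≤m+n 13 1)) p₀

        τ₁-11 : nat τ₁ 11 ≡ j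
        τ₁-11 = trans (P.agree 11 (ℕₚ.m≤m+n 12 2)) j₀

        τ₁-7 : nat τ₁ 7 ≡ N
        τ₁-7 = trans (agree₁ 7 (ℕₚ.m≤m+n 8 3)) (trans (agree 7 (ℕₚ.m≤m+n 8 3)) σ7)

        τ₁-6 : nat τ₁ 6 ≡ scenarioRow N ℕ.* n
        τ₁-6 = trans (agree₁ 6 (ℕₚ.m≤m+n 7 4)) (trans (agree 6 (ℕₚ.m≤m+n 7 4)) σ6)

        τ₁-10 : nat τ₁ 10 ≡ toℕ v
        τ₁-10 = trans (agree₁ 10 ℕₚ.≤-refl) (trans (agree 10 ℕₚ.≤-refl) σ10)

        here₁ : scenario (nat τ₁) j ≡ A ∪ ⁅ v ⁆
        here₁ = trans P.here (cong (_∪ ⁅ v ⁆) (rows₀ (scenarioRow j)))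

        elsewhere₁ : ∀ {r} → r ≢ scenarioRow j → row (nat τ₁) r ≡ row (nat τ) r
        elsewhere₁ {r} r≢ = trans (P.elsewhere r≢) (rows₀ r)

        weights₁ : ∀ i → weight (val τ₁) i ≡ weight (val τ) i
        weights₁ i = trans (P.weights i) (cong (λ w → weight w i) val₀)

        a₁ : val τ₁ 0 ≡ a
        a₁ = trans (P.values 0 (s≤s z≤n)) (cong (λ w → w 0) val₀)

        g₁ : val τ₁ 3 ≡ g
        g₁ = trans P.gain≡ (cong (gain v) (rows₀ (scenarioRow j)))

        ωg₁ : val τ₁ (4 ℕ.+ nat τ₁ 11) * val τ₁ 3 ≡ ω * g
        ωg₁ = cong₂ _*_ (trans (cong (λ i → val τ₁ (4 ℕ.+ i)) τ₁-11) (weights₁ j)) g₁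

        restoreState : State R → State R
        restoreState υ = ⟨ nat υ [ 15 ℕ.+ (nat υ 12 ℕ.+ nat υ 10) ↦ nat υ 14 ] , val υ ⟩

        whole : ω * g ≤ a → Raised v N σ j ⟨ nat τ₁ , val τ₁ [ 0 ↦ val τ₁ 0 - val τ₁ (4 ℕ.+ nat τ₁ 11) * val τ₁ 3 ] ⟩
        whole ωg≤a = close {s = ω} 0≤ω agree₁ τ₁-12
          (λ r r< → elsewhere₁ (low≢scenarioRow j r<))
          (λ i i<j → elsewhere₁ (scenarioRow-injective (ℕₚ.<⇒≢ i<j)))
          (λ i _ → weights₁ i)
          (λ i i<N → subst (0# ≤_) (sym (weights₁ i)) (nonneg i i<N))
          (subst (0# ≤_) (sym a′≡) (x≤y⇒0≤y-x ωg≤a))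
          (subst (_≤ mean j σ (gain v)) (sym a′≡)
            (≤-by affordable
              (≈-trans (+-congˡ (+-congˡ (≈-reflexive (cong₂ _*_ (sym ω≡) (cong (gain v) (sym A≡))))))
                (solve 3 (λ a x e → (a :- x) :+ (e :+ x) := e :+ a) ≈-refl a (ω * g) (mean j σ (gain v))))))
          ([ (λ wN≈0 → inj₁ (≈-trans (≈-reflexive (weights₁ N)) wN≈0))
           , (λ a≤0 → inj₂ (subst (_≤ 0#) (sym a′≡)
               (≤-by (+-mono-≤ a≤0 (*-nonNegative 0≤ω 0≤g))
                 (solve 2 (λ a x → (a :- x) :+ (con (+ 0) :+ x) := con (+ 0) :+ (a :+ con (+ 0))) ≈-refl a (ω * g))))) ]′ spare)
          (shifted-whole {v = v} {w = weight (val τ)} {X = scenario (nat τ)} (ℕₚ.m<n⇒m<1+n j<N) weights₁ here₁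
            (λ i i≢j → elsewhere₁ (scenarioRow-injective i≢j)))
          (≈-reflexive a′≡)
          where
          a′≡ : val τ₁ 0 - val τ₁ (4 ℕ.+ nat τ₁ 11) * val τ₁ 3 ≡ a - ω * g
          a′≡ = cong₂ _-_ a₁ ωg₁

        nothing-left : a ≤ 0# → Raised v N σ j (restoreState τ₁)
        nothing-left a≤0 = close {s = 0#} ≤-refl
          (λ i i<11 → trans (agree-updated (nat τ₁) (ℕₚ.m≤m+n 11 _) i i<11) (agree₁ i i<11))
          τ₁-12
          (λ r _ → trans (P.restored r) (rows₀ r))
          (λ i _ → trans (P.restored (scenarioRow i)) (rows₀ (scenarioRow i)))
          (λ i _ → weights₁ i)
          (λ i i<N → subst (0# ≤_) (sym (weights₁ i)) (nonneg i i<N))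
          (subst (0# ≤_) (sym a₁) budget≥0)
          (affordable-rest (subst (_≤ 0#) (sym a₁) a≤0))
          (inj₂ (subst (_≤ 0#) (sym a₁) a≤0))
          (λ h → ≈-trans
            (Σ<-cong (suc N) λ i _ → ≈-reflexive (cong₂ _*_ (weights₁ i) (cong h (trans (P.restored (scenarioRow i)) (rows₀ (scenarioRow i))))))
            (solve 2 (λ e x → e := e :+ con (+ 0) :* x) ≈-refl _ _))
          (≈-trans (≈-reflexive a₁) (solve 2 (λ a g → a := a :- con (+ 0) :* g) ≈-refl a g))

        splitState : State R → State R
        splitState υ = ⟨ nat υ , splitWeights (nat υ 7) (nat υ 11) (val υ 0 / val υ 3) (val υ) ⟩

        split-scenario : ∀ {τ₂} → Copied (scenarioRow j) (scenarioRow N) τ₁ 0 τ₂ →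
          ¬ (ω * g ≤ a) → ¬ (a ≤ 0#) → Raised v N σ j (restoreState (splitState τ₂))
        split-scenario {τ₂} copied ωg≰a a≰0 = close {s = s} 0≤s
          (λ i i<11 → trans (agree-updated (nat τ₂) (ℕₚ.m≤m+n 11 _) i i<11)
            (trans (agree₂ i (ℕₚ.<-≤-trans i<11 (ℕₚ.m≤m+n 11 2))) (agree₁ i i<11)))
          τ₂-12
          (λ r r< → other-row (low≢scenarioRow j r<) (low≢scenarioRow N r<))
          (λ i i<j → other-row (scenarioRow-injective (ℕₚ.<⇒≢ i<j)) (scenarioRow-injective (ℕₚ.<⇒≢ (ℕₚ.<-trans i<j j<N))))
          (λ i i<j → other-weight (ℕₚ.<⇒≢ i<j) (ℕₚ.<⇒≢ (ℕₚ.<-trans i<j j<N)))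
          nonneg′
          ≤-refl
          (affordable-rest ≤-refl)
          (inj₂ ≤-refl)
          (shifted-split {v = v} {w = weight (val τ)} {X = scenario (nat τ)} j<N wN≈0 weight-N weight-j
            (λ i → other-weight) row-N other-scenario)
          (≈-trans (solve 1 (λ a → con (+ 0) := a :- a) ≈-refl a) (+-congˡ (-‿cong (≈-sym (/-cancel g≉0)))))
          where
          module C = Copied copied
          υ = restoreState (splitState τ₂)
          -- The part of the scenario whose shift costs exactly the remaining budget a. It is at
          -- most ω because a ≤ ω * g.
          s = a / g
          agree₂ : ∀ i → i ℕ.< 13 → nat τ₂ i ≡ nat τ₁ i
          agree₂ i i<13 = C.agree i (ℕₚ.<-≤-trans i<13 (ℕₚ.m≤m+n 13 2)) (ℕₚ.<⇒≢ i<13)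
          τ₂-12 : nat τ₂ 12 ≡ scenarioRow j ℕ.* n
          τ₂-12 = trans (agree₂ 12 ℕₚ.≤-refl) τ₁-12
          τ₂-10 : nat τ₂ 10 ≡ toℕ v
          τ₂-10 = trans (agree₂ 10 (ℕₚ.m≤m+n 11 2)) τ₁-10
          N≢j : scenarioRow N ≢ scenarioRow j
          N≢j = scenarioRow-injective (ℕₚ.<⇒≢ j<N ∘ sym)
          row-j : scenario (nat υ) j ≡ A
          row-j = trans (row-write (nat τ₂) {r = scenarioRow j} {v} τ₂-12 τ₂-10 (nat τ₂ 14))
            (trans (cong₂ (λ B b → B [ v ]≔ b) (trans (C.others (N≢j ∘ sym)) P.here)
                     (trans (cong bit (C.agree 14 ℕₚ.≤-refl λ ())) P.old))
              (trans (insert-undo (row (nat τ₀) (scenarioRow j)) v) (rows₀ (scenarioRow j))))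
          other-row : ∀ {r} → r ≢ scenarioRow j → r ≢ scenarioRow N → row (nat υ) r ≡ row (nat τ) r
          other-row r≢j r≢N = trans (row-other (nat τ₂) {r = scenarioRow j} {v} τ₂-12 τ₂-10 (nat τ₂ 14) r≢j)
            (trans (C.others r≢N) (elsewhere₁ r≢j))
          row-N : scenario (nat υ) N ≡ A ∪ ⁅ v ⁆
          row-N = trans (row-other (nat τ₂) {r = scenarioRow j} {v} τ₂-12 τ₂-10 (nat τ₂ 14) N≢j)
            (trans (subset-ext λ x → C.copied x z≤n) here₁)
          other-scenario : ∀ i → i ≢ N → scenario (nat υ) i ≡ scenario (nat τ) i
          other-scenario i i≢N with i ℕ.≟ j
          ... | yes refl = row-j
          ... | no i≢j   = other-row (scenarioRow-injective i≢j) (scenarioRow-injective i≢N)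
          weights≡ : val υ ≡ splitWeights N j s (val τ₁)
          weights≡ rewrite C.val≡ | a₁ | g₁ =
            cong₂ (λ N′ j′ → splitWeights N′ j′ s (val τ₁))
              (trans (agree₂ 7 (ℕₚ.m≤m+n 8 5)) τ₁-7) (trans (agree₂ 11 (ℕₚ.m≤m+n 12 1)) τ₁-11)
          weight-at : ∀ i → weight (val υ) i ≡ weight (splitWeights N j s (val τ₁)) i
          weight-at i = cong (λ w → weight w i) weights≡
          weight-N : weight (val υ) N ≡ s
          weight-N = trans (weight-at N) (splitWeights-N (val τ₁) j<N)
          weight-j : weight (val υ) j ≡ ω - s
          weight-j = trans (weight-at j) (trans (splitWeights-j (val τ₁) j<N) (cong (_- s) (weights₁ j)))
          other-weight : ∀ {i} → i ≢ j → i ≢ N → weight (val υ) i ≡ weight (val τ) i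
          other-weight {i} i≢j i≢N = trans (weight-at i) (trans (splitWeights-other (val τ₁) j<N i i≢j i≢N) (weights₁ i))
          -- With g = 0 the whole scenario would cost 0 and fit into the budget. Hence the division
          -- by g is not the default case x / 0 = 0.
          g≉0 : ¬ (g ≈ 0#)
          g≉0 g≈0 = ωg≰a (≤-respˡ-≈ (≈-sym (≈-trans (*-congˡ g≈0) (zeroʳ ω))) budget≥0)
          0≤s : 0# ≤ s
          0≤s = /-nonNegative budget≥0 0≤g
          wN≈0 : weight (val τ) N ≈ 0#
          wN≈0 = [ (λ wN≈0 → wN≈0) , (λ a≤0 → contradiction a≤0 a≰0) ]′ spare
          nonneg′ : ∀ i → i ℕ.< suc N → 0# ≤ weight (val υ) i
          nonneg′ i i<N with i ℕ.≟ j | i ℕ.≟ N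
          ... | yes refl | _        = subst (0# ≤_) (sym weight-j) (x≤y⇒0≤y-x (x≤zy⇒x/y≤z 0≤g g≉0 (≰⇒≥ ωg≰a)))
          ... | no _     | yes refl = subst (0# ≤_) (sym weight-N) 0≤s
          ... | no i≢j   | no i≢N   = subst (0# ≤_) (sym (other-weight i≢j i≢N)) (nonneg i i<N)

    raise-runs : weight (val σ) N ≡ 0# → 0# ≤ val σ 0 → val σ 0 ≤ mean N σ (gain v) →
      Runs raise σ (suc (loopTime B (raiseBodyTime B))) (Raised v N σ 0)
    raise-runs wN≡0 0≤a a≤ = assignᴺ-then loop-runs (Raised v N σ) N B σ7 N≤B start body
      where
      wN≈0 : ∀ h → mean (suc N) σ h ≈ mean N σ h
      wN≈0 h = ≈-trans (+-congˡ (≈-trans (*-congʳ (≈-reflexive wN≡0)) (zeroˡ _))) (+-identityʳ _)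
      start : Raised v N σ N ⟨ (nat σ [ 12 ↦ nat σ 6 ]) [ 11 ↦ N ] , val σ ⟩
      start = record
        { agree = λ i i<11 → trans (agree-updated (nat σ [ 12 ↦ nat σ 6 ]) ℕₚ.≤-refl i i<11)
                                   (agree-updated (nat σ) (ℕₚ.n≤1+n 11) i i<11)
        ; pointer = σ6 ; rows = λ _ _ → refl ; untouched = λ _ _ → refl ; untouchedʷ = λ _ _ → refl
        ; nonneg = nonneg′ ; budget≥0 = 0≤a ; affordable = a≤ ; spare = inj₁ (≈-reflexive wN≡0)
        ; decreasing = λ h _ → ≤-reflexive (wN≈0 h) ; spent = +-congʳ (wN≈0 f) }
        where
        nonneg′ : ∀ i → i ℕ.< suc N → 0# ≤ weight (val σ) i
        nonneg′ i i<1+N with i ℕ.≟ N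
        ... | yes refl = ≤-reflexive (≈-reflexive (sym wN≡0))
        ... | no i≢N   = nonnegσ i (ℕₚ.≤∧≢⇒< (ℕ.s≤s⁻¹ i<1+N) i≢N)
      body : ∀ j τ → j ℕ.< N → nat τ 11 ≡ suc j → Raised v N σ (suc j) τ →
        Runs _ ⟨ nat τ [ 11 ↦ j ] , val τ ⟩ (raiseBodyTime B) (λ υ → nat υ 11 ≡ j × Raised v N σ j υ)
      body j τ j<N _ inv =
        assignᴺ-then
        seq-runs (probe-runs 10 {scenarioRow j} {v} τ₀ (ℕₚ.m≤m+n 11 3) p₀ v₀) λ τ₁ probed →
        let open Probing {τ₀} {τ₁} agree₀ p₀ refl (λ _ → refl) refl probed in
        if-runs
          (λ ωg≤a → weaken-runs (s≤s z≤n) (λ _ post → post)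
            (assignᴿ-runs (τ₁-11 , whole (subst₂ _≤_ ωg₁ a₁ (does⇒ (_ ≤? _) ωg≤a)))))
          (λ ωg≰a → seq-runs {Mid = λ τ₂ → nat τ₂ 11 ≡ j × Raised v N σ j (restoreState τ₂)}
            (if-runs
              (λ a≤0 → weaken-runs (s≤s z≤n) (λ _ post → post)
                (skip-runs (τ₁-11 , nothing-left (subst (_≤ 0#) a₁ (does⇒ (_ ≤? _) a≤0)))))
              (λ a≰0 → seq-runs (copy-runs {scenarioRow j} {scenarioRow N} τ₁ n≤B (scenarioRow-injective (ℕₚ.<⇒≢ j<N)) τ₁-12 τ₁-6) λ τ₂ copied →
                assignᴿ-then assignᴿ-then assignᴿ-runs
                  ( trans (Copied.agree copied 11 (ℕₚ.m≤m+n 12 3) λ ()) τ₁-11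
                  , split-scenario copied
                      (λ ωg≤a → does⇒¬ (_ ≤? _) ωg≰a (subst₂ _≤_ (sym ωg₁) (sym a₁) ωg≤a))
                      (λ a≤0 → does⇒¬ (_ ≤? _) a≰0 (subst (_≤ 0#) (sym a₁) a≤0)))))
            λ τ₂ post → assignᴺ-runs post)
        where
        open Body j<N inv
        τ₀ : State R
        τ₀ = ⟨ (nat τ [ 11 ↦ j ]) [ 12 ↦ nat τ 12 ℕ.∸ n ] , val τ ⟩
        agree₀ : AgreeBelow 11 (nat τ₀) (nat τ)
        agree₀ i i<11 = trans (agree-updated (nat τ [ 11 ↦ j ]) (ℕₚ.n≤1+n 11) i i<11) (agree-updated (nat τ) ℕₚ.≤-refl i i<11)
        p₀ : nat τ₀ 12 ≡ scenarioRow j ℕ.* n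
        p₀ = previous-row {r = scenarioRow j} (Raised.pointer inv)
        v₀ : nat τ₀ 10 ≡ toℕ v
        v₀ = trans (Raised.agree inv 10 ℕₚ.≤-refl) σ10

-- Processing one edge

swap : Program
swap = (lit 14 ≔ᴺ reg 9) ⨾ (lit 9 ≔ᴺ reg 10) ⨾ (lit 10 ≔ᴺ reg 14) ⨾ (lit 0 ≔ᴿ value 1)

insert-everywhere : Program
insert-everywhere = (lit 12 ≔ᴺ reg 6) ⨾ Loop 11 (reg 7) ((lit 12 ≔ᴺ reg 12 ∸ᴺ order) ⨾ (cell 12 9 ≔ᴺ lit 1))

-- Both costs are measured before either insertion, hence on the same random set. Slot N is cleared
-- before `raise` and counted afterwards whether or not a split has used it.
process-edge : Program
process-edge =
  (lit 9 ≔ᴺ endpoint₁ (reg 8)) ⨾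
  (lit 10 ≔ᴺ endpoint₂ (reg 8)) ⨾
  (lit 0 ≔ᴿ 0ᴿ) ⨾
  (lit 1 ≔ᴿ 0ᴿ) ⨾
  measure ⨾
  (If value 1 ≤ᴿ value 0 Then swap Else skip) ⨾
  (weight-cell 7 ≔ᴿ 0ᴿ) ⨾
  raise ⨾
  (lit 7 ≔ᴺ reg 7 +ᴺ lit 1) ⨾
  (lit 6 ≔ᴺ order +ᴺ reg 6) ⨾
  insert-everywhere ⨾
  (cell 5 9 ≔ᴺ lit 1)

edgeTime : ℕ → ℕ
edgeTime B = 4 ℕ.+ (suc (loopTime B 13) ℕ.+ (5 ℕ.+ suc (suc (loopTime B (raiseBodyTime B)) ℕ.+ (2 ℕ.+ (suc (loopTime B 2) ℕ.+ 1)))))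

module EdgeStep {c ℓ₁ ℓ₂} (R : OrderedField c ℓ₁ ℓ₂) (I : Instance R) where
  open Ordered R
  open Instance I
  open Machine R I
  open Weighted R n
  open SubmodularFunction R f nonNegative monotone submodular
  open CoverPhase R I
  open RaiseLoop R I

  endpointOf-< : ∀ π {e} (e<m : e ℕ.< m) → endpointOf π e ≡ toℕ (π (endpoints (Fin.fromℕ< e<m)))
  endpointOf-< π {e} e<m with e ℕ.<? m
  ... | yes e<m′ = cong (λ p → toℕ (π (endpoints (Fin.fromℕ< p)))) (ℕₚ.<-irrelevant e<m′ e<m)
  ... | no e≮m   = contradiction e<m e≮m

  mean-cong : ∀ N σ τ h → (∀ i → i ℕ.< N → weight (val τ) i ≡ weight (val σ) i) →
    (∀ i → i ℕ.< N → scenario (nat τ) i ≡ scenario (nat σ) i) → mean N τ h ≈ mean N σ h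
  mean-cong N σ τ h weights scenarios =
    Σ<-cong N λ i i<N → ≈-reflexive (cong₂ _*_ (weights i i<N) (cong h (scenarios i i<N)))

  coverRow : ℕ
  coverRow = 2 ℕ.+ (k ℕ.+ k)

  record Inserted (u : Fin n) (N : ℕ) (σ : State R) (j : ℕ) (τ : State R) : Set c where
    field
      agree     : AgreeBelow 11 (nat τ) (nat σ)
      pointer   : nat τ 12 ≡ scenarioRow j ℕ.* n
      rows      : ∀ r → r ℕ.< scenarioRow 0 → row (nat τ) r ≡ row (nat σ) r
      untouched : ∀ i → i ℕ.< j → scenario (nat τ) i ≡ scenario (nat σ) i
      inserted  : ∀ i → j ℕ.≤ i → i ℕ.< N → scenario (nat τ) i ≡ scenario (nat σ) i ∪ ⁅ u ⁆
      val≡      : val τ ≡ val σ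

  insert-runs : ∀ {u N B} σ → N ℕ.≤ B → nat σ 6 ≡ scenarioRow N ℕ.* n → nat σ 7 ≡ N → nat σ 9 ≡ toℕ u →
    Runs insert-everywhere σ (suc (loopTime B 2)) (Inserted u N σ 0)
  insert-runs {u} {N} σ N≤B σ6 σ7 σ9 = assignᴺ-then loop-runs (Inserted u N σ) N _ σ7 N≤B
    record
      { agree = λ i i<11 → trans (agree-updated (nat σ [ 12 ↦ nat σ 6 ]) ℕₚ.≤-refl i i<11)
                                 (agree-updated (nat σ) (ℕₚ.n≤1+n 11) i i<11)
      ; pointer = σ6 ; rows = λ _ _ → refl ; untouched = λ _ _ → refl ; val≡ = refl
      ; inserted = λ i N≤i i<N → contradiction i<N (ℕₚ.≤⇒≯ N≤i) }
    body
    where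
    body : ∀ j τ → j ℕ.< N → nat τ 11 ≡ suc j → Inserted u N σ (suc j) τ →
      Runs ((lit 12 ≔ᴺ reg 12 ∸ᴺ order) ⨾ (cell 12 9 ≔ᴺ lit 1)) ⟨ nat τ [ 11 ↦ j ] , val τ ⟩ 2
        (λ υ → nat υ 11 ≡ j × Inserted u N σ j υ)
    body j τ j<N _ inv = assignᴺ-then assignᴺ-runs (refl , record
      { agree     = λ i i<11 → trans (agree-updated μ {15 ℕ.+ (nat τ 12 ℕ.∸ n ℕ.+ nat τ 9)} (ℕₚ.m≤m+n 11 _) i i<11)
          (trans (agree-updated (nat τ [ 11 ↦ j ]) (ℕₚ.n≤1+n 11) i i<11) (trans (agree-updated (nat τ) ℕₚ.≤-refl i i<11) (agree i i<11)))
      ; pointer   = p≡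
      ; rows      = λ r r< → trans (row-other μ {r = scenarioRow j} {u} p≡ u≡ 1 (low≢scenarioRow j r<)) (rows r r<)
      ; untouched = λ i i<j → trans (row-other μ {r = scenarioRow j} {u} p≡ u≡ 1 (scenarioRow-injective (ℕₚ.<⇒≢ i<j)))
                                    (untouched i (ℕₚ.m<n⇒m<1+n i<j))
      ; inserted  = inserted′
      ; val≡      = val≡ })
      where
      open Inserted inv
      μ = (nat τ [ 11 ↦ j ]) [ 12 ↦ nat τ 12 ℕ.∸ n ]
      p≡ : nat τ 12 ℕ.∸ n ≡ scenarioRow j ℕ.* n
      p≡ = previous-row {r = scenarioRow j} pointer
      u≡ : nat τ 9 ≡ toℕ u
      u≡ = trans (agree 9 (ℕₚ.m≤m+n 10 1)) σ9
      inserted′ : ∀ i → j ℕ.≤ i → i ℕ.< N →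
        scenario (μ [ 15 ℕ.+ (nat τ 12 ℕ.∸ n ℕ.+ nat τ 9) ↦ 1 ]) i ≡ scenario (nat σ) i ∪ ⁅ u ⁆
      inserted′ i j≤i i<N with i ℕ.≟ j
      ... | yes refl = trans (row-insert μ {r = scenarioRow j} {u} p≡ u≡) (cong (_∪ ⁅ u ⁆) (untouched j ℕₚ.≤-refl))
      ... | no i≢j   = trans (row-other μ {r = scenarioRow j} {u} p≡ u≡ 1 (scenarioRow-injective i≢j))
                             (inserted i (ℕₚ.≤∧≢⇒< j≤i (i≢j ∘ sym)) i<N)

  -- Here e edges are still to come. Every edge appends one scenario, possibly of weight 0, so the
  -- number N is determined by `N+e`, and the loops over scenarios stay short. `bounded` ranges over
  -- all vertex covers because the optimal one is unknown to the program.
  record Covering (e : ℕ) (τ : State R) : Set (c ⊔ ℓ₁ ⊔ ℓ₂) where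
    cover : Subset n
    cover = row (nat τ) coverRow
    field
      N            : ℕ
      N+e          : N ℕ.+ e ≡ suc m
      count        : nat τ 7 ≡ N
      end          : nat τ 6 ≡ scenarioRow N ℕ.* n
      output-row   : nat τ 2 ≡ k ℕ.* n
      marked-row   : nat τ 3 ≡ (k ℕ.+ k) ℕ.* n
      scratch-row  : nat τ 4 ≡ suc (k ℕ.+ k) ℕ.* n
      cover-row    : nat τ 5 ≡ coverRow ℕ.* n
      empty        : ∀ r → r ℕ.< coverRow → row (nat τ) r ≡ ⊥
      nonneg       : ∀ i → i ℕ.< N → 0# ≤ weight (val τ) i
      covered      : ∀ e′ → e ℕ.≤ toℕ e′ → proj₁ (endpoints e′) ∈ cover ⊎ proj₂ (endpoints e′) ∈ cover
      almostSurely : mean N τ (minusIndicator cover) ≤ - 1#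
      bounded      : ∀ K → IsVertexCover graph K → mean N τ (potential K) ≤ f K + f K

  -- The cheaper endpoint u is the one that gets inserted everywhere.
  record Chosen (N : ℕ) (e : Fin m) (σ τ : State R) : Set (c ⊔ ℓ₁ ⊔ ℓ₂) where
    field
      u v      : Fin n
      ends     : ∀ A → IsVertexCover graph A → u ∈ A ⊎ v ∈ A
      covers   : ∀ A → u ∈ A → proj₁ (endpoints e) ∈ A ⊎ proj₂ (endpoints e) ∈ A
      agree    : AgreeBelow 9 (nat τ) (nat σ)
      u≡       : nat τ 9 ≡ toℕ u
      v≡       : nat τ 10 ≡ toℕ v
      rows     : ∀ r → row (nat τ) r ≡ row (nat σ) r
      weights  : ∀ i → weight (val τ) i ≡ weight (val σ) i
      budget   : val τ 0 ≈ mean N σ (gain u)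
      cheaper  : val τ 0 ≤ mean N σ (gain v)

  choose-runs : ∀ {N} e σ {τ} → nat σ 9 ≡ toℕ (proj₁ (endpoints e)) → nat σ 10 ≡ toℕ (proj₂ (endpoints e)) →
    Measured (proj₁ (endpoints e)) (proj₂ (endpoints e)) N σ 0 τ →
    Runs (If value 1 ≤ᴿ value 0 Then swap Else skip) τ 5 (Chosen N e σ)
  choose-runs {N} e σ {τ} σ9 σ10 measured =
    if-runs
      (λ b≤a → assignᴺ-then assignᴺ-then assignᴺ-then assignᴿ-runs record
        { u = V ; v = U
        ; ends = λ A cov → [ inj₂ , inj₁ ]′ (cov e) ; covers = λ _ → inj₂
        ; agree = λ i i<9 → trans
            (trans (agree-updated ((nat τ [ 14 ↦ nat τ 9 ]) [ 9 ↦ nat τ 10 ]) (ℕₚ.n≤1+n 9) i i<9)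
              (trans (agree-updated (nat τ [ 14 ↦ nat τ 9 ]) ℕₚ.≤-refl i i<9) (agree-updated (nat τ) (ℕₚ.m≤m+n 9 5) i i<9)))
            (agree i (ℕₚ.<-≤-trans i<9 (ℕₚ.m≤m+n 9 2)))
        ; u≡ = V≡ ; v≡ = U≡ ; rows = rows ; weights = weights
        ; budget = b≈ ; cheaper = ≤-respʳ-≈ a≈ (does⇒ (_ ≤? _) b≤a) })
      (λ b≰a → weaken-runs (s≤s z≤n) (λ _ post → post) (skip-runs record
        { u = U ; v = V
        ; ends = λ A cov → cov e ; covers = λ _ → inj₁
        ; agree = λ i i<9 → agree i (ℕₚ.<-≤-trans i<9 (ℕₚ.m≤m+n 9 2))
        ; u≡ = U≡ ; v≡ = V≡ ; rows = rows ; weights = weights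
        ; budget = a≈ ; cheaper = ≤-respʳ-≈ b≈ (≰⇒≥ (does⇒¬ (_ ≤? _) b≰a)) }))
    where
    open Measured measured
    U = proj₁ (endpoints e)
    V = proj₂ (endpoints e)
    U≡ : nat τ 9 ≡ toℕ U
    U≡ = trans (agree 9 (ℕₚ.m≤m+n 10 1)) σ9
    V≡ : nat τ 10 ≡ toℕ V
    V≡ = trans (agree 10 ℕₚ.≤-refl) σ10
    a≈ : val τ 0 ≈ mean N σ (gain U)
    a≈ = ≈-trans (≈-sym (+-identityʳ _)) cost-u
    b≈ : val τ 1 ≈ mean N σ (gain V)
    b≈ = ≈-trans (≈-sym (+-identityʳ _)) cost-v

  module ProcessEdge {e : ℕ} {τ : State R} (e<m : e ℕ.< m) (inv : Covering (suc e) τ) where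
    open Covering inv

    edge : Fin m
    edge = Fin.fromℕ< e<m

    1+N+e : suc N ℕ.+ e ≡ suc m
    1+N+e = trans (sym (ℕₚ.+-suc N e)) N+e

    σ₁ : State R
    σ₁ = ⟨ ((nat τ [ 8 ↦ e ]) [ 9 ↦ endpointOf proj₁ e ]) [ 10 ↦ endpointOf proj₂ e ]
         , ((val τ [ 0 ↦ 0# ]) [ 1 ↦ 0# ]) ⟩

    agree₁ : AgreeBelow 8 (nat σ₁) (nat τ)
    agree₁ i i<8 = trans (agree-updated ((nat τ [ 8 ↦ e ]) [ 9 ↦ endpointOf proj₁ e ]) (ℕₚ.m≤m+n 8 2) i i<8)
      (trans (agree-updated (nat τ [ 8 ↦ e ]) (ℕₚ.n≤1+n 8) i i<8) (agree-updated (nat τ) ℕₚ.≤-refl i i<8))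

    module AfterChoice {τ₂ : State R} (chosen : Chosen N edge σ₁ τ₂) where
      open Chosen chosen hiding (agree)

      σ₃ : State R
      σ₃ = ⟨ nat τ₂ , val τ₂ [ 4 ℕ.+ nat τ₂ 7 ↦ 0# ] ⟩

      agree₃ : AgreeBelow 8 (nat σ₃) (nat τ)
      agree₃ i i<8 = trans (Chosen.agree chosen i (ℕₚ.m<n⇒m<1+n i<8)) (agree₁ i i<8)

      e₃ : nat σ₃ 8 ≡ e
      e₃ = Chosen.agree chosen 8 ℕₚ.≤-refl

      σ₃-7 : nat σ₃ 7 ≡ N
      σ₃-7 = trans (agree₃ 7 ℕₚ.≤-refl) count

      σ₃-6 : nat σ₃ 6 ≡ scenarioRow N ℕ.* n
      σ₃-6 = trans (agree₃ 6 (ℕₚ.n≤1+n 7)) end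

      weights₃ : ∀ i → i ℕ.< N → weight (val σ₃) i ≡ weight (val τ) i
      weights₃ i i<N = trans
        (updated-other (val τ₂) {i = 4 ℕ.+ nat τ₂ 7} λ eq → ℕₚ.<⇒≢ i<N (trans (ℕₚ.+-cancelˡ-≡ 4 _ _ eq) σ₃-7))
        (weights i)

      fresh : weight (val σ₃) N ≡ 0#
      fresh = trans (cong (λ i → (val τ₂ [ 4 ℕ.+ i ↦ 0# ]) (4 ℕ.+ N)) σ₃-7) (updated-same (val τ₂) (4 ℕ.+ N))

      mean₃ : ∀ h → mean N σ₃ h ≈ mean N τ h
      mean₃ h = mean-cong N τ σ₃ h weights₃ (λ i _ → rows (scenarioRow i))

      nonneg₃ : ∀ i → i ℕ.< N → 0# ≤ weight (val σ₃) i
      nonneg₃ i i<N = subst (0# ≤_) (sym (weights₃ i i<N)) (nonneg i i<N)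

      0≤budget : 0# ≤ val σ₃ 0
      0≤budget = ≤-respʳ-≈ (≈-sym budget) (≤-respˡ-≈
        (≈-trans (Expectation.E-* N (weight (val τ)) (scenario (nat τ)) (λ _ → 0#) 0#) (zeroʳ _))
        (Expectation.E-mono N (weight (val τ)) (scenario (nat τ)) nonneg
          λ A → ≤-respˡ-≈ (≈-sym (zeroʳ 0#)) (gain-nonNegative u A)))

      cheaper₃ : val σ₃ 0 ≤ mean N σ₃ (gain v)
      cheaper₃ = ≤-respʳ-≈ (≈-sym (mean₃ (gain v))) cheaper

      module AfterRaise {τ₄ : State R} (raised : Raised v N σ₃ 0 τ₄) where
        module V = Raised raised

        σ₅ : State R
        σ₅ = ⟨ (nat τ₄ [ 7 ↦ nat τ₄ 7 ℕ.+ 1 ]) [ 6 ↦ n ℕ.+ nat τ₄ 6 ] , val τ₄ ⟩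

        agree₄ : AgreeBelow 8 (nat τ₄) (nat τ)
        agree₄ i i<8 = trans (V.agree i (ℕₚ.<-≤-trans i<8 (ℕₚ.m≤m+n 8 3))) (agree₃ i i<8)

        σ₅-7 : nat σ₅ 7 ≡ suc N
        σ₅-7 = trans (ℕₚ.+-comm (nat τ₄ 7) 1) (cong suc (trans (agree₄ 7 ℕₚ.≤-refl) count))

        σ₅-6 : nat σ₅ 6 ≡ scenarioRow (suc N) ℕ.* n
        σ₅-6 = cong (n ℕ.+_) (trans (agree₄ 6 (ℕₚ.n≤1+n 7)) end)

        σ₅-9 : nat σ₅ 9 ≡ toℕ u
        σ₅-9 = trans (V.agree 9 (ℕₚ.m≤m+n 10 1)) u≡

        -- After the last scenario `affordable` compares the budget with an empty mean, so nothing
        -- of it is left and v has cost exactly a.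
        spent₃ : mean (suc N) τ₄ f ≈ mean N σ₃ f + val σ₃ 0
        spent₃ = ≈-trans (≈-sym (≈-trans (+-congˡ (antisym V.affordable V.budget≥0)) (+-identityʳ _))) V.spent

        module AfterInsert {τ₆ : State R} (ins : Inserted u (suc N) σ₅ 0 τ₆) where
          module J = Inserted ins

          υ : State R
          υ = ⟨ nat τ₆ [ 15 ℕ.+ (nat τ₆ 5 ℕ.+ nat τ₆ 9) ↦ 1 ] , val τ₆ ⟩

          agree₆ : AgreeBelow 6 (nat υ) (nat τ)
          agree₆ i i<6 = trans (agree-updated (nat τ₆) {15 ℕ.+ (nat τ₆ 5 ℕ.+ nat τ₆ 9)} (ℕₚ.m≤m+n 6 _) i i<6)
            (trans (J.agree i (ℕₚ.<-≤-trans i<6 (ℕₚ.m≤m+n 6 5)))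
              (trans (agree-updated (nat τ₄ [ 7 ↦ nat τ₄ 7 ℕ.+ 1 ]) ℕₚ.≤-refl i i<6)
                (trans (agree-updated (nat τ₄) (ℕₚ.n≤1+n 6) i i<6) (agree₄ i (ℕₚ.<-≤-trans i<6 (ℕₚ.m≤m+n 6 2))))))

          τ₆-5 : nat τ₆ 5 ≡ coverRow ℕ.* n
          τ₆-5 = trans (agree₆ 5 ℕₚ.≤-refl) cover-row

          τ₆-9 : nat τ₆ 9 ≡ toℕ u
          τ₆-9 = trans (J.agree 9 (ℕₚ.m≤m+n 10 1)) σ₅-9

          low-rows : ∀ r → r ℕ.< scenarioRow 0 → row (nat τ₆) r ≡ row (nat τ) r
          low-rows r r< = trans (J.rows r r<) (trans (V.rows r r<) (rows r))

          cover′ : row (nat υ) coverRow ≡ cover ∪ ⁅ u ⁆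
          cover′ = trans (row-insert (nat τ₆) {r = coverRow} {u} τ₆-5 τ₆-9) (cong (_∪ ⁅ u ⁆) (low-rows coverRow ℕₚ.≤-refl))

          other-rows : ∀ {r} → r ≢ coverRow → row (nat υ) r ≡ row (nat τ₆) r
          other-rows = row-other (nat τ₆) {r = coverRow} {u} τ₆-5 τ₆-9 1

          weights₆ : ∀ i → weight (val υ) i ≡ weight (val τ₄) i
          weights₆ i = cong (λ w → weight w i) J.val≡

          scenarios₆ : ∀ i → i ℕ.< suc N → scenario (nat υ) i ≡ scenario (nat τ₄) i ∪ ⁅ u ⁆
          scenarios₆ i i<1+N = trans (other-rows (low≢scenarioRow i ℕₚ.≤-refl ∘ sym)) (J.inserted i z≤n i<1+N)

          mean₆ : ∀ h → mean (suc N) υ h ≈ mean (suc N) τ₄ (λ A → h (A ∪ ⁅ u ⁆))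
          mean₆ h = Σ<-cong (suc N) λ i i<1+N → ≈-reflexive (cong₂ _*_ (weights₆ i) (cong h (scenarios₆ i i<1+N)))

          grow : ∀ e′ → e ℕ.≤ toℕ e′ →
            proj₁ (endpoints e′) ∈ cover ∪ ⁅ u ⁆ ⊎ proj₂ (endpoints e′) ∈ cover ∪ ⁅ u ⁆
          grow e′ e≤e′ with e′ Fin.≟ edge
          ... | yes refl = covers _ (v∈A∪⁅v⁆ cover u)
          ... | no e′≢   = Sum.map (p⊆p∪q ⁅ u ⁆) (p⊆p∪q ⁅ u ⁆)
            (covered e′ (ℕₚ.≤∧≢⇒< e≤e′ λ e≡ → e′≢ (Finₚ.toℕ-injective (trans (sym e≡) (sym (Finₚ.toℕ-fromℕ< e<m))))))

          covering : Covering e υ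
          covering = record
            { N            = suc N
            ; N+e          = 1+N+e
            ; count        = trans (J.agree 7 (ℕₚ.m≤m+n 8 3)) σ₅-7
            ; end          = trans (J.agree 6 (ℕₚ.m≤m+n 7 4)) σ₅-6
            ; output-row   = trans (agree₆ 2 (ℕₚ.m≤m+n 3 3)) output-row
            ; marked-row   = trans (agree₆ 3 (ℕₚ.m≤m+n 4 2)) marked-row
            ; scratch-row  = trans (agree₆ 4 (ℕₚ.m≤m+n 5 1)) scratch-row
            ; cover-row    = trans (agree₆ 5 ℕₚ.≤-refl) cover-row
            ; empty        = λ r r< → trans (other-rows (ℕₚ.<⇒≢ r<)) (trans (low-rows r (ℕₚ.m<n⇒m<1+n r<)) (empty r r<))
            ; nonneg       = λ i i<1+N → subst (0# ≤_) (sym (weights₆ i)) (V.nonneg i i<1+N)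
            ; covered      = λ e′ e≤e′ → subst (λ C → proj₁ (endpoints e′) ∈ C ⊎ proj₂ (endpoints e′) ∈ C) (sym cover′) (grow e′ e≤e′)
            ; almostSurely = subst (λ C → mean (suc N) υ (minusIndicator C) ≤ - 1#) (sym cover′) almostSurely′
            ; bounded      = λ K K-cover → ≤-respˡ-≈ (≈-sym (mean₆ (potential K)))
                (≤-trans
                  (potential-step {N} {suc N} {weight (val σ₃)} {weight (val τ₄)} {scenario (nat σ₃)} {scenario (nat τ₄)}
                    V.nonneg {u} {v} {K} {val σ₃ 0} (ends K K-cover) V.decreasing spent₃
                    (≈-trans (mean₃ (gain u)) (≈-sym budget)))
                  (≤-respˡ-≈ (≈-sym (mean₃ (potential K))) (bounded K K-cover)))
            }
            where
            -- Adding u everywhere turns C ⊆ A into C ∪ u ⊆ A ∪ u, and the earlier insertion of v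
            -- only enlarged scenarios, so no weight is lost.
            almostSurely′ : mean (suc N) υ (minusIndicator (cover ∪ ⁅ u ⁆)) ≤ - 1#
            almostSurely′ = ≤-respˡ-≈ (≈-sym (mean₆ (minusIndicator (cover ∪ ⁅ u ⁆))))
              (≤-trans
                (Expectation.E-mono (suc N) (weight (val τ₄)) (scenario (nat τ₄)) V.nonneg {h′ = minusIndicator cover}
                  λ A → minusIndicator-antitone {cover} {A} {cover ∪ ⁅ u ⁆} {A ∪ ⁅ u ⁆} λ C⊆A → ∪-mono C⊆A ⊆-refl)
                (≤-trans
                  (V.decreasing (minusIndicator cover) λ A →
                    minusIndicator-antitone {cover} {A} {cover} {A ∪ ⁅ v ⁆} λ C⊆A → ⊆-trans C⊆A (p⊆p∪q ⁅ v ⁆))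
                  (≤-respˡ-≈ (≈-sym (mean₃ (minusIndicator cover))) almostSurely)))

          e₆ : nat υ 8 ≡ e
          e₆ = trans (J.agree 8 (ℕₚ.m≤m+n 9 2)) (trans (V.agree 8 (ℕₚ.m≤m+n 9 2)) e₃)

  process-edge-runs : ∀ {B} e τ → n ℕ.≤ B → suc m ℕ.≤ B → e ℕ.< m → Covering (suc e) τ →
    Runs process-edge ⟨ nat τ [ 8 ↦ e ] , val τ ⟩ (edgeTime B) (λ υ → nat υ 8 ≡ e × Covering e υ)
  process-edge-runs {B} e τ n≤B m<B e<m inv =
    assignᴺ-then assignᴺ-then assignᴿ-then assignᴿ-then
    seq-runs (measure-runs {proj₁ (endpoints edge)} {proj₂ (endpoints edge)} σ₁ N≤B
      (trans (agree₁ 6 (ℕₚ.n≤1+n 7)) end) (trans (agree₁ 7 ℕₚ.≤-refl) count)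
      (endpointOf-< proj₁ e<m) (endpointOf-< proj₂ e<m) refl refl) λ _ measured →
    seq-runs (choose-runs edge σ₁ (endpointOf-< proj₁ e<m) (endpointOf-< proj₂ e<m) measured) λ _ chosen →
    let open AfterChoice chosen in
    let open Chosen chosen using (u; v; v≡) in
    assignᴿ-then
    seq-runs (raise-runs {v} σ₃ n≤B N≤B σ₃-6 σ₃-7 v≡ nonneg₃ fresh 0≤budget cheaper₃) λ _ raised →
    let open AfterRaise raised in
    assignᴺ-then assignᴺ-then
    seq-runs (insert-runs {u} σ₅ 1+N≤B σ₅-6 σ₅-7 σ₅-9) λ _ ins →
    let open AfterInsert ins in
    assignᴺ-runs (e₆ , covering)
    where
    open ProcessEdge e<m inv
    open Covering inv using (N; end; count)
    1+N≤B : suc N ℕ.≤ B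
    1+N≤B = ℕₚ.≤-trans (ℕₚ.≤-trans (ℕₚ.m≤m+n (suc N) e) (ℕₚ.≤-reflexive 1+N+e)) m<B
    N≤B : N ℕ.≤ B
    N≤B = ℕₚ.≤-trans (ℕₚ.n≤1+n N) 1+N≤B

-- Register 9 and field cell 0: the best unmarked vertex so far (order if there
-- is none) and its cost.
scan : Program
scan = (lit 9 ≔ᴺ order) ⨾ Loop 11 order (
  (cell 4 11 ≔ᴺ lit 1) ⨾
  (lit 1 ≔ᴿ query-row 4) ⨾
  (cell 4 11 ≔ᴺ lit 0) ⨾
  (If (loadᴺ (cell 3 11) ≤ᴺ lit 0) ∧ᴮ (¬ᴮ ((reg 9 +ᴺ lit 1 ≤ᴺ order) ∧ᴮ (¬ᴮ (value 1 ≤ᴿ value 0))))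
   Then (lit 9 ≔ᴺ reg 11) ⨾ (lit 0 ≔ᴿ value 1)
   Else skip))

select : Program
select = (lit 12 ≔ᴺ reg 3) ⨾ Loop 8 parts (
  (lit 12 ≔ᴺ reg 12 ∸ᴺ order) ⨾
  scan ⨾
  (cell 12 9 ≔ᴺ lit 1) ⨾
  (cell 3 9 ≔ᴺ lit 1))

module _ {p q r} {P : Set p} {Q : Set q} {S : Set r} where
  -- Programs have no disjunction, so the guard of `scan` negates a conjunction. Decidability
  -- recovers the disjunction that is meant.
  guard-true : (d₁ : Dec P) (d₂ : Dec Q) (d₃ : Dec S) →
    does d₁ ∧ not (does d₂ ∧ not (does d₃)) ≡ true → P × (¬ Q ⊎ S)
  guard-true (yes p) (no ¬q) _       _ = p , inj₁ ¬q
  guard-true (yes p) (yes _) (yes s) _ = p , inj₂ s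

  guard-false : (d₁ : Dec P) (d₂ : Dec Q) (d₃ : Dec S) →
    does d₁ ∧ not (does d₂ ∧ not (does d₃)) ≡ false → ¬ P ⊎ (Q × ¬ S)
  guard-false (no ¬p) _       _       _ = inj₁ ¬p
  guard-false (yes _) (yes q) (no ¬s) _ = inj₂ (q , ¬s)

-- Selecting the cheapest vertices

module Selection {c ℓ₁ ℓ₂} (R : OrderedField c ℓ₁ ℓ₂) (I : Instance R) where
  open Ordered R
  open Instance I
  open Machine R I
  open CoverPhase R I
  open EdgeStep R I
  open Sums R

  cell-∉ : ∀ {y} {A : Subset n} {x} → bit y ≡ lookup A x → y ℕ.≤ 0 → x ∉ A
  cell-∉ {zero} bit≡ _ x∈A with trans bit≡ (Vecₚ.[]=⇒lookup x∈A)
  ... | ()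

  cell-∈ : ∀ {y} {A : Subset n} {x} → bit y ≡ lookup A x → ¬ (y ℕ.≤ 0) → x ∈ A
  cell-∈ {zero}  bit≡ y≰0 = contradiction z≤n y≰0
  cell-∈ {suc y} bit≡ _   = Vecₚ.lookup⇒[]= _ _ (sym bit≡)

  markedRow scratchRow : ℕ
  markedRow = k ℕ.+ k
  scratchRow  = suc (k ℕ.+ k)

  module _ {B : ℕ} (σ : State R) (n≤B : n ℕ.≤ B)
    (σ3 : nat σ 3 ≡ markedRow ℕ.* n) (σ4 : nat σ 4 ≡ scratchRow ℕ.* n) (blank : row (nat σ) scratchRow ≡ ⊥) where

    private
      M : Subset n
      M = row (nat σ) markedRow

    -- Until an unmarked vertex is met, field cell 0 holds a leftover of an earlier computation. So
    -- `none` says nothing about it, and the guard ignores it by testing whether register 9 is below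
    -- `order`.
    data Best (j : ℕ) (τ : State R) : Set (c ⊔ ℓ₂) where
      none : nat τ 9 ≡ n → (∀ x → j ℕ.≤ toℕ x → x ∈ M) → Best j τ
      best : ∀ b → nat τ 9 ≡ toℕ b → val τ 0 ≡ f ⁅ b ⁆ → b ∉ M →
        (∀ x → j ℕ.≤ toℕ x → x ∉ M → f ⁅ b ⁆ ≤ f ⁅ x ⁆) → Best j τ

    record Scanned (j : ℕ) (τ : State R) : Set (c ⊔ ℓ₂) where
      field
        agree : ∀ i → i ℕ.< 15 → i ≢ 9 → i ≢ 11 → nat τ i ≡ nat σ i
        rows  : ∀ r → row (nat τ) r ≡ row (nat σ) r
        found : Best j τ

    scan-runs : Runs scan σ (suc (loopTime B 6)) (Scanned 0)
    scan-runs = assignᴺ-then loop-runs Scanned n _ refl n≤B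
      record
        { agree = λ i _ i≢9 i≢11 → trans (updated-other (nat σ [ 9 ↦ n ]) i≢11) (updated-other (nat σ) i≢9)
        ; rows  = λ _ → refl
        ; found = none refl (λ x n≤x → contradiction (Finₚ.toℕ<n x) (ℕₚ.≤⇒≯ n≤x)) }
      body
      where
      body : ∀ j τ → j ℕ.< n → nat τ 11 ≡ suc j → Scanned (suc j) τ →
        Runs _ ⟨ nat τ [ 11 ↦ j ] , val τ ⟩ 6 (λ υ → nat υ 11 ≡ j × Scanned j υ)
      body j τ j<n _ inv =
        assignᴺ-then assignᴿ-then assignᴺ-then
        if-runs
          (λ guard → assignᴺ-then assignᴿ-runs (refl , record
            { agree = λ i i<15 i≢9 i≢11 → trans (updated-other m₂ i≢9) (agree₂ i i<15 i≢9 i≢11)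
            ; rows = rows₂
            ; found = improve (guard-true (_ ℕ.≤? _) (_ ℕ.≤? _) (_ ≤? _) guard) }))
          (λ guard → weaken-runs (s≤s z≤n) (λ _ post → post) (skip-runs (refl , record
            { agree = agree₂ ; rows = rows₂
            ; found = keep (guard-false (_ ℕ.≤? _) (_ ℕ.≤? _) (_ ≤? _) guard) })))
        where
        open Scanned inv
        v : Fin n
        v = Fin.fromℕ< j<n
        v≡ : j ≡ toℕ v
        v≡ = sym (Finₚ.toℕ-fromℕ< j<n)
        m₀ m₁ m₂ : ℕ → ℕ
        a = 15 ℕ.+ (nat τ 4 ℕ.+ j)
        m₀ = nat τ [ 11 ↦ j ]
        m₁ = m₀ [ a ↦ 1 ]
        m₂ = m₁ [ a ↦ 0 ]
        τ-4 : nat τ 4 ≡ scratchRow ℕ.* n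
        τ-4 = trans (agree 4 (ℕₚ.m≤m+n 5 10) (λ ()) (λ ())) σ4
        τ-3 : nat τ 3 ≡ markedRow ℕ.* n
        τ-3 = trans (agree 3 (ℕₚ.m≤m+n 4 11) (λ ()) (λ ())) σ3
        scratch₁ : row m₁ scratchRow ≡ ⊥ ∪ ⁅ v ⁆
        scratch₁ = trans (row-insert m₀ {r = scratchRow} {v} τ-4 v≡) (cong (_∪ ⁅ v ⁆) (trans (rows scratchRow) blank))
        query≡ : f (readSubset n m₁ (15 ℕ.+ nat τ 4)) ≡ f ⁅ v ⁆
        query≡ = trans (cong (λ p → f (readSubset n m₁ (15 ℕ.+ p))) τ-4)
          (cong f (trans scratch₁ (∪-identityˡ ⁅ v ⁆)))
        agree₂ : ∀ i → i ℕ.< 15 → i ≢ 9 → i ≢ 11 → m₂ i ≡ nat σ i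
        agree₂ i i<15 i≢9 i≢11 = trans (agree-updated m₁ {a} (ℕₚ.m≤m+n 15 _) i i<15)
          (trans (agree-updated m₀ {a} (ℕₚ.m≤m+n 15 _) i i<15) (trans (updated-other (nat τ) i≢11) (agree i i<15 i≢9 i≢11)))
        -- The scratch row was blank, so 0 is the entry that the query overwrote, and the row is
        -- blank again for the next candidate.
        rows₂ : ∀ r → row m₂ r ≡ row (nat σ) r
        rows₂ r with r ℕ.≟ scratchRow
        ... | no r≢    = trans (row-other m₁ {r = scratchRow} {v} τ-4 v≡ 0 r≢)
                           (trans (row-other m₀ {r = scratchRow} {v} τ-4 v≡ 1 r≢) (rows r))
        ... | yes refl = trans (row-write m₁ {r = scratchRow} {v} τ-4 v≡ 0)
          (trans (cong₂ (λ A b → A [ v ]≔ b) scratch₁ (sym (Vecₚ.lookup-replicate v outside)))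
            (trans (insert-undo ⊥ v) (sym blank)))
        marked : bit (m₂ (15 ℕ.+ (nat τ 3 ℕ.+ j))) ≡ lookup M v
        marked = trans (cell-bit m₂ {r = markedRow} {v} τ-3 v≡) (cong (λ A → lookup A v) (rows₂ markedRow))
        q = f (readSubset n m₁ (15 ℕ.+ nat τ 4))
        later : ∀ {x} → j ℕ.≤ toℕ x → x ≢ v → suc j ℕ.≤ toℕ x
        later j≤x x≢v = ℕₚ.≤∧≢⇒< j≤x λ j≡x → x≢v (Finₚ.toℕ-injective (trans (sym j≡x) v≡))
        improve : m₂ (15 ℕ.+ (nat τ 3 ℕ.+ j)) ℕ.≤ 0 × (¬ (nat τ 9 ℕ.+ 1 ℕ.≤ n) ⊎ q ≤ val τ 0) →
          Best j ⟨ m₂ [ 9 ↦ j ] , (val τ [ 1 ↦ q ]) [ 0 ↦ q ] ⟩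
        improve (cell≤0 , better) = best v v≡ query≡ v∉M minimal
          where
          v∉M : v ∉ M
          v∉M = cell-∉ marked cell≤0
          minimal : ∀ x → j ℕ.≤ toℕ x → x ∉ M → f ⁅ v ⁆ ≤ f ⁅ x ⁆
          minimal x j≤x x∉M with x Fin.≟ v
          ... | yes refl = ≤-refl
          ... | no x≢v with found
          ...   | none _ all∈M = contradiction (all∈M x (later j≤x x≢v)) x∉M
          ...   | best b b≡ fb≡ _ b-min =
            [ contradiction (subst (ℕ._≤ n) (trans (ℕₚ.+-comm 1 (toℕ b)) (cong (ℕ._+ 1) (sym b≡))) (Finₚ.toℕ<n b))
            , (λ q≤ → ≤-trans (subst (_≤ f ⁅ b ⁆) query≡ (subst (q ≤_) fb≡ q≤)) (b-min x (later j≤x x≢v) x∉M)) ]′ better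
        keep : ¬ (m₂ (15 ℕ.+ (nat τ 3 ℕ.+ j)) ℕ.≤ 0) ⊎ (nat τ 9 ℕ.+ 1 ℕ.≤ n × ¬ (q ≤ val τ 0)) →
          Best j ⟨ m₂ , val τ [ 1 ↦ q ] ⟩
        keep reason with found
        ... | none b≡n all∈M = none b≡n λ x j≤x → in-M x j≤x
          where
          in-M : ∀ x → j ℕ.≤ toℕ x → x ∈ M
          in-M x j≤x with x Fin.≟ v
          ... | no x≢v = all∈M x (later j≤x x≢v)
          ... | yes refl =
            [ cell-∈ marked
            , (λ { (b<n , _) → contradiction (subst (λ b → b ℕ.+ 1 ℕ.≤ n) b≡n b<n) (ℕₚ.<⇒≱ (ℕₚ.≤-reflexive (ℕₚ.+-comm 1 n))) }) ]′ reason
        ... | best b b≡ fb≡ b∉M b-min = best b b≡ fb≡ b∉M minimal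
          where
          minimal : ∀ x → j ℕ.≤ toℕ x → x ∉ M → f ⁅ b ⁆ ≤ f ⁅ x ⁆
          minimal x j≤x x∉M with x Fin.≟ v
          ... | no x≢v = b-min x (later j≤x x≢v) x∉M
          ... | yes refl =
            [ (λ cell≰0 → contradiction (cell-∈ marked cell≰0) x∉M)
            , (λ { (_ , q≰) → subst (f ⁅ b ⁆ ≤_) query≡ (subst (_≤ q) fb≡ (≰⇒≥ q≰)) }) ]′ reason

  -- The output rows are filled from the last to the first: the pointer starts at the marked row 2k,
  -- directly behind them. A new vertex is therefore put in front of t, and entry l belongs to row k
  -- + (j + l).
  record Selected (C : Subset n) (j : ℕ) (τ : State R) : Set (c ⊔ ℓ₂) where
    field
      chosen      : ℕ
      j+chosen    : j ℕ.+ chosen ≡ k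
      t           : Fin chosen → Fin n
      output-row  : nat τ 2 ≡ k ℕ.* n
      marked-row  : nat τ 3 ≡ markedRow ℕ.* n
      scratch-row : nat τ 4 ≡ scratchRow ℕ.* n
      cover-row   : nat τ 5 ≡ coverRow ℕ.* n
      pointer     : nat τ 12 ≡ (k ℕ.+ j) ℕ.* n
      scratch     : row (nat τ) scratchRow ≡ ⊥
      cover       : row (nat τ) coverRow ≡ C
      marked⇒     : ∀ {x} → x ∈ row (nat τ) markedRow → ∃[ l ] t l ≡ x
      marked⇐     : ∀ l → t l ∈ row (nat τ) markedRow
      blank       : ∀ r → r ℕ.< k ℕ.+ j → row (nat τ) r ≡ ⊥
      outputs     : ∀ l → row (nat τ) (k ℕ.+ (j ℕ.+ toℕ l)) ≡ ⁅ t l ⁆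
      injective   : Injective _≡_ _≡_ t
      cheapest    : Cheapest (f ∘ ⁅_⁆) t

  select-runs : ∀ {C B} σ → n ℕ.≤ B → nat σ 2 ≡ k ℕ.* n → nat σ 3 ≡ markedRow ℕ.* n →
    nat σ 4 ≡ scratchRow ℕ.* n → nat σ 5 ≡ coverRow ℕ.* n → row (nat σ) coverRow ≡ C →
    (∀ r → r ℕ.< coverRow → row (nat σ) r ≡ ⊥) →
    Runs select σ (suc (loopTime B (suc (suc (loopTime B 6) ℕ.+ 2)))) (Selected C 0)
  select-runs {C} {B} σ n≤B σ2 σ3 σ4 σ5 σC empty =
    assignᴺ-then loop-runs (Selected C) k B refl (ℕₚ.≤-trans k≤n n≤B)
      record
        { chosen = 0 ; j+chosen = ℕₚ.+-identityʳ k ; t = λ ()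
        ; output-row = σ2 ; marked-row = σ3 ; scratch-row = σ4 ; cover-row = σ5 ; pointer = σ3
        ; scratch = empty scratchRow ℕₚ.≤-refl ; cover = σC
        ; marked⇒ = λ {x} x∈ → contradiction (subst (x ∈_) (empty markedRow (ℕₚ.n≤1+n _)) x∈) ∉⊥
        ; marked⇐ = λ ()
        ; blank = λ r r< → empty r (ℕₚ.m<n⇒m<1+n (ℕₚ.m<n⇒m<1+n r<))
        ; outputs = λ ()
        ; injective = λ {} ; cheapest = λ _ _ → ≤-refl }
      body
    where
    body : ∀ j τ → j ℕ.< k → nat τ 8 ≡ suc j → Selected C (suc j) τ →
      Runs _ ⟨ nat τ [ 8 ↦ j ] , val τ ⟩ (suc (suc (loopTime B 6) ℕ.+ 2)) (λ υ → nat υ 8 ≡ j × Selected C j υ)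
    body j τ j<k _ inv =
      assignᴺ-then
      seq-runs (scan-runs τ₀ n≤B marked-row scratch-row scratch) λ τ₁ scanned →
      assignᴺ-then assignᴺ-runs (finish scanned)
      where
      open Selected inv
      τ₀ : State R
      τ₀ = ⟨ (nat τ [ 8 ↦ j ]) [ 12 ↦ nat τ 12 ℕ.∸ n ] , val τ ⟩
      p₀ : nat τ 12 ℕ.∸ n ≡ (k ℕ.+ j) ℕ.* n
      p₀ = previous-row {r = k ℕ.+ j} (trans pointer (cong (ℕ._* n) (ℕₚ.+-suc k j)))
      1+chosen≤n : suc chosen ℕ.≤ n
      1+chosen≤n = ℕₚ.≤-trans (ℕₚ.≤-trans (s≤s (ℕₚ.m≤n+m chosen j)) (ℕₚ.≤-reflexive j+chosen)) k≤n
      -- Fewer than k ≤ n vertices are marked, so one of the first `suc chosen` vertices is not.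
      -- This rules out the outcome `none` of the scan.
      unmarked : ∃[ x ] x ∉ row (nat τ) markedRow
      unmarked with missed (f ∘ ⁅_⁆) t (λ i → Fin.inject≤ i 1+chosen≤n) (Finₚ.inject≤-injective 1+chosen≤n 1+chosen≤n _ _)
      ... | l , missing = _ , λ x∈ → missing (marked⇒ x∈)
      module _ {τ₁ : State R} (scanned : Scanned τ₀ n≤B marked-row scratch-row scratch 0 τ₁) where
        open Scanned scanned
        υ : State R
        υ = ⟨ (nat τ₁ [ 15 ℕ.+ (nat τ₁ 12 ℕ.+ nat τ₁ 9) ↦ 1 ]) [ 15 ℕ.+ (nat τ₁ 3 ℕ.+ nat τ₁ 9) ↦ 1 ] , val τ₁ ⟩
        finish : nat υ 8 ≡ j × Selected C j υ
        finish with found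
        ... | none _ all∈M = contradiction (all∈M (proj₁ unmarked) z≤n) (proj₂ unmarked)
        ... | best b b≡ _ b∉M b-min = at 8 (ℕₚ.m≤m+n 9 6) (λ ()) (λ ()) , record
          { chosen = suc chosen ; j+chosen = trans (ℕₚ.+-suc j chosen) j+chosen ; t = b ◂ t
          ; output-row = trans (at 2 (ℕₚ.m≤m+n 3 12) (λ ()) (λ ())) output-row
          ; marked-row = q₁
          ; scratch-row = trans (at 4 (ℕₚ.m≤m+n 5 10) (λ ()) (λ ())) scratch-row
          ; cover-row = trans (at 5 (ℕₚ.m≤m+n 6 9) (λ ()) (λ ())) cover-row
          ; pointer = p₁
          ; scratch = trans (other (ℕₚ.<⇒≢ (ℕₚ.m<n⇒m<1+n k+j<M) ∘ sym) (ℕₚ.1+n≢n)) scratch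
          ; cover = trans (other (ℕₚ.<⇒≢ (ℕₚ.m<n⇒m<1+n (ℕₚ.m<n⇒m<1+n k+j<M)) ∘ sym) (ℕₚ.<⇒≢ (ℕₚ.m<n⇒m<1+n ℕₚ.≤-refl) ∘ sym)) cover
          ; marked⇒ = marked⇒′ ; marked⇐ = marked⇐′
          ; blank = λ r r< → trans (other (ℕₚ.<⇒≢ r<) (ℕₚ.<⇒≢ (ℕₚ.<-trans r< k+j<M)))
              (blank r (ℕₚ.<-≤-trans r< (ℕₚ.+-monoʳ-≤ k (ℕₚ.n≤1+n j))))
          ; outputs = output′
          ; injective = injective′
          ; cheapest = Cheapest-∷ (f ∘ ⁅_⁆) (λ x x∉t → b-min x z≤n λ x∈M → x∉t (marked⇒ x∈M)) cheapest }
          where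
          m₁ m₂ : ℕ → ℕ
          m₁ = nat τ₁ [ 15 ℕ.+ (nat τ₁ 12 ℕ.+ nat τ₁ 9) ↦ 1 ]
          m₂ = m₁ [ 15 ℕ.+ (nat τ₁ 3 ℕ.+ nat τ₁ 9) ↦ 1 ]
          at : ∀ i → i ℕ.< 15 → i ≢ 9 → i ≢ 11 → m₂ i ≡ nat τ₀ i
          at i i<15 i≢9 i≢11 = trans (agree-updated m₁ {15 ℕ.+ (nat τ₁ 3 ℕ.+ nat τ₁ 9)} (ℕₚ.m≤m+n 15 _) i i<15)
            (trans (agree-updated (nat τ₁) {15 ℕ.+ (nat τ₁ 12 ℕ.+ nat τ₁ 9)} (ℕₚ.m≤m+n 15 _) i i<15) (agree i i<15 i≢9 i≢11))
          p₁ : nat τ₁ 12 ≡ (k ℕ.+ j) ℕ.* n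
          p₁ = trans (agree 12 (ℕₚ.m≤m+n 13 2) (λ ()) (λ ())) p₀
          q₁ : nat τ₁ 3 ≡ markedRow ℕ.* n
          q₁ = trans (agree 3 (ℕₚ.m≤m+n 4 11) (λ ()) (λ ())) marked-row
          k+j<M : k ℕ.+ j ℕ.< markedRow
          k+j<M = ℕₚ.+-monoʳ-< k j<k
          other : ∀ {r} → r ≢ k ℕ.+ j → r ≢ markedRow → row m₂ r ≡ row (nat τ) r
          other {r} r≢k+j r≢M = trans (row-other m₁ {r = markedRow} {b} q₁ b≡ 1 r≢M)
            (trans (row-other (nat τ₁) {r = k ℕ.+ j} {b} p₁ b≡ 1 r≢k+j) (rows r))
          marked₂ : row m₂ markedRow ≡ row (nat τ) markedRow ∪ ⁅ b ⁆
          marked₂ = trans (row-insert m₁ {r = markedRow} {b} q₁ b≡)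
            (cong (_∪ ⁅ b ⁆) (trans (row-other (nat τ₁) {r = k ℕ.+ j} {b} p₁ b≡ 1 (ℕₚ.<⇒≢ k+j<M ∘ sym)) (rows markedRow)))
          marked⇒′ : ∀ {x} → x ∈ row m₂ markedRow → ∃[ l ] (b ◂ t) l ≡ x
          marked⇒′ {x} x∈ with x∈p∪q⁻ (row (nat τ) markedRow) ⁅ b ⁆ (subst (x ∈_) marked₂ x∈)
          ... | inj₁ x∈M = let (l , tl≡x) = marked⇒ x∈M in suc l , tl≡x
          ... | inj₂ x∈b = zero , sym (x∈⁅y⁆⇒x≡y b x∈b)
          marked⇐′ : ∀ l → (b ◂ t) l ∈ row m₂ markedRow
          marked⇐′ zero    = subst (b ∈_) (sym marked₂) (v∈A∪⁅v⁆ (row (nat τ) markedRow) b)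
          marked⇐′ (suc l) = subst (t l ∈_) (sym marked₂) (p⊆p∪q ⁅ b ⁆ (marked⇐ l))
          j+l<k : ∀ l → suc (j ℕ.+ toℕ l) ℕ.< k
          j+l<k l = ℕₚ.<-≤-trans (s≤s (ℕₚ.+-monoʳ-< j (Finₚ.toℕ<n l))) (ℕₚ.≤-reflexive j+chosen)
          output′ : ∀ l → row m₂ (k ℕ.+ (j ℕ.+ toℕ l)) ≡ ⁅ (b ◂ t) l ⁆
          output′ zero rewrite ℕₚ.+-identityʳ j =
            trans (row-other m₁ {r = markedRow} {b} q₁ b≡ 1 (ℕₚ.<⇒≢ k+j<M))
              (trans (row-insert (nat τ₁) {r = k ℕ.+ j} {b} p₁ b≡)
                (trans (cong (_∪ ⁅ b ⁆) (trans (rows (k ℕ.+ j)) (blank (k ℕ.+ j) (ℕₚ.≤-reflexive (sym (ℕₚ.+-suc k j))))))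
                  (∪-identityˡ ⁅ b ⁆)))
          output′ (suc l) rewrite ℕₚ.+-suc j (toℕ l) =
            trans (other (λ eq → ℕₚ.<⇒≢ (s≤s (ℕₚ.m≤m+n j (toℕ l))) (sym (ℕₚ.+-cancelˡ-≡ k _ _ eq)))
                         (ℕₚ.<⇒≢ (ℕₚ.+-monoʳ-< k (j+l<k l))))
              (outputs l)
          injective′ : Injective _≡_ _≡_ (b ◂ t)
          injective′ {zero}  {zero}  _  = refl
          injective′ {zero}  {suc l} eq = contradiction (subst (_∈ row (nat τ) markedRow) (sym eq) (marked⇐ l)) b∉M
          injective′ {suc l} {zero}  eq = contradiction (subst (_∈ row (nat τ) markedRow) eq (marked⇐ l)) b∉M
          injective′ {suc l} {suc i} eq = cong suc (injective eq)

-- Assembling the output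

add-remainder : Program
add-remainder = Loop 11 order (
  If (loadᴺ (cell 3 11) ≤ᴺ lit 0) ∧ᴮ (lit 1 ≤ᴺ loadᴺ (cell 5 11))
  Then (cell 2 11 ≔ᴺ lit 1)
  Else skip)

-- The output rows are moved to the front, overwriting the registers. Cells 1
-- and 0, the only registers still in use, come last.
move-output : Program
move-output =
  (lit 0 ≔ᴺ lit 15 +ᴺ reg 2) ⨾
  Loop 1 (reg 2) (lit 2 +ᴺ reg 1 ≔ᴺ loadᴺ (reg 0 +ᴺ (lit 2 +ᴺ reg 1))) ⨾
  (lit 1 ≔ᴺ loadᴺ (reg 0 +ᴺ lit 1)) ⨾
  (lit 0 ≔ᴺ loadᴺ (reg 0))

module _ {p q} {P : Set p} {Q : Set q} where
  both-true : (d₁ : Dec P) (d₂ : Dec Q) → does d₁ ∧ does d₂ ≡ true → P × Q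
  both-true (yes p) (yes q) _ = p , q

  both-false : (d₁ : Dec P) (d₂ : Dec Q) → does d₁ ∧ does d₂ ≡ false → P → ¬ Q
  both-false (no ¬p) _       _ p = contradiction p ¬p
  both-false (yes _) (no ¬q) _ _ = ¬q

module Finish {c ℓ₁ ℓ₂} (R : OrderedField c ℓ₁ ℓ₂) (I : Instance R) where
  open Instance I
  open Machine R I
  open CoverPhase R I
  open EdgeStep R I
  open Selection R I

  record Remaining (C M S : Subset n) (σ : State R) (j : ℕ) (τ : State R) : Set c where
    field
      agree    : AgreeBelow 11 (nat τ) (nat σ)
      others   : ∀ {r} → r ≢ k → row (nat τ) r ≡ row (nat σ) r
      old      : S ⊆ row (nat τ) k
      sound    : ∀ {x} → x ∈ row (nat τ) k → x ∈ S ⊎ (x ∈ C × x ∉ M)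
      complete : ∀ x → j ℕ.≤ toℕ x → x ∈ C → x ∉ M → x ∈ row (nat τ) k

  remainder-runs : ∀ {B} σ → n ℕ.≤ B → nat σ 2 ≡ k ℕ.* n → nat σ 3 ≡ markedRow ℕ.* n → nat σ 5 ≡ coverRow ℕ.* n →
    Runs add-remainder σ (loopTime B 2) (Remaining (row (nat σ) coverRow) (row (nat σ) markedRow) (row (nat σ) k) σ 0)
  remainder-runs {B} σ n≤B σ2 σ3 σ5 = loop-runs (Remaining C M S σ) n B refl n≤B
    record
      { agree = λ i i<11 → agree-updated (nat σ) ℕₚ.≤-refl i i<11
      ; others = λ _ → refl ; old = λ x∈ → x∈ ; sound = inj₁
      ; complete = λ x n≤x → contradiction (Finₚ.toℕ<n x) (ℕₚ.≤⇒≯ n≤x) }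
    body
    where
    C = row (nat σ) coverRow
    M = row (nat σ) markedRow
    S = row (nat σ) k
    -- The first output row k differs from the marked row 2k because k is at least 1.
    k<M : k ℕ.< markedRow
    k<M = ℕₚ.≤-trans (ℕₚ.≤-reflexive (ℕₚ.+-comm 1 k)) (ℕₚ.+-monoʳ-≤ k 1≤k)
    M≢k : markedRow ≢ k
    M≢k = ℕₚ.<⇒≢ k<M ∘ sym
    C≢k : coverRow ≢ k
    C≢k = ℕₚ.<⇒≢ (ℕₚ.m<n⇒m<1+n (ℕₚ.m<n⇒m<1+n k<M)) ∘ sym
    body : ∀ j τ → j ℕ.< n → nat τ 11 ≡ suc j → Remaining C M S σ (suc j) τ →
      Runs _ ⟨ nat τ [ 11 ↦ j ] , val τ ⟩ 2 (λ υ → nat υ 11 ≡ j × Remaining C M S σ j υ)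
    body j τ j<n _ inv = if-runs
      (λ guard → assignᴺ-runs (refl , add (both-true (_ ℕ.≤? _) (_ ℕ.≤? _) guard)))
      (λ guard → skip-runs (refl , keep (both-false (_ ℕ.≤? _) (_ ℕ.≤? _) guard)))
      where
      open Remaining inv
      μ = nat τ [ 11 ↦ j ]
      v : Fin n
      v = Fin.fromℕ< j<n
      v≡ : j ≡ toℕ v
      v≡ = sym (Finₚ.toℕ-fromℕ< j<n)
      agree′ : AgreeBelow 11 μ (nat σ)
      agree′ i i<11 = trans (agree-updated (nat τ) ℕₚ.≤-refl i i<11) (agree i i<11)
      τ-2 : nat τ 2 ≡ k ℕ.* n
      τ-2 = trans (agree 2 (ℕₚ.m≤m+n 3 8)) σ2
      inM : bit (μ (15 ℕ.+ (nat τ 3 ℕ.+ j))) ≡ lookup M v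
      inM = trans (cell-bit μ {r = markedRow} {v} (trans (agree 3 (ℕₚ.m≤m+n 4 7)) σ3) v≡)
                  (cong (λ A → lookup A v) (others M≢k))
      inC : bit (μ (15 ℕ.+ (nat τ 5 ℕ.+ j))) ≡ lookup C v
      inC = trans (cell-bit μ {r = coverRow} {v} (trans (agree 5 (ℕₚ.m≤m+n 6 5)) σ5) v≡)
                  (cong (λ A → lookup A v) (others C≢k))
      later : ∀ {x} → j ℕ.≤ toℕ x → x ≢ v → suc j ℕ.≤ toℕ x
      later j≤x x≢v = ℕₚ.≤∧≢⇒< j≤x λ j≡x → x≢v (Finₚ.toℕ-injective (trans (sym j≡x) v≡))
      add : μ (15 ℕ.+ (nat τ 3 ℕ.+ j)) ℕ.≤ 0 × 1 ℕ.≤ μ (15 ℕ.+ (nat τ 5 ℕ.+ j)) →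
        Remaining C M S σ j ⟨ μ [ 15 ℕ.+ (nat τ 2 ℕ.+ j) ↦ 1 ] , val τ ⟩
      add (cell≤0 , 1≤cell) = record
        { agree = λ i i<11 → trans (agree-updated μ {15 ℕ.+ (nat τ 2 ℕ.+ j)} (ℕₚ.m≤m+n 11 _) i i<11) (agree′ i i<11)
        ; others = λ r≢k → trans (row-other μ {r = k} {v} τ-2 v≡ 1 r≢k) (others r≢k)
        ; old = λ {x} x∈ → subst (x ∈_) (sym here) (p⊆p∪q ⁅ v ⁆ (old x∈))
        ; sound = λ {x} x∈ → [ sound , (λ x∈v → inj₂ (subst (λ y → y ∈ C × y ∉ M) (sym (x∈⁅y⁆⇒x≡y v x∈v)) v∈C─M)) ]′
            (x∈p∪q⁻ (row (nat τ) k) ⁅ v ⁆ (subst (x ∈_) here x∈))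
        ; complete = complete′ }
        where
        v∈C─M : v ∈ C × v ∉ M
        v∈C─M = cell-∈ inC (ℕₚ.<⇒≱ 1≤cell) , cell-∉ inM cell≤0
        here : row (μ [ 15 ℕ.+ (nat τ 2 ℕ.+ j) ↦ 1 ]) k ≡ row (nat τ) k ∪ ⁅ v ⁆
        here = row-insert μ {r = k} {v} τ-2 v≡
        complete′ : ∀ x → j ℕ.≤ toℕ x → x ∈ C → x ∉ M → x ∈ row (μ [ 15 ℕ.+ (nat τ 2 ℕ.+ j) ↦ 1 ]) k
        complete′ x j≤x x∈C x∉M with x Fin.≟ v
        ... | yes refl = subst (v ∈_) (sym here) (v∈A∪⁅v⁆ (row (nat τ) k) v)
        ... | no x≢v   = subst (x ∈_) (sym here) (p⊆p∪q ⁅ v ⁆ (complete x (later j≤x x≢v) x∈C x∉M))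
      keep : (μ (15 ℕ.+ (nat τ 3 ℕ.+ j)) ℕ.≤ 0 → ¬ (1 ℕ.≤ μ (15 ℕ.+ (nat τ 5 ℕ.+ j)))) →
        Remaining C M S σ j ⟨ μ , val τ ⟩
      keep reason = record { agree = agree′ ; others = others ; old = old ; sound = sound ; complete = complete′ }
        where
        complete′ : ∀ x → j ℕ.≤ toℕ x → x ∈ C → x ∉ M → x ∈ row (nat τ) k
        complete′ x j≤x x∈C x∉M with x Fin.≟ v
        ... | no x≢v   = complete x (later j≤x x≢v) x∈C x∉M
        ... | yes refl with μ (15 ℕ.+ (nat τ 3 ℕ.+ j)) ℕ.≤? 0
        ...   | no cell≰0  = contradiction (cell-∈ inM cell≰0) x∉M
        ...   | yes cell≤0 = contradiction x∈C (cell-∉ inC (ℕₚ.≮⇒≥ (reason cell≤0)))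

  record Moved (σ : State R) (j : ℕ) (τ : State R) : Set c where
    field
      base   : nat τ 0 ≡ 15 ℕ.+ k ℕ.* n
      source : ∀ x → nat τ (15 ℕ.+ (k ℕ.* n ℕ.+ x)) ≡ nat σ (15 ℕ.+ (k ℕ.* n ℕ.+ x))
      moved  : ∀ x → j ℕ.≤ x → x ℕ.< k ℕ.* n → nat τ (2 ℕ.+ x) ≡ nat σ (15 ℕ.+ (k ℕ.* n ℕ.+ (2 ℕ.+ x)))

  -- The rows 0, ..., k - 1 serve as a gap: the loop writes to cells 2, ..., kn + 1, and the source
  -- starts at cell 15 + kn. No source cell is overwritten before it is read.
  move-runs : ∀ {B} σ → k ℕ.* n ℕ.≤ B → nat σ 2 ≡ k ℕ.* n →
    Runs move-output σ (suc (loopTime B 1 ℕ.+ 2)) (λ υ → ∀ x → x ℕ.< k ℕ.* n → nat υ x ≡ nat σ (15 ℕ.+ (k ℕ.* n ℕ.+ x)))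
  move-runs {B} σ kn≤B σ2 =
    assignᴺ-then
    seq-runs (loop-runs (Moved σ) (k ℕ.* n) B σ2 kn≤B
      record { base = cong (15 ℕ.+_) σ2 ; source = λ _ → refl
             ; moved = λ x kn≤x x<kn → contradiction x<kn (ℕₚ.≤⇒≯ kn≤x) }
      body) λ τ inv →
    assignᴺ-then assignᴺ-runs (final τ inv)
    where
    cell-of : ∀ {p} m x → p ≡ 15 ℕ.+ k ℕ.* n → m (p ℕ.+ x) ≡ m (15 ℕ.+ (k ℕ.* n ℕ.+ x))
    cell-of m x refl = refl
    body : ∀ j τ → j ℕ.< k ℕ.* n → nat τ 1 ≡ suc j → Moved σ (suc j) τ →
      Runs _ ⟨ nat τ [ 1 ↦ j ] , val τ ⟩ 1 (λ υ → nat υ 1 ≡ j × Moved σ j υ)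
    body j τ j<kn _ inv = assignᴺ-runs (refl , record
      { base = base
      ; source = λ x → trans (updated-other μ {i = 2 ℕ.+ j} (far x)) (source x)
      ; moved = moved′ })
      where
      open Moved inv
      μ = nat τ [ 1 ↦ j ]
      y = μ (nat τ 0 ℕ.+ (2 ℕ.+ j))
      far : ∀ x → 15 ℕ.+ (k ℕ.* n ℕ.+ x) ≢ 2 ℕ.+ j
      far x = ℕₚ.<⇒≢ (ℕₚ.<-≤-trans (s≤s (s≤s j<kn)) (s≤s (s≤s (ℕₚ.≤-trans (ℕₚ.m≤m+n _ x) (ℕₚ.m≤n+m _ 13))))) ∘ sym
      moved′ : ∀ x → j ℕ.≤ x → x ℕ.< k ℕ.* n → (μ [ 2 ℕ.+ j ↦ y ]) (2 ℕ.+ x) ≡ nat σ (15 ℕ.+ (k ℕ.* n ℕ.+ (2 ℕ.+ x)))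
      moved′ x j≤x x<kn = by-cases (x ℕ.≟ j)
        where
        by-cases : Dec (x ≡ j) → (μ [ 2 ℕ.+ j ↦ y ]) (2 ℕ.+ x) ≡ nat σ (15 ℕ.+ (k ℕ.* n ℕ.+ (2 ℕ.+ x)))
        by-cases (yes refl) = trans (updated-same μ (2 ℕ.+ j)) (trans (cell-of μ (2 ℕ.+ j) base) (source (2 ℕ.+ j)))
        by-cases (no x≢j)   = trans (updated-other μ {i = 2 ℕ.+ j} λ eq → x≢j (ℕₚ.+-cancelˡ-≡ 2 _ _ eq))
                                    (moved x (ℕₚ.≤∧≢⇒< j≤x (x≢j ∘ sym)) x<kn)
    final : ∀ τ → Moved σ 0 τ → ∀ x → x ℕ.< k ℕ.* n →
      ((nat τ [ 1 ↦ nat τ (nat τ 0 ℕ.+ 1) ]) [ 0 ↦ (nat τ [ 1 ↦ nat τ (nat τ 0 ℕ.+ 1) ]) (nat τ 0) ]) x ≡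
      nat σ (15 ℕ.+ (k ℕ.* n ℕ.+ x))
    final τ inv zero _ = trans (cong (nat τ [ 1 ↦ nat τ (nat τ 0 ℕ.+ 1) ]) base)
      (trans (cong (λ i → nat τ (15 ℕ.+ i)) (sym (ℕₚ.+-identityʳ (k ℕ.* n)))) (source 0))
      where open Moved inv
    final τ inv (suc zero) _ = trans (cell-of (nat τ) 1 base) (source 1)
      where open Moved inv
    final τ inv (suc (suc x)) x<kn = moved x z≤n (ℕₚ.<-trans (ℕₚ.n<1+n x) (ℕₚ.<-trans (ℕₚ.n<1+n (suc x)) x<kn))
      where open Moved inv

  output-row≡ : ∀ {σ υ : State R} → (∀ x → x ℕ.< k ℕ.* n → nat υ x ≡ nat σ (15 ℕ.+ (k ℕ.* n ℕ.+ x))) →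
    ∀ i → output υ i ≡ row (nat σ) (k ℕ.+ toℕ i)
  output-row≡ {σ} {υ} moved i = Vecₚ.tabulate-cong λ v → cong bit
    (trans (moved _ (inside-output v))
      (cong (λ x → nat σ (15 ℕ.+ x)) (trans (sym (ℕₚ.+-assoc (k ℕ.* n) (toℕ i ℕ.* n) (toℕ v)))
        (cong (ℕ._+ toℕ v) (sym (ℕₚ.*-distribʳ-+ n k (toℕ i)))))))
    where
    inside-output : ∀ v → toℕ i ℕ.* n ℕ.+ toℕ v ℕ.< k ℕ.* n
    inside-output v = ℕₚ.<-≤-trans (ℕₚ.+-monoʳ-< (toℕ i ℕ.* n) (Finₚ.toℕ<n v))
      (ℕₚ.≤-trans (ℕₚ.≤-reflexive (ℕₚ.+-comm (toℕ i ℕ.* n) n)) (ℕₚ.*-monoˡ-≤ n (Finₚ.toℕ<n i)))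

-- The whole program and its running time

prepare : Program
prepare =
  -- The products kn and 2kn arise by repeated addition.
  Loop 8 parts ((lit 2 ≔ᴺ order +ᴺ reg 2) ⨾ (lit 3 ≔ᴺ order +ᴺ (order +ᴺ reg 3))) ⨾
  (lit 4 ≔ᴺ order +ᴺ reg 3) ⨾
  (lit 5 ≔ᴺ order +ᴺ reg 4) ⨾
  -- Two rows beyond the cover: the next row is the initial scenario, the empty set with weight 1,
  -- and register 6 points behind it.
  (lit 6 ≔ᴺ order +ᴺ (order +ᴺ reg 5)) ⨾
  (lit 7 ≔ᴺ lit 1) ⨾
  (lit 4 ≔ᴿ 1ᴿ)

algorithm : Program
algorithm = prepare ⨾ Loop 8 edges process-edge ⨾ select ⨾ add-remainder ⨾ move-output

prepareTime selectTime algorithmTime : ℕ → ℕ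
prepareTime B = loopTime B 2 ℕ.+ 5
selectTime B = suc (loopTime B (suc (suc (loopTime B 6) ℕ.+ 2)))
algorithmTime B = prepareTime B ℕ.+ (loopTime B (edgeTime B) ℕ.+ (selectTime B ℕ.+ (loopTime B 2 ℕ.+ suc (loopTime B 1 ℕ.+ 2))))

-- Polynomial bounds

PolynomiallyBounded : (ℕ → ℕ) → Set
PolynomiallyBounded T = ∃[ C ] ∃[ d ] (∀ s → 1 ℕ.≤ s → T s ℕ.≤ C ℕ.* s ℕ.^ d)

const-bounded : ∀ c → PolynomiallyBounded (λ _ → c)
const-bounded c = c , 0 , λ s _ → ℕₚ.≤-reflexive (sym (ℕₚ.*-identityʳ c))

id-bounded : PolynomiallyBounded (λ s → s)
id-bounded = 1 , 1 , λ s _ → ℕₚ.≤-reflexive (sym (trans (ℕₚ.*-identityˡ _) (ℕₚ.*-identityʳ s)))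

infixl 6 _+-bounded_
infixl 7 _*-bounded_

-- The exponents are added instead of taking their maximum; as s is at least 1, the power with the
-- larger exponent dominates both.
_+-bounded_ : ∀ {F G} → PolynomiallyBounded F → PolynomiallyBounded G → PolynomiallyBounded (λ s → F s ℕ.+ G s)
(C , d , F≤) +-bounded (C′ , d′ , G≤) = C ℕ.+ C′ , d ℕ.+ d′ , λ { s@(suc _) 1≤s →
  ℕₚ.≤-trans (ℕₚ.+-mono-≤
      (ℕₚ.≤-trans (F≤ s 1≤s) (ℕₚ.*-monoʳ-≤ C (ℕₚ.^-monoʳ-≤ s (ℕₚ.m≤m+n d d′))))
      (ℕₚ.≤-trans (G≤ s 1≤s) (ℕₚ.*-monoʳ-≤ C′ (ℕₚ.^-monoʳ-≤ s (ℕₚ.m≤n+m d′ d)))))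
    (ℕₚ.≤-reflexive (sym (ℕₚ.*-distribʳ-+ (s ℕ.^ (d ℕ.+ d′)) C C′))) }

_*-bounded_ : ∀ {F G} → PolynomiallyBounded F → PolynomiallyBounded G → PolynomiallyBounded (λ s → F s ℕ.* G s)
(C , d , F≤) *-bounded (C′ , d′ , G≤) = C ℕ.* C′ , d ℕ.+ d′ , λ s 1≤s →
  ℕₚ.≤-trans (ℕₚ.*-mono-≤ (F≤ s 1≤s) (G≤ s 1≤s)) (ℕₚ.≤-reflexive
    (trans (ℕₚ.[m*n]*[o*p]≡[m*o]*[n*p] C (s ℕ.^ d) C′ (s ℕ.^ d′))
      (cong (C ℕ.* C′ ℕ.*_) (sym (ℕₚ.^-distribˡ-+-* s d d′)))))

-- One bound for all loops, which run at most n, m + 1 or kn times. The square is needed for kn,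
-- where k ≤ n.
iterationBound : ℕ → ℕ
iterationBound s = suc s ℕ.* suc s

algorithmTime-bounded : PolynomiallyBounded (λ s → algorithmTime (iterationBound s))
algorithmTime-bounded =
  (loop (const-bounded 2) +-bounded const-bounded 5) +-bounded
  (loop edge +-bounded
  (const-bounded 1 +-bounded loop (const-bounded 1 +-bounded (const-bounded 1 +-bounded loop (const-bounded 6) +-bounded const-bounded 2)) +-bounded
  (loop (const-bounded 2) +-bounded (const-bounded 1 +-bounded (loop (const-bounded 1) +-bounded const-bounded 2)))))
  where
  bound : PolynomiallyBounded iterationBound
  bound = (const-bounded 1 +-bounded id-bounded) *-bounded (const-bounded 1 +-bounded id-bounded)
  loop : ∀ {T} → PolynomiallyBounded T → PolynomiallyBounded (λ s → loopTime (iterationBound s) (T s))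
  loop T = const-bounded 2 +-bounded bound *-bounded (const-bounded 2 +-bounded T)
  raise-body : PolynomiallyBounded (λ s → raiseBodyTime (iterationBound s))
  raise-body = const-bounded 1 +-bounded (const-bounded 4 +-bounded (const-bounded 1 +-bounded
    (const-bounded 1 +-bounded (loop (const-bounded 1) +-bounded const-bounded 3) +-bounded const-bounded 1)))
  edge : PolynomiallyBounded (λ s → edgeTime (iterationBound s))
  edge = const-bounded 4 +-bounded (const-bounded 1 +-bounded loop (const-bounded 13) +-bounded
    (const-bounded 5 +-bounded (const-bounded 1 +-bounded (const-bounded 1 +-bounded loop raise-body +-bounded
      (const-bounded 2 +-bounded (const-bounded 1 +-bounded loop (const-bounded 2) +-bounded const-bounded 1))))))

-- Correctness of the whole program

module Correctness {c ℓ₁ ℓ₂} (R : OrderedField c ℓ₁ ℓ₂) (I : Instance R) where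
  open Ordered R
  open Instance I
  open Problem R I
  open Machine R I
  open Weighted R n
  open SubmodularFunction R f nonNegative monotone submodular
  open CoverPhase R I
  open EdgeStep R I
  open Selection R I
  open Finish R I
  open Approximation R I
  open Sums R

  record Padded (j : ℕ) (τ : State R) : Set c where
    field
      i     : ℕ
      j+i   : j ℕ.+ i ≡ k
      reg-2 : nat τ 2 ≡ i ℕ.* n
      reg-3 : nat τ 3 ≡ (i ℕ.+ i) ℕ.* n
      zeros : ∀ x → nat τ (15 ℕ.+ x) ≡ 0

  empty-row : ∀ {m} → (∀ x → m (15 ℕ.+ x) ≡ 0) → ∀ r → row m r ≡ ⊥
  empty-row {m} zeros r = subset-ext λ v → trans (lookup-row m r v)
    (trans (cong bit (zeros (r ℕ.* n ℕ.+ toℕ v))) (sym (Vecₚ.lookup-replicate v outside)))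

  -- The postcondition anticipates the assignment to counter 8 that opens the loop over the edges,
  -- since `loop-runs` expects the invariant after it.
  prepare-runs : ∀ {B} → k ℕ.≤ B →
    Runs prepare (initial R) (prepareTime B) (λ τ → Covering m ⟨ nat τ [ 8 ↦ m ] , val τ ⟩)
  prepare-runs {B} k≤B =
    seq-runs (loop-runs Padded k B refl k≤B
      record { i = 0 ; j+i = ℕₚ.+-identityʳ k ; reg-2 = refl ; reg-3 = refl ; zeros = λ _ → refl }
      body) λ τ padded →
    assignᴺ-then assignᴺ-then assignᴺ-then assignᴺ-then assignᴿ-runs (start τ padded)
    where
    body : ∀ j τ → j ℕ.< k → nat τ 8 ≡ suc j → Padded (suc j) τ →
      Runs _ ⟨ nat τ [ 8 ↦ j ] , val τ ⟩ 2 (λ υ → nat υ 8 ≡ j × Padded j υ)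
    body j τ _ _ inv = assignᴺ-then assignᴺ-runs (refl , record
      { i = suc i ; j+i = trans (ℕₚ.+-suc j i) j+i
      ; reg-2 = cong (n ℕ.+_) reg-2
      ; reg-3 = trans (cong (λ x → n ℕ.+ (n ℕ.+ x)) reg-3) (cong (λ x → n ℕ.+ x ℕ.* n) (sym (ℕₚ.+-suc i i)))
      ; zeros = zeros })
      where open Padded inv
    start : ∀ τ → Padded 0 τ → Covering m
      ⟨ ((((nat τ [ 4 ↦ n ℕ.+ nat τ 3 ]) [ 5 ↦ n ℕ.+ (n ℕ.+ nat τ 3) ]) [ 6 ↦ n ℕ.+ (n ℕ.+ (n ℕ.+ (n ℕ.+ nat τ 3))) ])
           [ 7 ↦ 1 ]) [ 8 ↦ m ] , val τ [ 4 ↦ 1# ] ⟩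
    start τ padded with Padded.i padded | Padded.j+i padded | Padded.reg-2 padded | Padded.reg-3 padded
    ... | _ | refl | reg-2 | reg-3 = record
      { N = 1 ; N+e = refl ; count = refl
      ; end = cong (λ x → n ℕ.+ (n ℕ.+ (n ℕ.+ (n ℕ.+ x)))) reg-3
      ; output-row = reg-2 ; marked-row = reg-3
      ; scratch-row = cong (n ℕ.+_) reg-3 ; cover-row = cong (λ x → n ℕ.+ (n ℕ.+ x)) reg-3
      ; empty = λ r _ → blank r
      ; nonneg = λ { zero _ → 0≤1 ; (suc _) (s≤s ()) }
      ; covered = λ e′ m≤e′ → contradiction (Finₚ.toℕ<n e′) (ℕₚ.≤⇒≯ m≤e′)
      ; almostSurely = ≤-reflexive (≈-trans (only (minusIndicator (row (nat τ) coverRow)))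
          (≈-reflexive (trans (cong₂ minusIndicator (blank coverRow) refl) (minusIndicator-⊆ {⊥} {⊥} ⊆-refl))))
      ; bounded = λ K _ → ≤-respˡ-≈ (≈-sym (only (potential K)))
          (≤-by (nonNegative ⊥)
            (≈-trans (+-congʳ (+-congʳ (+-cong (≈-reflexive (cong f (∪-identityˡ K))) (≈-reflexive (cong f (∪-identityˡ K))))))
              (solve 2 (λ k o → ((k :+ k) :- o) :+ o := (k :+ k) :+ con (+ 0)) ≈-refl (f K) (f ⊥))))
      }
      where
      blank : ∀ r → row (nat τ) r ≡ ⊥
      blank = empty-row {nat τ} (Padded.zeros padded)
      only : ∀ h → 0# + 1# * h (scenario (nat τ) 0) ≈ h ⊥
      only h = ≈-trans (+-identityˡ _) (≈-trans (*-identityˡ _) (≈-reflexive (cong h (blank (scenarioRow 0)))))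

  module _ {C : Subset n} {τ₂ τ₃ υ : State R} (selected : Selected C 0 τ₂)
    (remaining : Remaining (row (nat τ₂) coverRow) (row (nat τ₂) markedRow) (row (nat τ₂) k) τ₂ 0 τ₃)
    (moved : ∀ x → x ℕ.< k ℕ.* n → nat υ x ≡ nat τ₃ (15 ℕ.+ (k ℕ.* n ℕ.+ x))) where

    output-correct : IsVertexCover graph C → (∀ K → IsVertexCover graph K → f C ≤ f K + f K) →
      Feasible (output υ) × (∀ v → IsOptimalValue v → objective (output υ) ≤ ((1# + 1#) + 1#) * v)
    output-correct C-cover C≤2K
      -- All fields that depend on `chosen` are abstracted together, so that the equation between
      -- `chosen` and `k` can be matched with `refl`.
      with Selected.chosen selected | Selected.j+chosen selected | Selected.t selected | Selected.marked⇒ selected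
         | Selected.marked⇐ selected | Selected.outputs selected | Selected.injective selected | Selected.cheapest selected
    ... | _ | refl | t | marked⇒ | marked⇐ | outputs | injective | cheapest =
      assigned-feasible assigned injective C-cover , assigned-objective assigned cheapest C≤2K
      where
      module D = Remaining remaining
      part : ∀ i → output υ i ≡ row (nat τ₃) (k ℕ.+ toℕ i)
      part = output-row≡ {τ₃} {υ} moved
      first : ∀ i → toℕ i ≡ 0 → output υ i ≡ row (nat τ₃) k
      first i i≡0 = trans (part i) (cong (row (nat τ₃)) (trans (cong (k ℕ.+_) i≡0) (ℕₚ.+-identityʳ k)))
      single : ∀ i → toℕ i ≡ 0 → row (nat τ₂) k ≡ ⁅ t i ⁆
      single i i≡0 = trans (cong (row (nat τ₂)) (sym (trans (cong (k ℕ.+_) i≡0) (ℕₚ.+-identityʳ k)))) (outputs i)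
      rest : ∀ i → toℕ i ≢ 0 → output υ i ≡ ⁅ t i ⁆
      rest i i≢0 = trans (part i) (trans (D.others λ eq → i≢0 (ℕₚ.+-cancelˡ-≡ k _ _ (trans eq (sym (ℕₚ.+-identityʳ k))))) (outputs i))
      assigned : Assigned C t (output υ)
      assigned = record { owner = owner′ ; foreign = foreign′ ; complete = complete′ }
        where
        owner′ : ∀ i → t i ∈ output υ i
        owner′ i with toℕ i ℕ.≟ 0
        ... | yes i≡0 = subst (t i ∈_) (sym (first i i≡0)) (D.old (subst (t i ∈_) (sym (single i i≡0)) (x∈⁅x⁆ (t i))))
        ... | no i≢0  = subst (t i ∈_) (sym (rest i i≢0)) (x∈⁅x⁆ (t i))
        foreign′ : ∀ i {x} → x ∈ output υ i → x ≡ t i ⊎ (toℕ i ≡ 0 × x ∈ C × ¬ (∃[ j ] t j ≡ x))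
        foreign′ i {x} x∈ with toℕ i ℕ.≟ 0
        ... | no i≢0  = inj₁ (x∈⁅y⁆⇒x≡y (t i) (subst (x ∈_) (rest i i≢0) x∈))
        ... | yes i≡0 = Sum.map
          (λ x∈S → x∈⁅y⁆⇒x≡y (t i) (subst (x ∈_) (single i i≡0) x∈S))
          (λ { (x∈C , x∉M) → i≡0 , subst (x ∈_) (Selected.cover selected) x∈C
                           , λ { (j , refl) → x∉M (marked⇐ j) } })
          (D.sound (subst (x ∈_) (first i i≡0) x∈))
        complete′ : ∀ {x} → x ∈ C → (∃[ j ] t j ≡ x) ⊎ (∃[ i ] x ∈ output υ i)
        complete′ {x} x∈C with Finₚ.any? (λ j → t j Fin.≟ x)
        ... | yes owned = inj₁ owned
        ... | no free   = inj₂ (Fin.fromℕ< 1≤k , subst (x ∈_) (sym (first _ (Finₚ.toℕ-fromℕ< 1≤k)))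
          (D.complete x z≤n (subst (x ∈_) (sym (Selected.cover selected)) x∈C) (free ∘ marked⇒)))

  algorithm-runs : ∀ {B} → n ℕ.≤ B → suc m ℕ.≤ B → k ℕ.* n ℕ.≤ B →
    Runs algorithm (initial R) (algorithmTime B) λ υ →
      Feasible (output υ) × (∀ v → IsOptimalValue v → objective (output υ) ≤ ((1# + 1#) + 1#) * v)
  algorithm-runs {B} n≤B m<B kn≤B =
    seq-runs (prepare-runs (ℕₚ.≤-trans k≤n n≤B)) λ τ₀ start →
    seq-runs (loop-runs Covering m B refl (ℕₚ.<⇒≤ m<B) start
      (λ e τ e<m _ inv → process-edge-runs e τ n≤B m<B e<m inv)) λ τ₁ covering →
    let module C = Covering covering in
    seq-runs (select-runs τ₁ n≤B C.output-row C.marked-row C.scratch-row C.cover-row refl C.empty) λ τ₂ selected →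
    let module S = Selected selected in
    seq-runs (remainder-runs τ₂ n≤B S.output-row S.marked-row S.cover-row) λ τ₃ remaining →
    weaken-runs ℕₚ.≤-refl
      (λ υ moved → output-correct {υ = υ} selected remaining moved (λ e → C.covered e z≤n)
        λ K K-cover → cover-bound C.nonneg C.almostSurely (C.bounded K K-cover))
      (move-runs τ₃ kn≤B (trans (Remaining.agree remaining 2 (ℕₚ.m≤m+n 3 8)) S.output-row))

corollary1 : ∀ {c ℓ₁ ℓ₂} (R : OrderedField c ℓ₁ ℓ₂) →
    let open OrderedField R using (1#) renaming (_+_ to _⊕_) in
    ∃[ P ] IsApproximationAlgorithm R ((1# ⊕ 1#) ⊕ 1#) P
corollary1 R = algorithm , proj₁ algorithmTime-bounded , proj₁ (proj₂ algorithmTime-bounded) , λ I →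
  let open Instance I
      bound = λ {x} (x≤ : x ℕ.≤ suc size) → ℕₚ.≤-trans x≤ (ℕₚ.m≤m*n (suc size) (suc size))
      n≤size = ℕₚ.m≤m+n n m
      (t , σ , runs , t≤ , feasible , approximate) = Correctness.algorithm-runs R I {iterationBound size}
        (bound (ℕₚ.m≤n⇒m≤1+n n≤size)) (bound (s≤s (ℕₚ.m≤n+m m n)))
        (ℕₚ.*-mono-≤ (ℕₚ.m≤n⇒m≤1+n (ℕₚ.≤-trans k≤n n≤size)) (ℕₚ.m≤n⇒m≤1+n n≤size))
  in t , σ , runs
   -- The polynomial bound asks for a size of at least 1, which follows from 1 ≤ k ≤ n.
   , ℕₚ.≤-trans t≤ (proj₂ (proj₂ algorithmTime-bounded) size (ℕₚ.≤-trans 1≤k (ℕₚ.≤-trans k≤n n≤size)))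
   , feasible , approximate
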